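{- Let $d\ge 1$ be an integer and let $\mathcal{F}^*$ be the interval subdivision of $(d-1)$-dimensional simplicial complexes. Then its transformation matrix $H_{\mathcal{F}^*}$ (a $(d+1)\times(d+1)$ real matrix) is totally positive, i.e. all minors of all orders of $H_{\mathcal{F}^*}$ are non-negative.
   Context: Rows and columns of matrices are indexed starting from $0$. All simplicial complexes are finite. For a $(d-1)$-dimensional simplicial complex $\Delta$ with $f_{i-1}$ faces of dimension $i-1$ ($f_{ -1}=1$), the $h$-vector $h^\Delta=(h_0,\dots,h_d)$ is defined by $\sum_{i=0}^d h_i x^i=\sum_{i=0}^d f_{i-1}x^i(1-x)^{d-i}$. The interval subdivision of $\Delta$ is the simplicial complex of all chains in the poset of closed intervals $[A,B]=\{C: A\subseteq C\subseteq B\}$, where $A\subseteq B$ are nonempty faces of $\Delta$, ordered by inclusion of intervals. Its transformation matrix $H_{\mathcal{F}^*}=[q_d(i,j)]_{0\le i,j\le d}$ is the matrix, depending only on $d$, such that $h^{\Delta'}=H_{\mathcal{F}^*}\,h^{\Delta}$ (column vectors) for every $(d-1)$-dimensional simplicial complex $\Delta$ with interval subdivision $\Delta'$. The following explicit description of $H_{\mathcal{F}^*}$ is known (Anwar and Nazir). Let $$p_d(i,j)=\sum_{r=0}^{i} r^j (r+1)^{d-j}(-1)^{i-r}\binom{d+1}{i-r}\quad(0\le i,j\le d,\ 0^0=1),$$ which are the entries of the transformation matrix of the barycentric subdivision, and let $P_{d,j}(x)=\sum_{i=0}^d p_d(i,j)x^i$ and $Q_{d,j}(x)=\sum_{i=0}^d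 q_d(i,j)x^i$. Then $Q_{d,j}(x)=E_2\big[(1+x)^dP_{d,j}(x)\big]$ for $0\le j\le d$, where $E_2\big[\sum_{k\ge0}c_kx^k\big]=\sum_{k\ge 0}c_{2k}x^k$. -}

module Defs where

open import Data.Empty using (⊥-elim)
open import Data.Fin using (Fin; zero; suc; toℕ)
import Data.Fin as Fin
import Data.Fin.Properties as Fin
open import Data.Fin.Subset
  using (Subset; inside; outside; _∈_; _⊆_; ∣_∣; Nonempty)
  renaming (⊥ to ∅)
open import Data.Fin.Subset.Properties
  using (_∈?_; _⊆?_; nonempty?; ∉⊥; ⊆-refl; ⊆-trans)
open import Data.Integer using (ℤ; +_; 0ℤ; 1ℤ; -1ℤ)
import Data.Integer as ℤ
open import Data.List
  using (List; []; _∷_; _++_; map; length; filter; lookup; cartesianProduct)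
open import Data.Nat using (ℕ; zero; suc; _∸_; _≤_)
import Data.Nat as ℕ
open import Data.Product using (∃; _×_; _,_; proj₁; proj₂)
open import Data.Rational using (ℚ; 0ℚ; 1ℚ; _/_)
import Data.Rational as ℚ
open import Data.Sum using (_⊎_)
open import Data.Vec using ([]; _∷_)
open import Data.Vec.Functional using (Vector; removeAt)
open import Level using (0ℓ)
open import Relation.Binary using (Rel; Monotonic₁)
import Relation.Binary as B
open import Relation.Binary.PropositionalEquality using (_≡_)
open import Relation.Nullary using (yes; no)
open import Relation.Nullary.Decidable using (_×-dec_; _⊎-dec_; _→-dec_; map′)
open import Relation.Unary using (Pred; Decidable)

open import Algebra.Definitions.RawMonoid ℚ.+-0-rawMonoid using () renaming (sum to sumℚ)
open import Algebra.Definitions.RawMonoid ℤ.+-0-rawMonoid using () renaming (sum to sumℤ)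
open import Algebra.Definitions.RawSemiring ℚ.+-*-rawSemiring using (_^_)

-- The ground set is Fin n; elements of it lying in no face are allowed.
-- Decidability of the face predicate makes the faces countable.

record SimplicialComplex (n : ℕ) : Set₁ where
  field
    Face     : Pred (Subset n) 0ℓ
    face?    : Decidable Face
    ∅-face   : Face ∅
    ⊆-closed : ∀ {σ τ} → σ ⊆ τ → Face τ → Face σ

open SimplicialComplex public

-- Dimension d - 1, expressed through the number d of vertices of a largest face.

HasRank : ∀ {n} → SimplicialComplex n → ℕ → Set
HasRank Δ d = (∃ λ σ → Face Δ σ × ∣ σ ∣ ≡ d) × (∀ σ → Face Δ σ → ∣ σ ∣ ≤ d)

subsets : ∀ n → List (Subset n)
subsets zero    = [] ∷ []
subsets (suc n) = map (outside ∷_) (subsets n) ++ map (inside ∷_) (subsets n)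

-- faces Δ i is f_{i-1}: the index is the number of vertices, not the dimension.

faces : ∀ {n} → SimplicialComplex n → ℕ → ℕ
faces {n} Δ i = length (filter (λ σ → face? Δ σ ×-dec (∣ σ ∣ ℕ.≟ i)) (subsets n))

-- Integer polynomials as coefficient sequences.

Poly : Set
Poly = ℕ → ℤ

infixl 7 _·_
infixr 8 _^ᵖ_

_·_ : Poly → Poly → Poly
(p · q) k = sumℤ {suc k} λ i → p (toℕ i) ℤ.* q (k ∸ toℕ i)

1ᵖ : Poly
1ᵖ zero    = 1ℤ
1ᵖ (suc _) = 0ℤ

X : Poly
X 1 = 1ℤ
X _ = 0ℤ

1-X : Poly
1-X 0 = 1ℤ
1-X 1 = -1ℤ
1-X _ = 0ℤ

_^ᵖ_ : Poly → ℕ → Poly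
p ^ᵖ zero  = 1ᵖ
p ^ᵖ suc n = p · p ^ᵖ n

-- Σ_{i=0}^{d} f_{i-1} x^i (1-x)^{d-i}; it has degree at most d.

hPolynomial : ∀ d {n} → SimplicialComplex n → Poly
hPolynomial d Δ k =
  sumℤ {suc d} λ i → (+ faces Δ (toℕ i)) ℤ.* (X ^ᵖ toℕ i · 1-X ^ᵖ (d ∸ toℕ i)) k

hVector : ∀ d {n} → SimplicialComplex n → Vector ℤ (suc d)
hVector d Δ i = hPolynomial d Δ (toℕ i)

-- Simplicial complex of the chains of a finite family xs, ordered by _≼_.
-- The vertices are the positions in xs.

orderComplex : {A : Set} {_≼_ : Rel A 0ℓ} → B.Decidable _≼_ →
               (xs : List A) → SimplicialComplex (length xs)
orderComplex {_≼_ = _≼_} _≼?_ xs = record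
  { Face     = λ S → ∀ i j → i ∈ S → j ∈ S →
                 (lookup xs i ≼ lookup xs j) ⊎ (lookup xs j ≼ lookup xs i)
  ; face?    = λ S → Fin.all? λ i → Fin.all? λ j → (i ∈? S) →-dec ((j ∈? S) →-dec
                 ((lookup xs i ≼? lookup xs j) ⊎-dec (lookup xs j ≼? lookup xs i)))
  ; ∅-face   = λ _ _ i∈∅ _ → ⊥-elim (∉⊥ i∈∅)
  ; ⊆-closed = λ σ⊆τ chain i j i∈σ j∈σ → chain i j (σ⊆τ i∈σ) (σ⊆τ j∈σ)
  }

module _ {n : ℕ} (Δ : SimplicialComplex n) where

  IsInterval : Pred (Subset n × Subset n) 0ℓ
  IsInterval (A , B) = (Face Δ A × Nonempty A) × (Face Δ B × Nonempty B) × A ⊆ B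

  isInterval? : Decidable IsInterval
  isInterval? (A , B) =
    (face? Δ A ×-dec nonempty? A) ×-dec (face? Δ B ×-dec nonempty? B) ×-dec (A ⊆? B)

  intervals : List (Subset n × Subset n)
  intervals = filter isInterval? (cartesianProduct (subsets n) (subsets n))

-- The pair (A , B) stands for [A,B] = {C : A ⊆ C ⊆ B}. A nonempty [A,B] determines A and B,
-- so every interval occurs exactly once in intervals Δ.

infix 4 _∈[_] _≼_ _≼?_

_∈[_] : ∀ {n} → Subset n → Subset n × Subset n → Set
C ∈[ A , B ] = A ⊆ C × C ⊆ B

_≼_ : ∀ {n} → Rel (Subset n × Subset n) 0ℓ
I ≼ J = ∀ C → C ∈[ I ] → C ∈[ J ]

_≼?_ : ∀ {n} → B.Decidable (_≼_ {n})
(A , B) ≼? (A′ , B′) with A ⊆? B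
... | no  A⊈B = yes λ C C∈I →
  ⊥-elim (A⊈B (⊆-trans {i = A} (proj₁ C∈I) (proj₂ C∈I)))
... | yes A⊆B = map′ to from ((A′ ⊆? A) ×-dec (B ⊆? B′))
  where
  to : A′ ⊆ A × B ⊆ B′ → (A , B) ≼ (A′ , B′)
  to p C q = ⊆-trans {i = A′} (proj₁ p) (proj₁ q) , ⊆-trans {i = C} (proj₂ q) (proj₂ p)

  from : (A , B) ≼ (A′ , B′) → A′ ⊆ A × B ⊆ B′
  from I≼J = proj₁ (I≼J A (⊆-refl {x = A} , A⊆B)) , proj₂ (I≼J B (A⊆B , ⊆-refl {x = B}))

intervalSubdivision : ∀ {n} (Δ : SimplicialComplex n) → SimplicialComplex (length (intervals Δ))
intervalSubdivision Δ = orderComplex _≼?_ (intervals Δ)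

Matrix : ℕ → ℕ → Set
Matrix m n = Fin m → Fin n → ℚ

det : ∀ {k} → Matrix k k → ℚ
det {zero}  M = 1ℚ
det {suc k} M = sumℚ λ j →
  (ℚ.- 1ℚ) ^ toℕ j ℚ.* M zero j ℚ.* det (λ r → removeAt (M (suc r)) j)

StrictlyIncreasing : ∀ {k n} → (Fin k → Fin n) → Set
StrictlyIncreasing = Monotonic₁ Fin._<_ Fin._<_

-- k ranges over all orders; increasing maps Fin k → Fin m exist only for k ≤ m.

TotallyPositive : ∀ {m n} → Matrix m n → Set
TotallyPositive {m} {n} M =
  ∀ {k} (r : Fin k → Fin m) (c : Fin k → Fin n) →
  StrictlyIncreasing r → StrictlyIncreasing c →
  0ℚ ℚ.≤ det (λ i j → M (r i) (c j))

-- The interval subdivision of a (d-1)-dimensional complex is again (d-1)-dimensional,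
-- so both h-vectors are taken with respect to d.

IsTransformationMatrix : ∀ d → Matrix (suc d) (suc d) → Set₁
IsTransformationMatrix d H =
  ∀ {n} (Δ : SimplicialComplex n) → HasRank Δ d → ∀ i →
  hVector d (intervalSubdivision Δ) i / 1 ≡ sumℚ λ j → H i j ℚ.* (hVector d Δ j / 1)

{-# OPTIONS --safe #-}

-- Let D and P be multiplication by 1 - x and 1 + x on power series. Interpolating the h-polynomial
-- through multichains of faces gives, for every complex of rank d with h-vector h,
--
--   Σ_j h_j r^j (r+1)^(d-j) = Σ_l f_{l-1} r^l =: F(r),   h = D^(d+1) of m ↦ Σ_l f_{l-1} C(m,l),
--
-- and the latter function, for the interval subdivision, is m ↦ Σ_{r ≤ 2m} (-1)^r F(r): a multichain
-- of m intervals is a multichain of 2m faces. Hence the j-th column of the transformation matrix is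
-- E₂ P^d D^(d+1) applied to r ↦ r^j (r+1)^(d-j). The skeleta of simplices have spanning h-vectors,
-- so there is no other transformation matrix.
--
-- Total positivity is preserved by nonnegative combinations of neighbouring rows, and the matrix arises
-- from the identity by such operations. The operator D^(d+1) sends
-- (r+1)⋯(r+d-i) · r(r-1)⋯(r-i+1) to d! x^i, and these polynomials are windows of d consecutive factors
-- in the knot sequence -d, …, -1, 0, …, d-1; the polynomials r^j (r+1)^(d-j) are the windows after all
-- negative knots have been moved to -1 and all others to 0. As in Boehm's knot insertion for B-splines,
-- moving one knot replaces every window by a convex combination of two neighbouring windows.
-- Finally P also combines neighbouring rows, and E₂ selects rows.

module Submission where

open import Algebra.Bundles using (CommutativeRing)
open import Data.Bool using (Bool; true; false; if_then_else_; _∧_; _∨_; not)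
import Data.Bool.Properties as Bool
open import Data.Empty using (⊥; ⊥-elim)
open import Data.Fin using (Fin; zero; suc; toℕ; punchIn)
import Data.Fin as Fin
import Data.Fin.Properties as Fin
open import Data.Fin.Subset using (Subset; inside; outside; _∈_; _⊆_; ∣_∣; Nonempty) renaming (⊥ to ∅; ⊤ to full)
open import Data.Fin.Subset.Properties using
  ( drop-∷-⊆; out⊆; s⊆s; ⊥⊆; p⊆q⇒∣p∣≤∣q∣; ∣⊥∣≡0; ∣⊤∣≡n
  ; ⊆-refl; ⊆-trans; ⊆-antisym; _⊆?_; nonempty? )
open import Data.Integer using (ℤ) renaming (+_ to pos)
import Data.Integer as ℤ
import Data.Integer.Properties as ℤ
open import Data.List using (List; []; _∷_; _++_; length; filter; lookup; cartesianProduct)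
import Data.List as List
open import Data.List.Membership.Propositional using () renaming (_∈_ to _∈ˡ_)
import Data.List.Membership.Propositional.Properties as ∈ˡ
import Data.List.Relation.Unary.All as All
open import Data.List.Relation.Unary.AllPairs using ([]; _∷_)
open import Data.List.Relation.Unary.Any using (here; there)
open import Data.List.Relation.Unary.Unique.Propositional using (Unique)
import Data.List.Relation.Unary.Unique.Propositional.Properties as Unique
open import Data.Nat using (ℕ; zero; suc; _∸_; _!; _≤_; z≤n; s≤s)
import Data.Nat as ℕ
open import Data.Nat.Combinatorics using (_C_; nCk+nC[k+1]≡[n+1]C[k+1])
import Data.Nat.Properties as ℕ
open import Data.Nat.Tactic.RingSolver using (solve-∀)
open import Data.Product using (_×_; _,_; proj₁; proj₂; ∃)
open import Data.Rational using (ℚ; 0ℚ; 1ℚ; _+_; _*_; _-_; -_; nonNegative; _/_; toℚᵘ)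
import Data.Rational as ℚ
open import Data.Rational.Properties
open import Data.Rational.Solver using (module +-*-Solver)
open import Data.Rational.Unnormalised using (mkℚᵘ; *≡*)
import Data.Rational.Unnormalised as ℚᵘ
import Data.Rational.Unnormalised.Properties as ℚᵘ
open import Data.Sum using (_⊎_; inj₁; inj₂)
open import Data.Unit using (⊤; tt)
open import Data.Vec using ([]; _∷_; here; there)
open import Data.Vec.Functional using (Vector; removeAt) renaming (_∷_ to _∷ᵛ_)
open import Data.Vec.Properties using (∷-injectiveʳ)
open import Function using (_∘_)
open import Relation.Binary.PropositionalEquality
open import Relation.Nullary using (Dec; yes; no; does; ¬_)
open import Relation.Nullary.Decidable using (dec-true; dec-false; _×-dec_)

open import Defs

open import Algebra.Definitions.RawMonoid ℚ.+-0-rawMonoid using () renaming (sum to sumℚ)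
open import Algebra.Definitions.RawMonoid ℤ.+-0-rawMonoid using () renaming (sum to sumℤ)
open import Algebra.Definitions.RawSemiring ℚ.+-*-rawSemiring using (_^_)
import Algebra.Properties.Semiring.Sum (CommutativeRing.semiring +-*-commutativeRing) as Sum
import Algebra.Properties.Semiring.Sum (CommutativeRing.semiring ℤ.+-*-commutativeRing) as ℤSum
open +-*-Solver using (solve; con; _:=_; _:+_; _:*_; _:-_; :-_)

-- F(r) counts the multichains of r faces, the empty face allowed: below a top face each vertex
-- chooses one of the r moments at which it enters. Hence F(r) - F(r-1) counts the multichains of r
-- nonempty faces, and for r = 2m these are the multichains of m intervals, with endpoints A_m ⊆ ⋯ ⊆
-- A_1 ⊆ B_1 ⊆ ⋯ ⊆ B_m. The binomial sum of an order complex counts the multichains of m elements in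
-- the poset with a bottom adjoined, so summing these differences over 1, ..., m and adding F(0)
-- yields the alternating sum.
--
-- Taking alternating partial sums is division by 1 + x, and (1 - x)^(d+1) passes inside E₂ as (1 -
-- x)^(d+1) (1 + x)^(d+1). One factor 1 + x cancels, which leaves the exponent in P^d.
--
-- Neighbouring windows differ in a single knot, -(p + 1) in one and q in the other, with p, q ≥ 0.
-- Both targets -1 and 0 lie between these two knots, so the weights of the insertion are
-- nonnegative.

nonNeg+ : ∀ {p q} → 0ℚ ℚ.≤ p → 0ℚ ℚ.≤ q → 0ℚ ℚ.≤ p + q
nonNeg+ = +-mono-≤

nonNeg* : ∀ {p q} → 0ℚ ℚ.≤ p → 0ℚ ℚ.≤ q → 0ℚ ℚ.≤ p * q
nonNeg* {p} {q} p≥0 q≥0 = nonNegative⁻¹ (p * q)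
  {{nonNeg*nonNeg⇒nonNeg p {{nonNegative p≥0}} q {{nonNegative q≥0}}}}

sum≡0 : ∀ {n} {t : Vector ℚ n} → (∀ i → t i ≡ 0ℚ) → sumℚ t ≡ 0ℚ
sum≡0 {n} t≡0 = trans (Sum.sum-cong-≗ t≡0) (Sum.sum-replicate-zero n)

sum-linear : ∀ {n} a b (s t : Vector ℚ n) →
  sumℚ (λ i → a * s i + b * t i) ≡ a * sumℚ s + b * sumℚ t
sum-linear a b s t = begin
  sumℚ (λ i → a * s i + b * t i)                   ≡⟨ Sum.∑-distrib-+ (λ i → a * s i) (λ i → b * t i) ⟩
  sumℚ (λ i → a * s i) + sumℚ (λ i → b * t i)      ≡⟨ cong₂ _+_ (Sum.*-distribˡ-sum a s) (Sum.*-distribˡ-sum b t) ⟨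
  a * sumℚ s + b * sumℚ t                          ∎
  where open ≡-Reasoning

-- Multilinearity of the determinant, and its vanishing for equal adjacent rows.

det-cong : ∀ {k} {M N : Matrix k k} → (∀ i j → M i j ≡ N i j) → det M ≡ det N
det-cong {zero}  M≗N = refl
det-cong {suc k} M≗N = Sum.sum-cong-≗ λ j →
  cong₂ _*_ (cong ((- 1ℚ) ^ toℕ j *_) (M≗N zero j)) (det-cong λ r i → M≗N (suc r) (punchIn j i))

-- Linearity is demanded in the first row only, and recursively in the later rows once the first is
-- fixed. This matches the expansion of `det` along its first row and avoids replacing a row at an
-- arbitrary index.
Multilinear : ∀ k {n} → ((Fin k → Vector ℚ n) → ℚ) → Set
Multilinear zero    f = ⊤
Multilinear (suc k) f =
  (∀ a b u v M → f ((λ j → a * u j + b * v j) ∷ᵛ M) ≡ a * f (u ∷ᵛ M) + b * f (v ∷ᵛ M)) ×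
  (∀ u → Multilinear k (λ M → f (u ∷ᵛ M)))

multilinear-cong : ∀ k {n} {f g : (Fin k → Vector ℚ n) → ℚ} →
  (∀ M → f M ≡ g M) → Multilinear k f → Multilinear k g
multilinear-cong zero    f≗g _       = tt
multilinear-cong (suc k) f≗g (l , m) =
  (λ a b u v M → trans (sym (f≗g _))
    (trans (l a b u v M) (cong₂ (λ p q → a * p + b * q) (f≗g _) (f≗g _)))) ,
  λ u → multilinear-cong k (λ M → f≗g (u ∷ᵛ M)) (m u)

multilinear-scale : ∀ k {n} c {f : (Fin k → Vector ℚ n) → ℚ} →
  Multilinear k f → Multilinear k (λ M → c * f M)
multilinear-scale zero    c _       = tt
multilinear-scale (suc k) c {f} (l , m) =
  (λ a b u v M → trans (cong (c *_) (l a b u v M))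
    (solve 5 (λ c a b p q → c :* (a :* p :+ b :* q) := a :* (c :* p) :+ b :* (c :* q)) refl
      c a b (f (u ∷ᵛ M)) (f (v ∷ᵛ M)))) ,
  λ u → multilinear-scale k c (m u)

multilinear-sum : ∀ k {n m} (f : Fin m → (Fin k → Vector ℚ n) → ℚ) →
  (∀ i → Multilinear k (f i)) → Multilinear k (λ M → sumℚ (λ i → f i M))
multilinear-sum zero    f _  = tt
multilinear-sum (suc k) f ml =
  (λ a b u v M → trans (Sum.sum-cong-≗ λ i → proj₁ (ml i) a b u v M)
    (sum-linear a b (λ i → f i (u ∷ᵛ M)) (λ i → f i (v ∷ᵛ M)))) ,
  λ u → multilinear-sum k (λ i M → f i (u ∷ᵛ M)) (λ i → proj₂ (ml i) u)

-- Without function extensionality a function of matrices need not respect entrywise equality, and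
-- splitting a matrix as `u ∷ᵛ M` reproduces it only entrywise.
Congruentᴹ : ∀ {k n} → ((Fin k → Vector ℚ n) → ℚ) → Set
Congruentᴹ f = ∀ {M N} → (∀ i j → M i j ≡ N i j) → f M ≡ f N

multilinear-reindex : ∀ k {n m} (π : Fin m → Fin n) {f : (Fin k → Vector ℚ m) → ℚ} →
  Congruentᴹ f → Multilinear k f → Multilinear k (λ M → f (λ r → M r ∘ π))
multilinear-reindex zero    π f-cong _       = tt
multilinear-reindex (suc k) π {f} f-cong (l , m) =
  (λ a b u v M → trans (f-cong (split _ M)) (trans (l a b (u ∘ π) (v ∘ π) (λ r → M r ∘ π))
     (cong₂ (λ p q → a * p + b * q) (sym (f-cong (split u M))) (sym (f-cong (split v M)))))) ,
  λ u → multilinear-cong k (λ M → sym (f-cong (split u M)))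
    (multilinear-reindex k π (λ M≗N → f-cong (λ { zero _ → refl ; (suc i) j → M≗N i j })) (m (u ∘ π)))
  where
  split : ∀ u M r j → (u ∷ᵛ M) r (π j) ≡ ((u ∘ π) ∷ᵛ (λ r → M r ∘ π)) r j
  split u M zero    j = refl
  split u M (suc r) j = refl

det-multilinear : ∀ k → Multilinear k (det {k})
det-multilinear zero    = tt
det-multilinear (suc k) =
  (λ a b u v M → trans
    (Sum.sum-cong-≗ λ j → solve 6 (λ s a p b q d → s :* (a :* p :+ b :* q) :* d :=
       a :* (s :* p :* d) :+ b :* (s :* q :* d)) refl
       ((- 1ℚ) ^ toℕ j) a (u j) b (v j) (det (λ r → removeAt (M r) j)))
    (sum-linear a b (λ j → (- 1ℚ) ^ toℕ j * u j * det (λ r → removeAt (M r) j))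
                    (λ j → (- 1ℚ) ^ toℕ j * v j * det (λ r → removeAt (M r) j)))) ,
  λ u → multilinear-sum k (λ j M → (- 1ℚ) ^ toℕ j * u j * det (λ r → removeAt (M r) j))
    λ j → multilinear-scale k ((- 1ℚ) ^ toℕ j * u j)
      (multilinear-reindex k (punchIn j) {f = det} det-cong (det-multilinear k))

-- Expanding every row gives 2^k terms, one for each choice `β`, whose coefficients are products of
-- the weights. Rows are expanded from the top, and each decision is prepended to `β`.
multilinear-nonNeg : ∀ k {n} {f : (Fin k → Vector ℚ n) → ℚ} →
  Congruentᴹ f → Multilinear k f →
  (a b : Fin k → ℚ) (u v : Fin k → Vector ℚ n) →
  (∀ i → 0ℚ ℚ.≤ a i) → (∀ i → 0ℚ ℚ.≤ b i) →
  (∀ (β : Fin k → Bool) → 0ℚ ℚ.≤ f (λ i → if β i then u i else v i)) →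
  0ℚ ℚ.≤ f (λ i j → a i * u i j + b i * v i j)
multilinear-nonNeg zero    f-cong _ a b u v _ _ h = subst (0ℚ ℚ.≤_) (f-cong λ ()) (h λ ())
multilinear-nonNeg (suc k) {f = f} f-cong (l , m) a b u v a≥0 b≥0 h =
  subst (0ℚ ℚ.≤_) (sym (trans (f-cong cons) (l (a zero) (b zero) (u zero) (v zero) _)))
    (nonNeg+ (nonNeg* (a≥0 zero) (rest (u zero) true λ _ → refl))
             (nonNeg* (b≥0 zero) (rest (v zero) false λ _ → refl)))
  where
  R : Fin k → Vector ℚ _
  R i j = a (suc i) * u (suc i) j + b (suc i) * v (suc i) j

  cons : ∀ i j → a i * u i j + b i * v i j ≡ ((λ j → a zero * u zero j + b zero * v zero j) ∷ᵛ R) i j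
  cons zero    j = refl
  cons (suc i) j = refl

  rest : ∀ w β₀ → (∀ j → (if β₀ then u zero else v zero) j ≡ w j) → 0ℚ ℚ.≤ f (w ∷ᵛ R)
  rest w β₀ w≡ = multilinear-nonNeg k (λ M≗N → f-cong (λ { zero _ → refl ; (suc i) j → M≗N i j }))
    (m w) (a ∘ suc) (b ∘ suc) (u ∘ suc) (v ∘ suc) (a≥0 ∘ suc) (b≥0 ∘ suc)
    λ β → subst (0ℚ ℚ.≤_) (f-cong λ { zero j → w≡ j ; (suc i) j → refl }) (h (β₀ ∷ᵛ β))

-- The choices of columns i < j and j < i for the two equal rows x cancel.

equal-rows-expansion : ∀ n (x : Vector ℚ (suc (suc n))) (G : (Fin n → Fin (suc (suc n))) → ℚ) →
  (∀ {π ρ} → (∀ a → π a ≡ ρ a) → G π ≡ G ρ) →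
  sumℚ (λ i → (- 1ℚ) ^ toℕ i * x i *
    sumℚ (λ j → (- 1ℚ) ^ toℕ j * x (punchIn i j) * G (λ a → punchIn i (punchIn j a)))) ≡ 0ℚ
equal-rows-expansion n x G G-cong = begin
  1ℚ * x zero * P + sumℚ Q
    ≡⟨ cong (λ z → 1ℚ * x zero * P + z) (Sum.sum-cong-≗ Q≗) ⟩
  1ℚ * x zero * P + sumℚ (λ i → (- x zero) * p i + (- 1ℚ) * q i)
    ≡⟨ cong (λ z → 1ℚ * x zero * P + z) (sum-linear (- x zero) (- 1ℚ) p q) ⟩
  1ℚ * x zero * P + ((- x zero) * sumℚ p + (- 1ℚ) * sumℚ q)
    ≡⟨ cong (λ z → 1ℚ * x zero * P + ((- x zero) * sumℚ p + (- 1ℚ) * z)) (inner n x G G-cong) ⟩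
  1ℚ * x zero * P + ((- x zero) * P + (- 1ℚ) * 0ℚ)
    ≡⟨ solve 2 (λ y P → con 1ℚ :* y :* P :+ ((:- y) :* P :+ con (- 1ℚ) :* con 0ℚ) := con 0ℚ) refl (x zero) P ⟩
  0ℚ ∎
  where
  open ≡-Reasoning
  s : ∀ {m} → Fin m → ℚ
  s i = (- 1ℚ) ^ toℕ i

  p q Q : Fin (suc n) → ℚ
  p i = s i * x (suc i) * G (λ a → suc (punchIn i a))
  q i = s i * x (suc i) * sumℚ (λ j → s (suc j) * x (suc (punchIn i j)) *
    G (λ a → punchIn (suc i) (punchIn (suc j) a)))
  Q i = s (suc i) * x (suc i) *
    sumℚ (λ j → s j * x (punchIn (suc i) j) * G (λ a → punchIn (suc i) (punchIn j a)))

  P : ℚ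
  P = sumℚ p

  -- The inner term j = 0 is minus `x zero * p i` and cancels the term of `x zero * P` that takes
  -- column 0 first. The remaining terms avoid column 0 and are collected in `q`.
  Q≗ : ∀ i → Q i ≡ (- x zero) * p i + (- 1ℚ) * q i
  Q≗ i = solve 5 (λ s y x g r → (con (- 1ℚ) :* s) :* y :* (con 1ℚ :* x :* g :+ r) :=
      (:- x) :* (s :* y :* g) :+ con (- 1ℚ) :* (s :* y :* r)) refl
    (s i) (x (suc i)) (x zero) (G (λ a → suc (punchIn i a)))
    (sumℚ (λ j → s (suc j) * x (suc (punchIn i j)) * G (λ a → punchIn (suc i) (punchIn (suc j) a))))

  inner : ∀ n (x : Vector ℚ (suc (suc n))) (G : (Fin n → Fin (suc (suc n))) → ℚ) →
    (∀ {π ρ} → (∀ a → π a ≡ ρ a) → G π ≡ G ρ) →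
    sumℚ (λ (i : Fin (suc n)) → s i * x (suc i) * sumℚ (λ j → s (suc j) * x (suc (punchIn i j)) *
      G (λ a → punchIn (suc i) (punchIn (suc j) a)))) ≡ 0ℚ
  inner zero    x G G-cong = sum≡0 λ i → *-zeroʳ (s i * x (suc i))
  inner (suc n) x G G-cong = begin
    sumℚ (λ i → s i * x (suc i) * sumℚ (λ j → s (suc j) * x (suc (punchIn i j)) *
      G (λ a → punchIn (suc i) (punchIn (suc j) a))))
      ≡⟨ Sum.sum-cong-≗ (λ i → trans (cong (s i * x (suc i) *_) (neg i))
           (solve 2 (λ a b → a :* (con (- 1ℚ) :* b) := con (- 1ℚ) :* (a :* b)) refl (s i * x (suc i)) (r i))) ⟩
    sumℚ (λ i → - 1ℚ * (s i * x (suc i) * r i))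
      ≡⟨ Sum.*-distribˡ-sum (- 1ℚ) (λ i → s i * x (suc i) * r i) ⟨
    - 1ℚ * sumℚ (λ i → s i * x (suc i) * r i)
      ≡⟨ cong (- 1ℚ *_) (equal-rows-expansion n (x ∘ suc) G′
           λ π≗ρ → G-cong λ { zero → refl ; (suc a) → cong suc (π≗ρ a) }) ⟩
    0ℚ ∎
    where
    -- Column 0 is chosen by neither row, so it stays the first of the remaining columns.
    G′ : (Fin n → Fin (suc (suc n))) → ℚ
    G′ π = G (zero ∷ᵛ suc ∘ π)

    r : Fin (suc (suc n)) → ℚ
    r i = sumℚ λ j → s j * x (suc (punchIn i j)) * G′ (λ a → punchIn i (punchIn j a))

    neg : ∀ i → sumℚ (λ j → s (suc j) * x (suc (punchIn i j)) *
      G (λ a → punchIn (suc i) (punchIn (suc j) a))) ≡ - 1ℚ * r i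
    neg i = trans (Sum.sum-cong-≗ λ j → trans
        (cong (s (suc j) * x (suc (punchIn i j)) *_) (G-cong {λ a → punchIn (suc i) (punchIn (suc j) a)} {zero ∷ᵛ λ a → suc (punchIn i (punchIn j a))}
          λ { zero → refl ; (suc a) → refl }))
        (solve 3 (λ s x g → con (- 1ℚ) :* s :* x :* g := con (- 1ℚ) :* (s :* x :* g)) refl
          (s j) (x (suc (punchIn i j))) (G′ (λ a → punchIn i (punchIn j a)))))
      (sym (Sum.*-distribˡ-sum (- 1ℚ) (λ j → s j * x (suc (punchIn i j)) * G′ (λ a → punchIn i (punchIn j a)))))

det-equal-rows : ∀ {k} (M : Matrix (suc k) (suc k)) (i : Fin k) →
  (∀ j → M (Fin.inject₁ i) j ≡ M (suc i) j) → det M ≡ 0ℚ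
det-equal-rows {suc k} M zero M≡ = trans
  (Sum.sum-cong-≗ λ j → cong ((- 1ℚ) ^ toℕ j * M zero j *_)
    (Sum.sum-cong-≗ λ i → cong (λ z → (- 1ℚ) ^ toℕ i * z * det (λ r a → M (suc (suc r)) (punchIn j (punchIn i a))))
      (sym (M≡ (punchIn j i)))))
  (equal-rows-expansion k (M zero) (λ π → det λ r a → M (suc (suc r)) (π a))
    λ π≗ρ → det-cong λ r a → cong (M (suc (suc r))) (π≗ρ a))
det-equal-rows {suc k} M (suc i) M≡ = sum≡0 λ j →
  trans (cong ((- 1ℚ) ^ toℕ j * M zero j *_)
          (det-equal-rows (λ r → removeAt (M (suc r)) j) i λ a → M≡ (punchIn j a)))
        (*-zeroʳ ((- 1ℚ) ^ toℕ j * M zero j))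

det-zero-column : ∀ {k} (M : Matrix (suc k) (suc k)) → (∀ i → M i zero ≡ 0ℚ) → det M ≡ 0ℚ
det-zero-column {k} M M≡0 = sum≡0 (term k M M≡0)
  where
  term : ∀ k (M : Matrix (suc k) (suc k)) → (∀ i → M i zero ≡ 0ℚ) → ∀ j →
    (- 1ℚ) ^ toℕ j * M zero j * det (λ r → removeAt (M (suc r)) j) ≡ 0ℚ
  term k       M M≡0 zero    = trans (cong (λ z → 1ℚ * z * det (λ r → removeAt (M (suc r)) zero)) (M≡0 zero))
    (*-zeroˡ (det (λ r → removeAt (M (suc r)) zero)))
  term (suc k) M M≡0 (suc j) = trans
    (cong ((- 1ℚ) ^ toℕ (suc j) * M zero (suc j) *_)
      (sum≡0 (term k (λ r → removeAt (M (suc r)) (suc j)) (M≡0 ∘ suc))))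
    (*-zeroʳ ((- 1ℚ) ^ toℕ (suc j) * M zero (suc j)))

-- Total positivity and nonnegative combinations of rows.

-- Rows are indexed by all of ℕ because the row operations do not respect a finite range:
-- multiplication by 1 + x raises degrees, and moving a knot may refer to row i + 1.
TotallyPositiveℕ : ∀ {n} → (ℕ → Vector ℚ n) → Set
TotallyPositiveℕ {n} M = ∀ {k} (r : Fin k → ℕ) (c : Fin k → Fin n) →
  (∀ {i j} → i Fin.< j → r i ℕ.< r j) → StrictlyIncreasing c →
  0ℚ ℚ.≤ det (λ i j → M (r i) (c j))

identity : ∀ {n} → ℕ → Vector ℚ n
identity i j with i ℕ.≟ toℕ j
... | yes _ = 1ℚ
... | no  _ = 0ℚ

identity-diagonal : ∀ {n} {i} {j : Fin n} → i ≡ toℕ j → identity i j ≡ 1ℚ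
identity-diagonal {i = i} {j} i≡j with i ℕ.≟ toℕ j
... | yes _  = refl
... | no i≢j = ⊥-elim (i≢j i≡j)

identity-off-diagonal : ∀ {n} {i} {j : Fin n} → i ≢ toℕ j → identity i j ≡ 0ℚ
identity-off-diagonal {i = i} {j} i≢j with i ℕ.≟ toℕ j
... | yes i≡j = ⊥-elim (i≢j i≡j)
... | no _    = refl

-- If the first row has its 1 in a later column, `r zero ≡ toℕ (c (suc j))`, then all further rows
-- have an index above `c zero`, so the complementary minor has a zero first column. Only the
-- leading term of the expansion survives.
identity-totallyPositive : ∀ {n} → TotallyPositiveℕ (identity {n})
identity-totallyPositive {n} {zero}  r c r↑ c↑ = nonNegative⁻¹ 1ℚ
identity-totallyPositive {n} {suc k} r c r↑ c↑ = subst (0ℚ ℚ.≤_) (sym (trans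
    (cong (λ z → 1ℚ * identity (r zero) (c zero) * minor zero + z) (sum≡0 tail≡0)) (+-identityʳ _))) head≥0
  where
  minor : Fin (suc k) → ℚ
  minor j = det (λ i a → identity {n} (r (suc i)) (c (punchIn j a)))

  head≥0 : 0ℚ ℚ.≤ 1ℚ * identity (r zero) (c zero) * minor zero
  head≥0 with r zero ℕ.≟ toℕ (c zero)
  ... | yes _ = subst (0ℚ ℚ.≤_) (sym (*-identityˡ (minor zero)))
                  (identity-totallyPositive (r ∘ suc) (c ∘ suc) (r↑ ∘ s≤s) (c↑ ∘ s≤s))
  ... | no  _ = ≤-reflexive (sym (*-zeroˡ (minor zero)))

  tail≡0 : ∀ j → (- 1ℚ) ^ toℕ (suc j) * identity (r zero) (c (suc j)) * minor (suc j) ≡ 0ℚ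
  tail≡0 j with r zero ℕ.≟ toℕ (c (suc j))
  ... | no  _   = trans (cong (_* minor (suc j)) (*-zeroʳ ((- 1ℚ) ^ toℕ (suc j)))) (*-zeroˡ (minor (suc j)))
  ... | yes r≡c = trans (cong ((- 1ℚ) ^ toℕ (suc j) * 1ℚ *_) (minor≡0 k refl)) (*-zeroʳ ((- 1ℚ) ^ toℕ (suc j) * 1ℚ))
    where
    minor≡0 : ∀ k′ → k ≡ k′ → minor (suc j) ≡ 0ℚ
    minor≡0 (suc k′) refl = det-zero-column (λ i a → identity (r (suc i)) (c (punchIn (suc j) a)))
      λ i → identity-off-diagonal (ℕ.>⇒≢ (ℕ.<-trans (c↑ (s≤s z≤n)) (subst (ℕ._< r (suc i)) r≡c (r↑ (s≤s z≤n)))))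

-- Weakly increasing row indices either are strictly increasing or repeat a row.

weakly-increasing-nonNeg : ∀ {n} {M : ℕ → Vector ℚ n} → TotallyPositiveℕ M →
  ∀ {k} (s : Fin k → ℕ) (c : Fin k → Fin n) → (∀ {i j} → i Fin.< j → s i ℕ.≤ s j) →
  StrictlyIncreasing c → 0ℚ ℚ.≤ det (λ i j → M (s i) (c j))
weakly-increasing-nonNeg M-tp {zero} s c s↑ c↑ = M-tp s c (λ {}) (λ {i} → c↑ {i})
weakly-increasing-nonNeg {n} {M} M-tp {suc k} s c s↑ c↑
  with Fin.any? (λ i → s (Fin.inject₁ i) ℕ.≟ s (suc i))
... | yes (i , s≡) = ≤-reflexive (sym (det-equal-rows (λ i j → M (s i) (c j)) i λ j → cong (λ z → M z (c j)) s≡))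
... | no  s≢       = M-tp s c (strict s s↑ λ i s≡ → s≢ (i , s≡)) c↑
  where
  strict : ∀ {k} (s : Fin (suc k) → ℕ) → (∀ {i j} → i Fin.< j → s i ℕ.≤ s j) →
    (∀ i → s (Fin.inject₁ i) ≢ s (suc i)) → ∀ {i j} → i Fin.< j → s i ℕ.< s j
  strict {suc k} s s↑ s≢ {zero}  {suc zero}    _ = ℕ.≤∧≢⇒< (s↑ (s≤s z≤n)) (s≢ zero)
  strict {suc k} s s↑ s≢ {zero}  {suc (suc j)} _ =
    ℕ.<-≤-trans (ℕ.≤∧≢⇒< (s↑ (s≤s z≤n)) (s≢ zero)) (s↑ (s≤s (s≤s z≤n)))
  strict {suc k} s s↑ s≢ {suc i} {suc j} (s≤s i<j) =
    strict (s ∘ suc) (s↑ ∘ s≤s) (s≢ ∘ suc) i<j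

-- By multilinearity a minor of the combined rows is a nonnegative combination of determinants in
-- which each row is either `lo` or `hi`. The interlacing `hi i ≤ lo j` makes every such choice
-- weakly increasing. With `lo` and `hi` equal this is scaling of rows.
combine-rows-totallyPositive : ∀ {n} {M : ℕ → Vector ℚ n} → TotallyPositiveℕ M →
  (lo hi : ℕ → ℕ) → (∀ i → lo i ℕ.≤ hi i) → (∀ {i j} → i ℕ.< j → hi i ℕ.≤ lo j) →
  (a b : ℕ → ℚ) → (∀ i → 0ℚ ℚ.≤ a i) → (∀ i → 0ℚ ℚ.≤ b i) →
  TotallyPositiveℕ (λ i j → a i * M (lo i) j + b i * M (hi i) j)
combine-rows-totallyPositive {M = M} M-tp lo hi lo≤hi hi≤lo a b a≥0 b≥0 {k} r c r↑ c↑ =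
  multilinear-nonNeg k {f = det} det-cong (det-multilinear k) (a ∘ r) (b ∘ r)
    (λ i j → M (lo (r i)) (c j)) (λ i j → M (hi (r i)) (c j)) (a≥0 ∘ r) (b≥0 ∘ r)
    λ β → subst (0ℚ ℚ.≤_) (det-cong (select β))
      (weakly-increasing-nonNeg {M = M} M-tp (s β) c (s↑ β) c↑)
  where
  s : (Fin k → Bool) → Fin k → ℕ
  s β i = if β i then lo (r i) else hi (r i)

  select : ∀ β i j → M (s β i) (c j) ≡
    (if β i then (λ j → M (lo (r i)) (c j)) else (λ j → M (hi (r i)) (c j))) j
  select β i j with β i
  ... | true  = refl
  ... | false = refl

  s≤hi : ∀ β i → s β i ℕ.≤ hi (r i)
  s≤hi β i with β i
  ... | true  = lo≤hi (r i)
  ... | false = ℕ.≤-refl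

  lo≤s : ∀ β i → lo (r i) ℕ.≤ s β i
  lo≤s β i with β i
  ... | true  = ℕ.≤-refl
  ... | false = lo≤hi (r i)

  s↑ : ∀ β {i j} → i Fin.< j → s β i ℕ.≤ s β j
  s↑ β {i} {j} i<j = ℕ.≤-trans (s≤hi β i) (ℕ.≤-trans (hi≤lo (r↑ i<j)) (lo≤s β j))

-- Integers and natural numbers inside the rationals.

fromℤ : ℤ → ℚ
fromℤ z = z / 1

fromℤ-+ : ∀ a b → fromℤ (a ℤ.+ b) ≡ fromℤ a + fromℤ b
fromℤ-+ a b = toℚᵘ-injective (begin
  toℚᵘ (fromℤ (a ℤ.+ b))                 ≈⟨ toℚᵘ-fromℚᵘ (mkℚᵘ (a ℤ.+ b) 0) ⟩
  mkℚᵘ (a ℤ.+ b) 0                       ≈⟨ *≡* (cong (ℤ._* pos 1) (sym (cong₂ ℤ._+_ (ℤ.*-identityʳ a) (ℤ.*-identityʳ b)))) ⟩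
  mkℚᵘ a 0 ℚᵘ.+ mkℚᵘ b 0                 ≈⟨ ℚᵘ.+-cong (toℚᵘ-fromℚᵘ (mkℚᵘ a 0)) (toℚᵘ-fromℚᵘ (mkℚᵘ b 0)) ⟨
  toℚᵘ (fromℤ a) ℚᵘ.+ toℚᵘ (fromℤ b)     ≈⟨ toℚᵘ-homo-+ (fromℤ a) (fromℤ b) ⟨
  toℚᵘ (fromℤ a + fromℤ b)               ∎)
  where open ℚᵘ.≃-Reasoning

fromℤ-* : ∀ a b → fromℤ (a ℤ.* b) ≡ fromℤ a * fromℤ b
fromℤ-* a b = toℚᵘ-injective (begin
  toℚᵘ (fromℤ (a ℤ.* b))                 ≈⟨ toℚᵘ-fromℚᵘ (mkℚᵘ (a ℤ.* b) 0) ⟩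
  mkℚᵘ a 0 ℚᵘ.* mkℚᵘ b 0                 ≈⟨ ℚᵘ.*-cong (toℚᵘ-fromℚᵘ (mkℚᵘ a 0)) (toℚᵘ-fromℚᵘ (mkℚᵘ b 0)) ⟨
  toℚᵘ (fromℤ a) ℚᵘ.* toℚᵘ (fromℤ b)     ≈⟨ toℚᵘ-homo-* (fromℤ a) (fromℤ b) ⟨
  toℚᵘ (fromℤ a * fromℤ b)               ∎)
  where open ℚᵘ.≃-Reasoning

fromℕ : ℕ → ℚ
fromℕ n = fromℤ (pos n)

fromℕ-suc : ∀ n → fromℕ (suc n) ≡ 1ℚ + fromℕ n
fromℕ-suc n = fromℤ-+ (pos 1) (pos n)

fromℕ-+ : ∀ m n → fromℕ (m ℕ.+ n) ≡ fromℕ m + fromℕ n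
fromℕ-+ m n = fromℤ-+ (pos m) (pos n)

fromℕ-* : ∀ m n → fromℕ (m ℕ.* n) ≡ fromℕ m * fromℕ n
fromℕ-* m n = trans (cong fromℤ (ℤ.pos-* m n)) (fromℤ-* (pos m) (pos n))

fromℕ-nonNeg : ∀ n → 0ℚ ℚ.≤ fromℕ n
fromℕ-nonNeg n = nonNegative⁻¹ (fromℕ n) {{normalize-nonNeg n 1}}

1/suc : ℕ → ℚ
1/suc n = pos 1 / suc n

1/suc-inverse : ∀ n → 1/suc n * fromℕ (suc n) ≡ 1ℚ
1/suc-inverse n = toℚᵘ-injective (begin
  toℚᵘ (1/suc n * fromℕ (suc n))               ≈⟨ toℚᵘ-homo-* (1/suc n) (fromℕ (suc n)) ⟩
  toℚᵘ (1/suc n) ℚᵘ.* toℚᵘ (fromℕ (suc n))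
    ≈⟨ ℚᵘ.*-cong (toℚᵘ-fromℚᵘ (mkℚᵘ (pos 1) n)) (toℚᵘ-fromℚᵘ (mkℚᵘ (pos (suc n)) 0)) ⟩
  mkℚᵘ (pos 1) n ℚᵘ.* mkℚᵘ (pos (suc n)) 0           ≈⟨ *≡* (cong pos (trans (ℕ.*-identityʳ (suc n ℕ.+ 0)) (sym (trans (ℕ.*-identityˡ (suc n ℕ.* 1)) (ℕ.*-comm (suc n) 1))))) ⟩
  toℚᵘ 1ℚ ∎)
  where open ℚᵘ.≃-Reasoning

1/suc-nonNeg : ∀ n → 0ℚ ℚ.≤ 1/suc n
1/suc-nonNeg n = nonNegative⁻¹ (1/suc n) {{normalize-nonNeg 1 (suc n)}}

-- Finite sums over 0, ..., n.

∑ : ℕ → (ℕ → ℚ) → ℚ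
∑ zero    f = f zero
∑ (suc n) f = ∑ n f + f (suc n)

∑-cong : ∀ n {f g : ℕ → ℚ} → (∀ {i} → i ℕ.≤ n → f i ≡ g i) → ∑ n f ≡ ∑ n g
∑-cong zero    f≗g = f≗g z≤n
∑-cong (suc n) f≗g = cong₂ _+_ (∑-cong n (f≗g ∘ ℕ.m≤n⇒m≤1+n)) (f≗g ℕ.≤-refl)

∑-+ : ∀ n (f g : ℕ → ℚ) → ∑ n (λ i → f i + g i) ≡ ∑ n f + ∑ n g
∑-+ zero    f g = refl
∑-+ (suc n) f g = trans (cong (_+ (f (suc n) + g (suc n))) (∑-+ n f g))
  (solve 4 (λ F G x y → (F :+ G) :+ (x :+ y) := (F :+ x) :+ (G :+ y)) refl (∑ n f) (∑ n g) (f (suc n)) (g (suc n)))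

∑-* : ∀ n a (f : ℕ → ℚ) → ∑ n (λ i → a * f i) ≡ a * ∑ n f
∑-* zero    a f = refl
∑-* (suc n) a f = trans (cong (_+ a * f (suc n)) (∑-* n a f)) (sym (*-distribˡ-+ a (∑ n f) (f (suc n))))

∑-swap : ∀ m n (f : ℕ → ℕ → ℚ) → ∑ m (λ i → ∑ n (f i)) ≡ ∑ n (λ j → ∑ m (λ i → f i j))
∑-swap zero    n f = refl
∑-swap (suc m) n f = trans (cong (_+ ∑ n (f (suc m))) (∑-swap m n f))
  (sym (∑-+ n (λ j → ∑ m (λ i → f i j)) (f (suc m))))

∑-first : ∀ n (f : ℕ → ℚ) → ∑ (suc n) f ≡ f zero + ∑ n (f ∘ suc)
∑-first zero    f = refl
∑-first (suc n) f = trans (cong (_+ f (suc (suc n))) (∑-first n f)) (+-assoc (f zero) (∑ n (f ∘ suc)) (f (suc (suc n))))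

sumℚ≡∑ : ∀ n (f : ℕ → ℚ) → sumℚ {suc n} (f ∘ toℕ) ≡ ∑ n f
sumℚ≡∑ zero    f = +-identityʳ (f zero)
sumℚ≡∑ (suc n) f = trans (cong (f zero +_) (sumℚ≡∑ n (f ∘ suc))) (sym (∑-first n f))

∑-zero : ∀ n {f : ℕ → ℚ} → (∀ {i} → i ℕ.≤ n → f i ≡ 0ℚ) → ∑ n f ≡ 0ℚ
∑-zero zero    f≡0 = f≡0 z≤n
∑-zero (suc n) f≡0 = cong₂ _+_ (∑-zero n (f≡0 ∘ ℕ.m≤n⇒m≤1+n)) (f≡0 ℕ.≤-refl)

∑-single : ∀ {n k} {f : ℕ → ℚ} → k ℕ.≤ n → (∀ {i} → i ℕ.≤ n → i ≢ k → f i ≡ 0ℚ) → ∑ n f ≡ f k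
∑-single {zero}          z≤n f≡0 = refl
∑-single {suc n} {k} {f} k≤n f≡0 with k ℕ.≟ suc n
... | yes refl = trans (cong (_+ f (suc n)) (∑-zero n λ i≤n → f≡0 (ℕ.m≤n⇒m≤1+n i≤n) (ℕ.<⇒≢ (s≤s i≤n)))) (+-identityˡ (f (suc n)))
... | no  k≢n  = trans (cong₂ _+_ (∑-single (ℕ.≤-pred (ℕ.≤∧≢⇒< k≤n k≢n)) (f≡0 ∘ ℕ.m≤n⇒m≤1+n)) (f≡0 ℕ.≤-refl (k≢n ∘ sym))) (+-identityʳ (f k))

-- Power series and linear operators on them.

-- Power series are identified with their coefficient sequences; ∇ and pairSum are
-- multiplication by 1 - x and 1 + x.

Seq : Set
Seq = ℕ → ℚ

shift ∇ pairSum even : Seq → Seq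
shift f zero    = 0ℚ
shift f (suc k) = f k
∇ f zero    = f zero
∇ f (suc k) = f (suc k) - f k
pairSum f zero    = f zero
pairSum f (suc k) = f (suc k) + f k

double : ℕ → ℕ
double zero    = zero
double (suc k) = suc (suc (double k))

even f k = f (double k)

one : Seq
one zero    = 1ℚ
one (suc _) = 0ℚ

iter : (Seq → Seq) → ℕ → Seq → Seq
iter T zero    f = f
iter T (suc n) f = T (iter T n f)

-- Pointwise congruence is a field of its own: without function extensionality an operator on
-- sequences need not respect `_≗_`.
record Linear (T : Seq → Seq) : Set where
  field
    cong-≗ : ∀ {f g} → f ≗ g → T f ≗ T g
    linear : ∀ a b f g → T (λ k → a * f k + b * g k) ≗ (λ k → a * T f k + b * T g k)

open Linear

shift-linear : Linear shift
shift-linear .cong-≗ f≗g zero    = refl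
shift-linear .cong-≗ f≗g (suc k) = f≗g k
shift-linear .linear a b f g zero    = solve 2 (λ a b → con 0ℚ := a :* con 0ℚ :+ b :* con 0ℚ) refl a b
shift-linear .linear a b f g (suc k) = refl

∇-linear : Linear ∇
∇-linear .cong-≗ f≗g zero    = f≗g zero
∇-linear .cong-≗ f≗g (suc k) = cong₂ _-_ (f≗g (suc k)) (f≗g k)
∇-linear .linear a b f g zero    = refl
∇-linear .linear a b f g (suc k) =
  solve 6 (λ a b x y z w → (a :* x :+ b :* y) :- (a :* z :+ b :* w) := a :* (x :- z) :+ b :* (y :- w)) refl
    a b (f (suc k)) (g (suc k)) (f k) (g k)

pairSum-linear : Linear pairSum
pairSum-linear .cong-≗ f≗g zero    = f≗g zero
pairSum-linear .cong-≗ f≗g (suc k) = cong₂ _+_ (f≗g (suc k)) (f≗g k)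
pairSum-linear .linear a b f g zero    = refl
pairSum-linear .linear a b f g (suc k) =
  solve 6 (λ a b x y z w → (a :* x :+ b :* y) :+ (a :* z :+ b :* w) := a :* (x :+ z) :+ b :* (y :+ w)) refl
    a b (f (suc k)) (g (suc k)) (f k) (g k)

even-linear : Linear even
even-linear .cong-≗ f≗g k       = f≗g (double k)
even-linear .linear a b f g k   = refl

∘-linear : ∀ {T U} → Linear T → Linear U → Linear (T ∘ U)
∘-linear T-lin U-lin .cong-≗ f≗g = T-lin .cong-≗ (U-lin .cong-≗ f≗g)
∘-linear {T} {U} T-lin U-lin .linear a b f g k =
  trans (T-lin .cong-≗ (U-lin .linear a b f g) k) (T-lin .linear a b (U f) (U g) k)

iter-linear : ∀ {T} → Linear T → ∀ n → Linear (iter T n)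
iter-linear T-lin zero    .cong-≗ f≗g      = f≗g
iter-linear T-lin zero    .linear a b f g k = refl
iter-linear T-lin (suc n) = ∘-linear T-lin (iter-linear T-lin n)

linear-scale : ∀ {T} → Linear T → ∀ a f → T (λ k → a * f k) ≗ (λ k → a * T f k)
linear-scale {T} T-lin a f k = begin
  T (λ k → a * f k) k                 ≡⟨ T-lin .cong-≗ (λ k → sym (drop (f k))) k ⟩
  T (λ k → a * f k + 0ℚ * f k) k      ≡⟨ T-lin .linear a 0ℚ f f k ⟩
  a * T f k + 0ℚ * T f k              ≡⟨ drop (T f k) ⟩
  a * T f k                           ∎
  where
  open ≡-Reasoning
  drop : ∀ x → a * x + 0ℚ * x ≡ a * x
  drop = solve 2 (λ a x → a :* x :+ con 0ℚ :* x := a :* x) refl a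

linear-∑ : ∀ {T} → Linear T → ∀ n (c : ℕ → ℚ) (f : ℕ → Seq) →
  T (λ k → ∑ n (λ i → c i * f i k)) ≗ (λ k → ∑ n (λ i → c i * T (f i) k))
linear-∑ T-lin zero    c f k = linear-scale T-lin (c zero) (f zero) k
linear-∑ {T} T-lin (suc n) c f k = begin
  T (λ k → F k + c (suc n) * f (suc n) k) k        ≡⟨ T-lin .cong-≗ (λ k → cong (_+ c (suc n) * f (suc n) k) (sym (*-identityˡ (F k)))) k ⟩
  T (λ k → 1ℚ * F k + c (suc n) * f (suc n) k) k   ≡⟨ T-lin .linear 1ℚ (c (suc n)) F (f (suc n)) k ⟩
  1ℚ * T F k + c (suc n) * T (f (suc n)) k         ≡⟨ cong (_+ c (suc n) * T (f (suc n)) k) (trans (*-identityˡ (T F k)) (linear-∑ T-lin n c f k)) ⟩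
  ∑ n (λ i → c i * T (f i) k) + c (suc n) * T (f (suc n)) k ∎
  where
  open ≡-Reasoning
  F : Seq
  F k = ∑ n (λ i → c i * f i k)

Commute : (T U : Seq → Seq) → Set
Commute T U = ∀ f → T (U f) ≗ U (T f)

commute-iter : ∀ {T U} → Linear U → Commute T U → ∀ n → Commute T (iter U n)
commute-iter U-lin TU zero    f k = refl
commute-iter {T} {U} U-lin TU (suc n) f k =
  trans (TU (iter U n f) k) (U-lin .cong-≗ (commute-iter U-lin TU n f) k)

iter-commute : ∀ {T U} → Linear T → Commute T U → ∀ n → Commute (iter T n) U
iter-commute T-lin TU zero    f k = refl
iter-commute {T} {U} T-lin TU (suc n) f k =
  trans (T-lin .cong-≗ (iter-commute T-lin TU n f) k) (TU (iter T n f) k)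

∇-shift : Commute ∇ shift
∇-shift f zero          = refl
∇-shift f (suc zero)    = solve 1 (λ x → x :- con 0ℚ := x) refl (f zero)
∇-shift f (suc (suc k)) = refl

∇-pairSum : Commute ∇ pairSum
∇-pairSum f zero          = refl
∇-pairSum f (suc zero)    = solve 2 (λ x y → (x :+ y) :- y := (x :- y) :+ y) refl (f 1) (f 0)
∇-pairSum f (suc (suc k)) =
  solve 3 (λ x y z → (x :+ y) :- (y :+ z) := (x :- y) :+ (y :- z)) refl (f (suc (suc k))) (f (suc k)) (f k)

-- `even` turns multiplication by x² into multiplication by x, and 1 - x² = (1 - x)(1 + x).
∇-even : ∀ f → ∇ (even f) ≗ even (∇ (pairSum f))
∇-even f zero    = refl
∇-even f (suc k) = solve 3 (λ x y z → x :- z := (x :+ y) :- (y :+ z)) refl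
  (f (suc (suc (double k)))) (f (suc (double k))) (f (double k))

-- (1-x)^n E₂[g] = E₂[(1-x²)^n g]

iter-∇-even : ∀ n f → iter ∇ n (even f) ≗ even (iter pairSum n (iter ∇ n f))
iter-∇-even zero    f k = refl
iter-∇-even (suc n) f k = begin
  ∇ (iter ∇ n (even f)) k                               ≡⟨ ∇-linear .cong-≗ (iter-∇-even n f) k ⟩
  ∇ (even (iter pairSum n (iter ∇ n f))) k              ≡⟨ ∇-even (iter pairSum n (iter ∇ n f)) k ⟩
  even (∇ (iter pairSum (suc n) (iter ∇ n f))) k        ≡⟨ commute-iter pairSum-linear ∇-pairSum (suc n) (iter ∇ n f) (double k) ⟩
  even (iter pairSum (suc n) (iter ∇ (suc n) f)) k      ∎
  where open ≡-Reasoning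

-- Knot insertion.

-- Products of n consecutive linear factors y, y + ε, y + 2ε, … after a further copies
-- of the first knot have been inserted.

knots : ℚ → ℚ → ℕ → ℕ → ℚ
knots y ε a       zero    = 1ℚ
knots y ε zero    (suc n) = knots y ε zero n * (y + ε * fromℕ n)
knots y ε (suc a) (suc n) = y * knots y ε a n

-- Truncated subtraction is intended: while n lies among the inserted copies, `n ∸ a` is 0 and the
-- appended factor is y itself.
knots-suc : ∀ y ε a n → knots y ε a (suc n) ≡ knots y ε a n * (y + ε * fromℕ (n ∸ a))
knots-suc y ε zero    n       = refl
knots-suc y ε (suc a) zero    = solve 2 (λ y ε → y :* con 1ℚ := con 1ℚ :* (y :+ ε :* con 0ℚ)) refl y ε
knots-suc y ε (suc a) (suc n) = trans (cong (y *_) (knots-suc y ε a n))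
  (sym (*-assoc y (knots y ε a n) (y + ε * fromℕ (n ∸ a))))

-- The i-th window of d factors from x + d, …, x + 1, x, …, x - (d - 1), for a = b = 0,
-- and from d times x + 1 followed by d times x, for a = b = d.

basis : ℕ → ℕ → ℕ → ℕ → ℚ → ℚ
basis a b d i x = knots (x + 1ℚ) 1ℚ a (d ∸ i) * knots x (- 1ℚ) b i

-- The new factor x + 1 (resp. x) is a convex combination of x + 1 + p and x - q.

weight : ℕ → ℕ → ℕ → ℚ
weight p q n = 1/suc (p ℕ.+ q) * fromℕ n

weight-nonNeg : ∀ p q n → 0ℚ ℚ.≤ weight p q n
weight-nonNeg p q n = nonNeg* (1/suc-nonNeg (p ℕ.+ q)) (fromℕ-nonNeg n)

weight-total : ∀ p q z → 1/suc (p ℕ.+ q) * ((1ℚ + (fromℕ p + fromℕ q)) * z) ≡ z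
weight-total p q z = begin
  1/suc (p ℕ.+ q) * ((1ℚ + (fromℕ p + fromℕ q)) * z)
    ≡⟨ cong (λ s → 1/suc (p ℕ.+ q) * (s * z)) (trans (fromℕ-suc (p ℕ.+ q)) (cong (1ℚ +_) (fromℕ-+ p q))) ⟨
  1/suc (p ℕ.+ q) * (fromℕ (suc (p ℕ.+ q)) * z)
    ≡⟨ *-assoc (1/suc (p ℕ.+ q)) (fromℕ (suc (p ℕ.+ q))) z ⟨
  1/suc (p ℕ.+ q) * fromℕ (suc (p ℕ.+ q)) * z
    ≡⟨ cong (_* z) (1/suc-inverse (p ℕ.+ q)) ⟩
  1ℚ * z
    ≡⟨ *-identityˡ z ⟩
  z ∎
  where open ≡-Reasoning

-- From (q + 1)(x + 1 + p) + p(x - q) = (p + q + 1)(x + 1). The counterpart for the factor x is (p +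
-- 1)(x - q) + q(x + 1 + p) = (p + q + 1)x.
insert-left : ∀ p q x A B → ((x + 1ℚ) * A) * B ≡
  weight p q (suc q) * (A * (x + 1ℚ + 1ℚ * fromℕ p) * B) + weight p q p * (A * (B * (x + - 1ℚ * fromℕ q)))
insert-left p q x A B = sym (begin
  ρ * fromℕ (suc q) * (A * (x + 1ℚ + 1ℚ * P) * B) + ρ * P * (A * (B * (x + - 1ℚ * Q)))
    ≡⟨ cong (λ s → ρ * s * (A * (x + 1ℚ + 1ℚ * P) * B) + ρ * P * (A * (B * (x + - 1ℚ * Q)))) (fromℕ-suc q) ⟩
  ρ * (1ℚ + Q) * (A * (x + 1ℚ + 1ℚ * P) * B) + ρ * P * (A * (B * (x + - 1ℚ * Q)))
    ≡⟨ solve 6 (λ ρ P Q x A B →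
         ρ :* (con 1ℚ :+ Q) :* (A :* (x :+ con 1ℚ :+ con 1ℚ :* P) :* B) :+ ρ :* P :* (A :* (B :* (x :+ con (- 1ℚ) :* Q)))
         := ρ :* ((con 1ℚ :+ (P :+ Q)) :* ((x :+ con 1ℚ) :* A :* B))) refl ρ P Q x A B ⟩
  ρ * ((1ℚ + (P + Q)) * ((x + 1ℚ) * A * B))
    ≡⟨ weight-total p q ((x + 1ℚ) * A * B) ⟩
  (x + 1ℚ) * A * B ∎)
  where
  open ≡-Reasoning
  ρ P Q : ℚ
  ρ = 1/suc (p ℕ.+ q)
  P = fromℕ p
  Q = fromℕ q

insert-right : ∀ p q x A B → A * (x * B) ≡
  weight p q (suc p) * (A * (B * (x + - 1ℚ * fromℕ q))) + weight p q q * (A * (x + 1ℚ + 1ℚ * fromℕ p) * B)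
insert-right p q x A B = sym (begin
  ρ * fromℕ (suc p) * (A * (B * (x + - 1ℚ * Q))) + ρ * Q * (A * (x + 1ℚ + 1ℚ * P) * B)
    ≡⟨ cong (λ s → ρ * s * (A * (B * (x + - 1ℚ * Q))) + ρ * Q * (A * (x + 1ℚ + 1ℚ * P) * B)) (fromℕ-suc p) ⟩
  ρ * (1ℚ + P) * (A * (B * (x + - 1ℚ * Q))) + ρ * Q * (A * (x + 1ℚ + 1ℚ * P) * B)
    ≡⟨ solve 6 (λ ρ P Q x A B →
         ρ :* (con 1ℚ :+ P) :* (A :* (B :* (x :+ con (- 1ℚ) :* Q))) :+ ρ :* Q :* (A :* (x :+ con 1ℚ :+ con 1ℚ :* P) :* B)
         := ρ :* ((con 1ℚ :+ (P :+ Q)) :* (A :* (x :* B)))) refl ρ P Q x A B ⟩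
  ρ * ((1ℚ + (P + Q)) * (A * (x * B)))
    ≡⟨ weight-total p q (A * (x * B)) ⟩
  A * (x * B) ∎)
  where
  open ≡-Reasoning
  ρ P Q : ℚ
  ρ = 1/suc (p ℕ.+ q)
  P = fromℕ p
  Q = fromℕ q

-- Summation by parts: a bidiagonal matrix passes from the coefficients `m` to the functions `w`.
-- The `β` terms are reindexed by one, so a boundary term at d + 1 completes the sum, and
-- `β zero ≡ 0ℚ` removes the term where `pred` maps 0 to 0.
∑-lower-bidiagonal : ∀ d (w w′ m α β : ℕ → ℚ) → β zero ≡ 0ℚ →
  (∀ {j} → j ℕ.≤ d → w′ j ≡ α j * w j + β (suc j) * w (suc j)) →
  ∑ d (λ i → w i * (α i * m i + β i * m (ℕ.pred i))) + w (suc d) * (β (suc d) * m d) ≡ ∑ d (λ j → w′ j * m j)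
∑-lower-bidiagonal zero w w′ m α β β₀≡0 w′≡ = begin
  w 0 * (α 0 * m 0 + β 0 * m 0) + w 1 * (β 1 * m 0)
    ≡⟨ cong (λ z → w 0 * (α 0 * m 0 + z * m 0) + w 1 * (β 1 * m 0)) β₀≡0 ⟩
  w 0 * (α 0 * m 0 + 0ℚ * m 0) + w 1 * (β 1 * m 0)
    ≡⟨ solve 5 (λ w₀ α m w₁ β → w₀ :* (α :* m :+ con 0ℚ :* m) :+ w₁ :* (β :* m) := (α :* w₀ :+ β :* w₁) :* m) refl
         (w 0) (α 0) (m 0) (w 1) (β 1) ⟩
  (α 0 * w 0 + β 1 * w 1) * m 0
    ≡⟨ cong (_* m 0) (w′≡ z≤n) ⟨
  w′ 0 * m 0 ∎
  where open ≡-Reasoning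
∑-lower-bidiagonal (suc d) w w′ m α β β₀≡0 w′≡ = begin
  S + w₁ * (α₁ * m₁ + β₁ * m d) + w₂ * (β₂ * m₁)
    ≡⟨ solve 8 (λ S w₁ α₁ m₁ β₁ m₀ w₂ β₂ → S :+ w₁ :* (α₁ :* m₁ :+ β₁ :* m₀) :+ w₂ :* (β₂ :* m₁) :=
         (S :+ w₁ :* (β₁ :* m₀)) :+ (α₁ :* w₁ :+ β₂ :* w₂) :* m₁) refl S w₁ α₁ m₁ β₁ (m d) w₂ β₂ ⟩
  (S + w₁ * (β₁ * m d)) + (α₁ * w₁ + β₂ * w₂) * m₁
    ≡⟨ cong₂ (λ s z → s + z * m₁) (∑-lower-bidiagonal d w w′ m α β β₀≡0 (w′≡ ∘ ℕ.m≤n⇒m≤1+n)) (sym (w′≡ ℕ.≤-refl)) ⟩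
  ∑ d (λ j → w′ j * m j) + w′ (suc d) * m₁ ∎
  where
  open ≡-Reasoning
  S w₁ α₁ m₁ β₁ w₂ β₂ : ℚ
  S = ∑ d (λ i → w i * (α i * m i + β i * m (ℕ.pred i)))
  w₁ = w (suc d)
  α₁ = α (suc d)
  m₁ = m (suc d)
  β₁ = β (suc d)
  w₂ = w (suc (suc d))
  β₂ = β (suc (suc d))

∑-upper-bidiagonal : ∀ d (w w′ m α β : ℕ → ℚ) → w′ zero ≡ α zero * w zero →
  (∀ {j} → j ℕ.< d → w′ (suc j) ≡ α (suc j) * w (suc j) + β j * w j) →
  ∑ d (λ i → w i * (α i * m i + β i * m (suc i))) ≡ ∑ d (λ j → w′ j * m j) + w d * (β d * m (suc d))
∑-upper-bidiagonal zero w w′ m α β w′₀≡ w′≡ = begin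
  w 0 * (α 0 * m 0 + β 0 * m 1)
    ≡⟨ solve 5 (λ w α m₀ β m₁ → w :* (α :* m₀ :+ β :* m₁) := α :* w :* m₀ :+ w :* (β :* m₁)) refl
         (w 0) (α 0) (m 0) (β 0) (m 1) ⟩
  α 0 * w 0 * m 0 + w 0 * (β 0 * m 1)
    ≡⟨ cong (λ z → z * m 0 + w 0 * (β 0 * m 1)) w′₀≡ ⟨
  w′ 0 * m 0 + w 0 * (β 0 * m 1) ∎
  where open ≡-Reasoning
∑-upper-bidiagonal (suc d) w w′ m α β w′₀≡ w′≡ = begin
  ∑ d (λ i → w i * (α i * m i + β i * m (suc i))) + w₁ * (α₁ * m₁ + β₁ * m₂)
    ≡⟨ cong (_+ w₁ * (α₁ * m₁ + β₁ * m₂)) (∑-upper-bidiagonal d w w′ m α β w′₀≡ (w′≡ ∘ ℕ.m≤n⇒m≤1+n)) ⟩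
  S + w d * (β d * m₁) + w₁ * (α₁ * m₁ + β₁ * m₂)
    ≡⟨ solve 8 (λ S w₀ β₀ m₁ w₁ α₁ β₁ m₂ → S :+ w₀ :* (β₀ :* m₁) :+ w₁ :* (α₁ :* m₁ :+ β₁ :* m₂) :=
         (S :+ (α₁ :* w₁ :+ β₀ :* w₀) :* m₁) :+ w₁ :* (β₁ :* m₂)) refl S (w d) (β d) m₁ w₁ α₁ β₁ m₂ ⟩
  S + (α₁ * w₁ + β d * w d) * m₁ + w₁ * (β₁ * m₂)
    ≡⟨ cong (λ z → S + z * m₁ + w₁ * (β₁ * m₂)) (w′≡ ℕ.≤-refl) ⟨
  S + w′ (suc d) * m₁ + w₁ * (β₁ * m₂) ∎
  where
  open ≡-Reasoning
  S w₁ α₁ m₁ β₁ m₂ : ℚ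
  S = ∑ d (λ j → w′ j * m j)
  w₁ = w (suc d)
  α₁ = α (suc d)
  m₁ = m (suc d)
  β₁ = β (suc d)
  m₂ = m (suc (suc d))

-- The expanded functions are always the final windows x^j (x+1)^(d-j), while the windows they are
-- expanded in change. The recursion starts from the identity at a = b = d and takes the inserted
-- copies away again, so that each step multiplies `matrix` from the left, that is, combines rows.
-- Rows beyond d are not constrained by `expands`.
record Expansion (d a b : ℕ) : Set where
  field
    matrix           : ℕ → Vector ℚ (suc d)
    totallyPositive  : TotallyPositiveℕ matrix
    expands          : ∀ x j → ∑ d (λ i → basis a b d i x * matrix i j) ≡ basis d d d (toℕ j) x

open Expansion

expansion-start : ∀ d → Expansion d d d
expansion-start d .matrix = identity
expansion-start d .totallyPositive = identity-totallyPositive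
expansion-start d .expands x j = trans
  (∑-single (ℕ.≤-pred (Fin.toℕ<n j)) λ {i} _ i≢j →
    trans (cong (basis d d d i x *_) (identity-off-diagonal {j = j} i≢j)) (*-zeroʳ (basis d d d i x)))
  (trans (cong (basis d d d (toℕ j) x *_) (identity-diagonal {j = j} refl)) (*-identityʳ (basis d d d (toℕ j) x)))

remove-left-knot : ∀ {d a b} → Expansion d (suc a) b → Expansion d a b
remove-left-knot {d} {a} {b} e = record
  { matrix          = λ i j → α i * matrix e i j + β i * matrix e (ℕ.pred i) j
  ; totallyPositive = λ {k} r c r↑ c↑ → subst (0ℚ ℚ.≤_)
      (det-cong λ i j → +-comm (β (r i) * matrix e (ℕ.pred (r i)) (c j)) (α (r i) * matrix e (r i) (c j)))
      (combine-rows-totallyPositive {M = matrix e} (totallyPositive e) ℕ.pred (λ i → i) (λ i → ℕ.pred[n]≤n)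
        ℕ.<⇒≤pred β α β≥0 α≥0 r c r↑ c↑)
  ; expands         = λ x j → begin
      ∑ d (λ i → old x i * (α i * matrix e i j + β i * matrix e (ℕ.pred i) j))
        ≡⟨ trans (cong (∑ d (λ i → old x i * (α i * matrix e i j + β i * matrix e (ℕ.pred i) j)) +_) (last≡0 x j)) (+-identityʳ _) ⟨
      ∑ d (λ i → old x i * (α i * matrix e i j + β i * matrix e (ℕ.pred i) j)) + old x (suc d) * (β (suc d) * matrix e d j)
        ≡⟨ ∑-lower-bidiagonal d (old x) (new x) (λ i → matrix e i j) α β refl (new≡ x) ⟩
      ∑ d (λ i → new x i * matrix e i j)
        ≡⟨ expands e x j ⟩
      basis d d d (toℕ j) x ∎
  }
  where
  open ≡-Reasoning
  -- The names follow the insertion, against the direction of the lemma: `new` has one more copy of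
  -- the factor x + 1.
  old new : ℚ → ℕ → ℚ
  old x i = basis a b d i x
  new x i = basis (suc a) b d i x

  -- The old windows i and i + 1 share all factors but one, which is x + 1 + p i in the former and x
  -- - q i in the latter.
  p q : ℕ → ℕ
  p i = (d ∸ suc i) ∸ a
  q i = i ∸ b

  α β : ℕ → ℚ
  α i = weight (p i) (q i) (suc (q i))
  β zero    = 0ℚ
  β (suc i) = weight (p i) (q i) (p i)

  α≥0 : ∀ i → 0ℚ ℚ.≤ α i
  α≥0 i = weight-nonNeg (p i) (q i) (suc (q i))

  β≥0 : ∀ i → 0ℚ ℚ.≤ β i
  β≥0 zero    = ≤-refl
  β≥0 (suc i) = weight-nonNeg (p i) (q i) (p i)

  -- Window d has no left factor to be changed. The truncated `d ∸ suc d` gives p d = 0, hence the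
  -- weights 1 and 0, and the nonexistent window d + 1 drops out.
  p-last : p d ≡ 0
  p-last = trans (cong (_∸ a) (ℕ.m≤n⇒m∸n≡0 (ℕ.n≤1+n d))) (ℕ.0∸n≡0 a)

  β-last : β (suc d) ≡ 0ℚ
  β-last = trans (cong (λ p → weight p (q d) p) p-last) (*-zeroʳ (1/suc (q d)))

  α-last : α d ≡ 1ℚ
  α-last = trans (cong (λ p → weight p (q d) (suc (q d))) p-last) (1/suc-inverse (q d))

  last≡0 : ∀ x j → old x (suc d) * (β (suc d) * matrix e d j) ≡ 0ℚ
  last≡0 x j = trans (cong (λ z → old x (suc d) * (z * matrix e d j)) β-last)
    (solve 2 (λ a b → a :* (con 0ℚ :* b) := con 0ℚ) refl (old x (suc d)) (matrix e d j))

  new≡ : ∀ x {j} → j ℕ.≤ d → new x j ≡ α j * old x j + β (suc j) * old x (suc j)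
  new≡ x {j} j≤d with j ℕ.≟ d
  ... | yes refl = begin
    new x d                                       ≡⟨ cong (λ n → knots (x + 1ℚ) 1ℚ (suc a) n * knots x (- 1ℚ) b d) (ℕ.n∸n≡0 d) ⟩
    1ℚ * knots x (- 1ℚ) b d                       ≡⟨ cong (λ n → knots (x + 1ℚ) 1ℚ a n * knots x (- 1ℚ) b d) (ℕ.n∸n≡0 d) ⟨
    old x d                                       ≡⟨ solve 2 (λ y z → y := con 1ℚ :* y :+ con 0ℚ :* z) refl (old x d) (old x (suc d)) ⟩
    1ℚ * old x d + 0ℚ * old x (suc d)             ≡⟨ cong₂ (λ y z → y * old x d + z * old x (suc d)) α-last β-last ⟨
    α d * old x d + β (suc d) * old x (suc d)     ∎
  ... | no j≢d = begin
    new x j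
      ≡⟨ cong (λ n → knots (x + 1ℚ) 1ℚ (suc a) n * knots x (- 1ℚ) b j) d∸j ⟩
    (x + 1ℚ) * knots (x + 1ℚ) 1ℚ a (d ∸ suc j) * knots x (- 1ℚ) b j
      ≡⟨ insert-left (p j) (q j) x (knots (x + 1ℚ) 1ℚ a (d ∸ suc j)) (knots x (- 1ℚ) b j) ⟩
    α j * (knots (x + 1ℚ) 1ℚ a (d ∸ suc j) * (x + 1ℚ + 1ℚ * fromℕ (p j)) * knots x (- 1ℚ) b j) +
    β (suc j) * (knots (x + 1ℚ) 1ℚ a (d ∸ suc j) * (knots x (- 1ℚ) b j * (x + - 1ℚ * fromℕ (q j))))
      ≡⟨ cong₂ (λ y z → α j * (y * knots x (- 1ℚ) b j) + β (suc j) * (knots (x + 1ℚ) 1ℚ a (d ∸ suc j) * z))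
           (trans (cong (knots (x + 1ℚ) 1ℚ a) d∸j) (knots-suc (x + 1ℚ) 1ℚ a (d ∸ suc j)))
           (knots-suc x (- 1ℚ) b j) ⟨
    α j * old x j + β (suc j) * old x (suc j) ∎
    where
    d∸j : d ∸ j ≡ suc (d ∸ suc j)
    d∸j = ℕ.+-∸-assoc 1 (ℕ.≤∧≢⇒< j≤d j≢d)

remove-right-knot : ∀ {d a b} → Expansion d a (suc b) → Expansion d a b
remove-right-knot {d} {a} {b} e = record
  { matrix          = λ i j → α i * matrix e i j + β i * matrix e (suc i) j
  ; totallyPositive = λ {k} → combine-rows-totallyPositive {M = matrix e} (totallyPositive e) (λ i → i) suc ℕ.n≤1+n
      (λ i<j → i<j) α β α≥0 β≥0 {k}
  ; expands         = λ x j → begin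
      ∑ d (λ i → old x i * (α i * matrix e i j + β i * matrix e (suc i) j))
        ≡⟨ ∑-upper-bidiagonal d (old x) (new x) (λ i → matrix e i j) α β (sym (*-identityˡ (old x zero))) (new≡ x) ⟩
      ∑ d (λ i → new x i * matrix e i j) + old x d * (β d * matrix e (suc d) j)
        ≡⟨ trans (cong (∑ d (λ i → new x i * matrix e i j) +_) (last≡0 x j)) (+-identityʳ _) ⟩
      ∑ d (λ i → new x i * matrix e i j)
        ≡⟨ expands e x j ⟩
      basis d d d (toℕ j) x ∎
  }
  where
  open ≡-Reasoning
  old new : ℚ → ℕ → ℚ
  old x i = basis a b d i x
  new x i = basis a (suc b) d i x

  p q : ℕ → ℕ
  p i = (d ∸ suc i) ∸ a
  q i = i ∸ b

  α β : ℕ → ℚ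
  -- Window 0 has no right factor, so the insertion leaves it unchanged.
  α zero    = 1ℚ
  α (suc i) = weight (p i) (q i) (suc (p i))
  -- The weight formula need not vanish at i = d. It is cut off there to remove the boundary term,
  -- which involves row d + 1 of the matrix.
  β i with i ℕ.<? d
  ... | yes _ = weight (p i) (q i) (q i)
  ... | no  _ = 0ℚ

  α≥0 : ∀ i → 0ℚ ℚ.≤ α i
  α≥0 zero    = nonNegative⁻¹ 1ℚ
  α≥0 (suc i) = weight-nonNeg (p i) (q i) (suc (p i))

  β≥0 : ∀ i → 0ℚ ℚ.≤ β i
  β≥0 i with i ℕ.<? d
  ... | yes _ = weight-nonNeg (p i) (q i) (q i)
  ... | no  _ = ≤-refl

  β-last : β d ≡ 0ℚ
  β-last with d ℕ.<? d
  ... | yes d<d = ⊥-elim (ℕ.<-irrefl refl d<d)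
  ... | no  _   = refl

  β-inner : ∀ {j} → j ℕ.< d → β j ≡ weight (p j) (q j) (q j)
  β-inner {j} j<d with j ℕ.<? d
  ... | yes _   = refl
  ... | no  j≮d = ⊥-elim (j≮d j<d)

  last≡0 : ∀ x j → old x d * (β d * matrix e (suc d) j) ≡ 0ℚ
  last≡0 x j = trans (cong (λ z → old x d * (z * matrix e (suc d) j)) β-last)
    (solve 2 (λ a b → a :* (con 0ℚ :* b) := con 0ℚ) refl (old x d) (matrix e (suc d) j))

  new≡ : ∀ x {j} → j ℕ.< d → new x (suc j) ≡ α (suc j) * old x (suc j) + β j * old x j
  new≡ x {j} j<d = begin
    knots (x + 1ℚ) 1ℚ a (d ∸ suc j) * (x * knots x (- 1ℚ) b j)
      ≡⟨ insert-right (p j) (q j) x (knots (x + 1ℚ) 1ℚ a (d ∸ suc j)) (knots x (- 1ℚ) b j) ⟩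
    α (suc j) * (knots (x + 1ℚ) 1ℚ a (d ∸ suc j) * (knots x (- 1ℚ) b j * (x + - 1ℚ * fromℕ (q j)))) +
    weight (p j) (q j) (q j) * (knots (x + 1ℚ) 1ℚ a (d ∸ suc j) * (x + 1ℚ + 1ℚ * fromℕ (p j)) * knots x (- 1ℚ) b j)
      ≡⟨ cong₂ _+_ (cong (λ z → α (suc j) * (knots (x + 1ℚ) 1ℚ a (d ∸ suc j) * z)) (knots-suc x (- 1ℚ) b j))
           (cong₂ (λ y z → y * (z * knots x (- 1ℚ) b j)) (β-inner j<d)
             (trans (cong (knots (x + 1ℚ) 1ℚ a) (ℕ.+-∸-assoc 1 j<d)) (knots-suc (x + 1ℚ) 1ℚ a (d ∸ suc j)))) ⟨
    α (suc j) * old x (suc j) + β j * old x j ∎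

expansion : ∀ d → Expansion d 0 0
expansion d = down-left d (down-right d (expansion-start d))
  where
  down-right : ∀ b → Expansion d d b → Expansion d d 0
  down-right zero    e = e
  down-right (suc b) e = down-right b (remove-right-knot e)

  down-left : ∀ a → Expansion d a 0 → Expansion d 0 0
  down-left zero    e = e
  down-left (suc a) e = down-left a (remove-left-knot e)

-- The operator `∇` on windows of distinct knots.

knots-first : ∀ y ε n → knots y ε 0 (suc n) ≡ y * knots (y + ε) ε 0 n
knots-first y ε zero    = solve 2 (λ y ε → con 1ℚ :* (y :+ ε :* con 0ℚ) := y :* con 1ℚ) refl y ε
knots-first y ε (suc n) = begin
  knots y ε 0 (suc n) * (y + ε * fromℕ (suc n))
    ≡⟨ cong₂ (λ a b → a * (y + ε * b)) (knots-first y ε n) (fromℕ-suc n) ⟩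
  y * knots (y + ε) ε 0 n * (y + ε * (1ℚ + fromℕ n))
    ≡⟨ solve 4 (λ y ε n k → y :* k :* (y :+ ε :* (con 1ℚ :+ n)) := y :* (k :* ((y :+ ε) :+ ε :* n))) refl
         y ε (fromℕ n) (knots (y + ε) ε 0 n) ⟩
  y * (knots (y + ε) ε 0 n * ((y + ε) + ε * fromℕ n)) ∎
  where open ≡-Reasoning

-- A rising factorial times a falling one: the product of the consecutive integers r - i + 1, ..., r
-- + n, which vanishes for r < i. It is `basis 0 0 (n + i) i` at r.
factorials : ℕ → ℕ → Seq
factorials n i r = knots (fromℕ r + 1ℚ) 1ℚ 0 n * knots (fromℕ r) (- 1ℚ) 0 i

-- Passing from r to r + 1 while trading a rising factor for a falling one keeps the block of
-- consecutive integers. At r = 0 the falling factorial contains the factor 0.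
factorials-shift : ∀ n i → factorials n (suc i) ≗ shift (factorials (suc n) i)
factorials-shift n i zero    = trans (cong (knots 1ℚ 1ℚ 0 n *_) (trans (knots-first 0ℚ (- 1ℚ) i) (*-zeroˡ (knots (0ℚ + - 1ℚ) (- 1ℚ) 0 i))))
  (*-zeroʳ (knots 1ℚ 1ℚ 0 n))
factorials-shift n i (suc r) = begin
  knots (fromℕ (suc r) + 1ℚ) 1ℚ 0 n * knots (fromℕ (suc r)) (- 1ℚ) 0 (suc i)
    ≡⟨ cong (λ z → knots (z + 1ℚ) 1ℚ 0 n * knots z (- 1ℚ) 0 (suc i)) r+1 ⟩
  knots (R + 1ℚ + 1ℚ) 1ℚ 0 n * knots (R + 1ℚ) (- 1ℚ) 0 (suc i)
    ≡⟨ cong (knots (R + 1ℚ + 1ℚ) 1ℚ 0 n *_) (knots-first (R + 1ℚ) (- 1ℚ) i) ⟩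
  knots (R + 1ℚ + 1ℚ) 1ℚ 0 n * ((R + 1ℚ) * knots (R + 1ℚ + - 1ℚ) (- 1ℚ) 0 i)
    ≡⟨ cong (λ z → knots (R + 1ℚ + 1ℚ) 1ℚ 0 n * ((R + 1ℚ) * knots z (- 1ℚ) 0 i))
         (solve 1 (λ r → r :+ con 1ℚ :+ con (- 1ℚ) := r) refl R) ⟩
  knots (R + 1ℚ + 1ℚ) 1ℚ 0 n * ((R + 1ℚ) * knots R (- 1ℚ) 0 i)
    ≡⟨ solve 3 (λ a b c → a :* (b :* c) := b :* a :* c) refl (knots (R + 1ℚ + 1ℚ) 1ℚ 0 n) (R + 1ℚ) (knots R (- 1ℚ) 0 i) ⟩
  (R + 1ℚ) * knots (R + 1ℚ + 1ℚ) 1ℚ 0 n * knots R (- 1ℚ) 0 i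
    ≡⟨ cong (_* knots R (- 1ℚ) 0 i) (knots-first (R + 1ℚ) 1ℚ n) ⟨
  knots (R + 1ℚ) 1ℚ 0 (suc n) * knots R (- 1ℚ) 0 i ∎
  where
  open ≡-Reasoning
  R : ℚ
  R = fromℕ r
  r+1 : fromℕ (suc r) ≡ R + 1ℚ
  r+1 = trans (fromℕ-suc r) (+-comm 1ℚ R)

factorials-monomial : ∀ n i → factorials n i ≗ iter shift i (factorials (n ℕ.+ i) 0)
factorials-monomial n zero    k = cong (λ n → factorials n 0 k) (sym (ℕ.+-identityʳ n))
factorials-monomial n (suc i) k = trans (factorials-shift n i k)
  (trans (shift-linear .cong-≗ (factorials-monomial (suc n) i) k)
    (cong (λ m → shift (iter shift i (factorials m 0)) k) (sym (ℕ.+-suc n i))))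

∇-factorials : ∀ n → ∇ (factorials (suc n) 0) ≗ (λ k → fromℕ (suc n) * factorials n 0 k)
∇-factorials n zero    = trans
  (solve 2 (λ k n → k :* (con 1ℚ :+ con 1ℚ :* n) :* con 1ℚ := (con 1ℚ :+ n) :* (k :* con 1ℚ)) refl (knots 1ℚ 1ℚ 0 n) (fromℕ n))
  (cong (_* (knots 1ℚ 1ℚ 0 n * 1ℚ)) (sym (fromℕ-suc n)))
∇-factorials n (suc r) = begin
  knots (fromℕ (suc r) + 1ℚ) 1ℚ 0 (suc n) * 1ℚ - knots (R + 1ℚ) 1ℚ 0 (suc n) * 1ℚ
    ≡⟨ cong₂ (λ a b → knots (a + 1ℚ) 1ℚ 0 (suc n) * 1ℚ - b * 1ℚ) r+1 (knots-first (R + 1ℚ) 1ℚ n) ⟩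
  A * (R + 1ℚ + 1ℚ + 1ℚ * N) * 1ℚ - (R + 1ℚ) * A * 1ℚ
    ≡⟨ solve 3 (λ a r n → a :* (r :+ con 1ℚ :+ con 1ℚ :+ con 1ℚ :* n) :* con 1ℚ :- (r :+ con 1ℚ) :* a :* con 1ℚ
         := (con 1ℚ :+ n) :* (a :* con 1ℚ)) refl A R N ⟩
  (1ℚ + N) * (A * 1ℚ)
    ≡⟨ cong₂ (λ a b → a * (knots (b + 1ℚ) 1ℚ 0 n * 1ℚ)) (fromℕ-suc n) r+1 ⟨
  fromℕ (suc n) * (knots (fromℕ (suc r) + 1ℚ) 1ℚ 0 n * 1ℚ) ∎
  where
  open ≡-Reasoning
  R N A : ℚ
  R = fromℕ r
  N = fromℕ n
  A = knots (R + 1ℚ + 1ℚ) 1ℚ 0 n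
  r+1 : fromℕ (suc r) ≡ R + 1ℚ
  r+1 = trans (fromℕ-suc r) (+-comm 1ℚ R)

-- The generating function Σ_r (r+1)⋯(r+n) x^r = n!/(1-x)^(n+1), with one factor of the denominator
-- cleared per step.
iter-∇-factorials : ∀ n → iter ∇ (suc n) (factorials n 0) ≗ (λ k → fromℕ (n !) * one k)
iter-∇-factorials zero    zero    = refl
iter-∇-factorials zero    (suc k) = refl
iter-∇-factorials (suc n) k = begin
  iter ∇ (suc (suc n)) (factorials (suc n) 0) k
    ≡⟨ commute-iter {∇} ∇-linear (λ _ _ → refl) (suc n) (factorials (suc n) 0) k ⟩
  iter ∇ (suc n) (∇ (factorials (suc n) 0)) k
    ≡⟨ iter-linear ∇-linear (suc n) .cong-≗ (∇-factorials n) k ⟩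
  iter ∇ (suc n) (λ k → fromℕ (suc n) * factorials n 0 k) k
    ≡⟨ linear-scale (iter-linear ∇-linear (suc n)) (fromℕ (suc n)) (factorials n 0) k ⟩
  fromℕ (suc n) * iter ∇ (suc n) (factorials n 0) k
    ≡⟨ cong (fromℕ (suc n) *_) (iter-∇-factorials n k) ⟩
  fromℕ (suc n) * (fromℕ (n !) * one k)
    ≡⟨ *-assoc (fromℕ (suc n)) (fromℕ (n !)) (one k) ⟨
  fromℕ (suc n) * fromℕ (n !) * one k
    ≡⟨ cong (_* one k) (fromℕ-* (suc n) (n !)) ⟨
  fromℕ (suc n !) * one k ∎
  where open ≡-Reasoning

monomial-diagonal : ∀ k → iter shift k one k ≡ 1ℚ
monomial-diagonal zero    = refl
monomial-diagonal (suc k) = monomial-diagonal k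

monomial-off-diagonal : ∀ {i k} → i ≢ k → iter shift i one k ≡ 0ℚ
monomial-off-diagonal {zero}  {zero}  i≢k = ⊥-elim (i≢k refl)
monomial-off-diagonal {zero}  {suc k} i≢k = refl
monomial-off-diagonal {suc i} {zero}  i≢k = refl
monomial-off-diagonal {suc i} {suc k} i≢k = monomial-off-diagonal (i≢k ∘ cong suc)

iter-∇-basis : ∀ d {i} → i ℕ.≤ d →
  iter ∇ (suc d) (λ r → basis 0 0 d i (fromℕ r)) ≗ (λ k → fromℕ (d !) * iter shift i one k)
iter-∇-basis d {i} i≤d k = begin
  iter ∇ (suc d) (factorials (d ∸ i) i) k
    ≡⟨ iter-linear ∇-linear (suc d) .cong-≗ (factorials-monomial (d ∸ i) i) k ⟩
  iter ∇ (suc d) (iter shift i (factorials (d ∸ i ℕ.+ i) 0)) k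
    ≡⟨ cong (λ n → iter ∇ (suc d) (iter shift i (factorials n 0)) k) (ℕ.m∸n+n≡m i≤d) ⟩
  iter ∇ (suc d) (iter shift i (factorials d 0)) k
    ≡⟨ commute-iter shift-linear (iter-commute ∇-linear ∇-shift (suc d)) i (factorials d 0) k ⟩
  iter shift i (iter ∇ (suc d) (factorials d 0)) k
    ≡⟨ iter-linear shift-linear i .cong-≗ (iter-∇-factorials d) k ⟩
  iter shift i (λ k → fromℕ (d !) * one k) k
    ≡⟨ linear-scale (iter-linear shift-linear i) (fromℕ (d !)) one k ⟩
  fromℕ (d !) * iter shift i one k ∎
  where open ≡-Reasoning

-- Total positivity of the barycentric and the interval matrix.

-- The coefficient sequences of P_{d,j} and Q_{d,j}, where
-- P_{d,j}(x) = (1-x)^(d+1) Σ_r r^j (r+1)^(d-j) x^r and Q_{d,j} = E₂[(1+x)^d P_{d,j}].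

barycentricColumn intervalColumn : ℕ → ℕ → Seq
barycentricColumn d j = iter ∇ (suc d) (λ r → basis d d d j (fromℕ r))
intervalColumn d j = even (iter pairSum d (barycentricColumn d j))

totallyPositive-cong : ∀ {n} {M N : ℕ → Vector ℚ n} → (∀ i j → M i j ≡ N i j) →
  TotallyPositiveℕ M → TotallyPositiveℕ N
totallyPositive-cong M≗N M-tp r c r↑ c↑ =
  subst (0ℚ ℚ.≤_) (det-cong λ i j → M≗N (r i) (c j)) (M-tp r c r↑ c↑)

-- After expansion in windows of distinct knots, `iter ∇ (suc d)` sends window i to d! x^i. The
-- coefficient of x^k in column j is therefore d! times entry (k, j) of the expansion matrix.
barycentric-totallyPositive : ∀ d → TotallyPositiveℕ {suc d} (λ k j → barycentricColumn d (toℕ j) k)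
barycentric-totallyPositive d = totallyPositive-cong (λ k j → sym (entry k j))
  (combine-rows-totallyPositive {M = matrix e} (totallyPositive e) (λ i → i) (λ i → i) (λ i → ℕ.≤-refl) ℕ.<⇒≤
    scale (λ _ → 0ℚ) scale≥0 (λ _ → ≤-refl))
  where
  open ≡-Reasoning
  e : Expansion d 0 0
  e = expansion d

  -- The columns are polynomials of degree at most d, whereas the rows of `matrix e` beyond d are
  -- arbitrary; they are scaled to zero.
  scale : ℕ → ℚ
  scale k with k ℕ.≤? d
  ... | yes _ = fromℕ (d !)
  ... | no  _ = 0ℚ

  scale≥0 : ∀ k → 0ℚ ℚ.≤ scale k
  scale≥0 k with k ℕ.≤? d
  ... | yes _ = fromℕ-nonNeg (d !)
  ... | no  _ = ≤-refl

  collapse : ∀ k (m : ℕ → ℚ) →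
    ∑ d (λ i → m i * (fromℕ (d !) * iter shift i one k)) ≡ scale k * m k + 0ℚ * m k
  collapse k m with k ℕ.≤? d
  ... | yes k≤d = trans
    (∑-single k≤d λ {i} _ i≢k → trans (cong (λ z → m i * (fromℕ (d !) * z)) (monomial-off-diagonal {i} {k} i≢k))
      (solve 2 (λ a b → a :* (b :* con 0ℚ) := con 0ℚ) refl (m i) (fromℕ (d !))))
    (trans (cong (λ z → m k * (fromℕ (d !) * z)) (monomial-diagonal k))
      (solve 2 (λ a b → a :* (b :* con 1ℚ) := b :* a :+ con 0ℚ :* a) refl (m k) (fromℕ (d !))))
  ... | no  k≰d = trans
    (∑-zero d λ {i} i≤d → trans (cong (λ z → m i * (fromℕ (d !) * z)) (monomial-off-diagonal {i} {k} (λ { refl → k≰d i≤d })))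
      (solve 2 (λ a b → a :* (b :* con 0ℚ) := con 0ℚ) refl (m i) (fromℕ (d !))))
    (solve 1 (λ a → con 0ℚ := con 0ℚ :* a :+ con 0ℚ :* a) refl (m k))

  entry : ∀ k j → barycentricColumn d (toℕ j) k ≡ scale k * matrix e k j + 0ℚ * matrix e k j
  entry k j = begin
    iter ∇ (suc d) (λ r → basis d d d (toℕ j) (fromℕ r)) k
      ≡⟨ iter-linear ∇-linear (suc d) .cong-≗ (λ r → trans (sym (expands e (fromℕ r) j))
           (∑-cong d λ {i} _ → *-comm (basis 0 0 d i (fromℕ r)) (matrix e i j))) k ⟩
    iter ∇ (suc d) (λ r → ∑ d (λ i → matrix e i j * basis 0 0 d i (fromℕ r))) k
      ≡⟨ linear-∑ (iter-linear ∇-linear (suc d)) d (λ i → matrix e i j) (λ i r → basis 0 0 d i (fromℕ r)) k ⟩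
    ∑ d (λ i → matrix e i j * iter ∇ (suc d) (λ r → basis 0 0 d i (fromℕ r)) k)
      ≡⟨ ∑-cong d (λ {i} i≤d → cong (matrix e i j *_) (iter-∇-basis d i≤d k)) ⟩
    ∑ d (λ i → matrix e i j * (fromℕ (d !) * iter shift i one k))
      ≡⟨ collapse k (λ i → matrix e i j) ⟩
    scale k * matrix e k j + 0ℚ * matrix e k j ∎

pairSum-totallyPositive : ∀ {n} {M : ℕ → Vector ℚ n} → TotallyPositiveℕ M →
  TotallyPositiveℕ (λ k j → pairSum (λ k → M k j) k)
pairSum-totallyPositive {n} {M} M-tp = totallyPositive-cong entry
  (combine-rows-totallyPositive {M = M} M-tp ℕ.pred (λ i → i) (λ i → ℕ.pred[n]≤n) ℕ.<⇒≤pred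
    a (λ _ → 1ℚ) a≥0 (λ _ → nonNegative⁻¹ 1ℚ))
  where
  a : ℕ → ℚ
  -- `pred` sends 0 to 0, and row 0 must not be counted twice.
  a zero    = 0ℚ
  a (suc _) = 1ℚ

  a≥0 : ∀ i → 0ℚ ℚ.≤ a i
  a≥0 zero    = ≤-refl
  a≥0 (suc _) = nonNegative⁻¹ 1ℚ

  entry : ∀ k j → a k * M (ℕ.pred k) j + 1ℚ * M k j ≡ pairSum (λ k → M k j) k
  entry zero    j = solve 1 (λ x → con 0ℚ :* x :+ con 1ℚ :* x := x) refl (M zero j)
  entry (suc k) j = solve 2 (λ x y → con 1ℚ :* x :+ con 1ℚ :* y := y :+ x) refl (M k j) (M (suc k) j)

iter-pairSum-totallyPositive : ∀ m {n} {M : ℕ → Vector ℚ n} → TotallyPositiveℕ M →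
  TotallyPositiveℕ (λ k j → iter pairSum m (λ k → M k j) k)
iter-pairSum-totallyPositive zero    M-tp {k} = M-tp {k}
iter-pairSum-totallyPositive (suc m) {M = M} M-tp {k} =
  pairSum-totallyPositive {M = λ k j → iter pairSum m (λ k → M k j) k} (iter-pairSum-totallyPositive m {M = M} M-tp) {k}

double-mono-< : ∀ {m n} → m ℕ.< n → double m ℕ.< double n
double-mono-< {zero}  {suc n} _         = s≤s z≤n
double-mono-< {suc m} {suc n} (s≤s m<n) = s≤s (s≤s (double-mono-< m<n))

interval-totallyPositive : ∀ d → TotallyPositiveℕ {suc d} (λ k j → intervalColumn d (toℕ j) k)
interval-totallyPositive d r c r↑ c↑ =
  iter-pairSum-totallyPositive d {M = λ k j → barycentricColumn d (toℕ j) k} (barycentric-totallyPositive d)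
    (double ∘ r) c (double-mono-< ∘ r↑) c↑

-- The h-polynomial as a rational sequence.

sumℤ≡0 : ∀ {n} {t : Vector ℤ n} → (∀ i → t i ≡ ℤ.0ℤ) → sumℤ t ≡ ℤ.0ℤ
sumℤ≡0 {n} t≡0 = trans (ℤSum.sum-cong-≗ t≡0) (ℤSum.sum-replicate-zero n)

fromℤ-sum : ∀ {n} (t : Vector ℤ n) → fromℤ (sumℤ t) ≡ sumℚ (fromℤ ∘ t)
fromℤ-sum {zero}  t = refl
fromℤ-sum {suc n} t = trans (fromℤ-+ (t zero) (sumℤ (t ∘ suc))) (cong (fromℤ (t zero) +_) (fromℤ-sum (t ∘ suc)))

·-congʳ : ∀ {p q} s → p ≗ q → p · s ≗ q · s
·-congʳ s p≗q k = ℤSum.sum-cong-≗ λ (i : Fin (suc k)) → cong (ℤ._* s (k ∸ toℕ i)) (p≗q (toℕ i))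

1ᵖ-· : ∀ q → 1ᵖ · q ≗ q
1ᵖ-· q k = trans (cong₂ ℤ._+_ (ℤ.*-identityˡ (q k)) (sumℤ≡0 λ (i : Fin k) → ℤ.*-zeroˡ (q (k ∸ suc (toℕ i)))))
  (ℤ.+-identityʳ (q k))

shiftℤ : Poly → Poly
shiftℤ p zero    = ℤ.0ℤ
shiftℤ p (suc k) = p k

shiftℤ-cong : ∀ {p q} → p ≗ q → shiftℤ p ≗ shiftℤ q
shiftℤ-cong p≗q zero    = refl
shiftℤ-cong p≗q (suc k) = p≗q k

shiftℤ-· : ∀ p q → shiftℤ p · q ≗ shiftℤ (p · q)
shiftℤ-· p q zero    = trans (ℤ.+-identityʳ (ℤ.0ℤ ℤ.* q 0)) (ℤ.*-zeroˡ (q 0))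
shiftℤ-· p q (suc k) = trans (cong (ℤ._+ (p · q) k) (ℤ.*-zeroˡ (q (suc k)))) (ℤ.+-identityˡ ((p · q) k))

X-· : ∀ q → X · q ≗ shiftℤ q
X-· q k = trans (·-congʳ q X≗ k) (trans (shiftℤ-· 1ᵖ q k) (shiftℤ-cong (1ᵖ-· q) k))
  where
  X≗ : X ≗ shiftℤ 1ᵖ
  X≗ zero          = refl
  X≗ (suc zero)    = refl
  X≗ (suc (suc k)) = refl

X^-· : ∀ l q → X ^ᵖ suc l · q ≗ shiftℤ (X ^ᵖ l · q)
X^-· l q k = trans (·-congʳ q (X-· (X ^ᵖ l)) k) (shiftℤ-· (X ^ᵖ l) q k)

1-X-·-zero : ∀ q → (1-X · q) 0 ≡ q 0
1-X-·-zero q = trans (ℤ.+-identityʳ (ℤ.1ℤ ℤ.* q 0)) (ℤ.*-identityˡ (q 0))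

1-X-·-suc : ∀ q k → (1-X · q) (suc k) ≡ q (suc k) ℤ.+ ℤ.-1ℤ ℤ.* q k
1-X-·-suc q k = cong₂ ℤ._+_ (ℤ.*-identityˡ (q (suc k)))
  (trans (cong (λ z → ℤ.-1ℤ ℤ.* q k ℤ.+ z) (sumℤ≡0 λ (i : Fin k) → ℤ.*-zeroˡ (q (k ∸ suc (toℕ i)))))
    (ℤ.+-identityʳ (ℤ.-1ℤ ℤ.* q k)))

-- The coefficients of x^l (1-x)^e, written with operators instead of convolution products so that
-- they can be moved past `∇` and `shift`.
binomialPower : ℕ → ℕ → Seq
binomialPower l e = iter shift l (iter ∇ e one)

fromℤ-1-X^ : ∀ e k → fromℤ ((1-X ^ᵖ e) k) ≡ iter ∇ e one k
fromℤ-1-X^ zero    zero    = refl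
fromℤ-1-X^ zero    (suc k) = refl
fromℤ-1-X^ (suc e) zero    = trans (cong fromℤ (1-X-·-zero (1-X ^ᵖ e))) (fromℤ-1-X^ e zero)
fromℤ-1-X^ (suc e) (suc k) = begin
  fromℤ ((1-X · 1-X ^ᵖ e) (suc k))
    ≡⟨ cong fromℤ (1-X-·-suc (1-X ^ᵖ e) k) ⟩
  fromℤ ((1-X ^ᵖ e) (suc k) ℤ.+ ℤ.-1ℤ ℤ.* (1-X ^ᵖ e) k)
    ≡⟨ trans (fromℤ-+ ((1-X ^ᵖ e) (suc k)) (ℤ.-1ℤ ℤ.* (1-X ^ᵖ e) k)) (cong (fromℤ ((1-X ^ᵖ e) (suc k)) +_) (fromℤ-* ℤ.-1ℤ ((1-X ^ᵖ e) k))) ⟩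
  fromℤ ((1-X ^ᵖ e) (suc k)) + - 1ℚ * fromℤ ((1-X ^ᵖ e) k)
    ≡⟨ cong₂ (λ a b → a + - 1ℚ * b) (fromℤ-1-X^ e (suc k)) (fromℤ-1-X^ e k) ⟩
  iter ∇ e one (suc k) + - 1ℚ * iter ∇ e one k
    ≡⟨ solve 2 (λ a b → a :+ con (- 1ℚ) :* b := a :- b) refl (iter ∇ e one (suc k)) (iter ∇ e one k) ⟩
  ∇ (iter ∇ e one) (suc k) ∎
  where open ≡-Reasoning

fromℤ-binomialPower : ∀ l e k → fromℤ ((X ^ᵖ l · 1-X ^ᵖ e) k) ≡ binomialPower l e k
fromℤ-binomialPower zero    e k       = trans (cong fromℤ (1ᵖ-· (1-X ^ᵖ e) k)) (fromℤ-1-X^ e k)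
fromℤ-binomialPower (suc l) e zero    = cong fromℤ (X^-· l (1-X ^ᵖ e) zero)
fromℤ-binomialPower (suc l) e (suc k) = trans (cong fromℤ (X^-· l (1-X ^ᵖ e) (suc k))) (fromℤ-binomialPower l e k)

hSeq : ℕ → (ℕ → ℚ) → Seq
hSeq d f k = ∑ d λ l → f l * binomialPower l (d ∸ l) k

hVector≡hSeq : ∀ d {n} (Δ : SimplicialComplex n) i →
  fromℤ (hVector d Δ i) ≡ hSeq d (λ l → fromℕ (faces Δ l)) (toℕ i)
hVector≡hSeq d Δ i = begin
  fromℤ (sumℤ {suc d} (λ l → pos (faces Δ (toℕ l)) ℤ.* (X ^ᵖ toℕ l · 1-X ^ᵖ (d ∸ toℕ l)) (toℕ i)))
    ≡⟨ fromℤ-sum {suc d} (λ l → pos (faces Δ (toℕ l)) ℤ.* (X ^ᵖ toℕ l · 1-X ^ᵖ (d ∸ toℕ l)) (toℕ i)) ⟩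
  sumℚ {suc d} (λ l → fromℤ (pos (faces Δ (toℕ l)) ℤ.* (X ^ᵖ toℕ l · 1-X ^ᵖ (d ∸ toℕ l)) (toℕ i)))
    ≡⟨ Sum.sum-cong-≗ {suc d} (λ l → trans
         (fromℤ-* (pos (faces Δ (toℕ l))) ((X ^ᵖ toℕ l · 1-X ^ᵖ (d ∸ toℕ l)) (toℕ i)))
         (cong (fromℕ (faces Δ (toℕ l)) *_) (fromℤ-binomialPower (toℕ l) (d ∸ toℕ l) (toℕ i)))) ⟩
  sumℚ {suc d} (λ l → fromℕ (faces Δ (toℕ l)) * binomialPower (toℕ l) (d ∸ toℕ l) (toℕ i))
    ≡⟨ sumℚ≡∑ d (λ l → fromℕ (faces Δ l) * binomialPower l (d ∸ l) (toℕ i)) ⟩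
  hSeq d (λ l → fromℕ (faces Δ l)) (toℕ i) ∎
  where open ≡-Reasoning

-- The h-vector against the basis x^j (1+x)^(d-j).

-- Σ_j p_j x^j (1+x)^(d-j)

homogenize : ℕ → Seq → ℚ → ℚ
homogenize zero    p x = p zero
homogenize (suc d) p x = (x + 1ℚ) * homogenize d p x + p (suc d) * x ^ suc d

knots-power : ∀ y ε {a n} → n ℕ.≤ a → knots y ε a n ≡ y ^ n
knots-power y ε z≤n       = refl
knots-power y ε (s≤s n≤a) = cong (y *_) (knots-power y ε n≤a)

∑-basis : ∀ d p x → ∑ d (λ j → p j * basis d d d j x) ≡ homogenize d p x
∑-basis d p x = trans (∑-cong d λ {j} j≤d → cong (p j *_)
    (cong₂ _*_ (knots-power (x + 1ℚ) 1ℚ (ℕ.m∸n≤m d j)) (knots-power x (- 1ℚ) j≤d)))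
  (powers d)
  where
  open ≡-Reasoning
  powers : ∀ d → ∑ d (λ j → p j * ((x + 1ℚ) ^ (d ∸ j) * x ^ j)) ≡ homogenize d p x
  powers zero    = *-identityʳ (p 0)
  powers (suc d) = cong₂ _+_
    (begin
      ∑ d (λ j → p j * ((x + 1ℚ) ^ (suc d ∸ j) * x ^ j))
        ≡⟨ ∑-cong d (λ {j} j≤d → trans (cong (λ n → p j * ((x + 1ℚ) ^ n * x ^ j)) (ℕ.+-∸-assoc 1 j≤d))
             (solve 4 (λ p y a b → p :* (y :* a :* b) := y :* (p :* (a :* b))) refl
               (p j) (x + 1ℚ) ((x + 1ℚ) ^ (d ∸ j)) (x ^ j))) ⟩
      ∑ d (λ j → (x + 1ℚ) * (p j * ((x + 1ℚ) ^ (d ∸ j) * x ^ j)))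
        ≡⟨ ∑-* d (x + 1ℚ) (λ j → p j * ((x + 1ℚ) ^ (d ∸ j) * x ^ j)) ⟩
      (x + 1ℚ) * ∑ d (λ j → p j * ((x + 1ℚ) ^ (d ∸ j) * x ^ j))
        ≡⟨ cong ((x + 1ℚ) *_) (powers d) ⟩
      (x + 1ℚ) * homogenize d p x ∎)
    (cong (p (suc d) *_) (trans (cong (λ n → (x + 1ℚ) ^ n * x ^ suc d) (ℕ.n∸n≡0 d)) (*-identityˡ (x ^ suc d))))

homogenize-shift : ∀ d p x → homogenize (suc d) (shift p) x ≡ x * homogenize d p x
homogenize-shift zero    p x = solve 2 (λ x p → (x :+ con 1ℚ) :* con 0ℚ :+ p :* (x :* con 1ℚ) := x :* p) refl x (p 0)
homogenize-shift (suc d) p x = trans (cong (λ z → (x + 1ℚ) * z + p (suc d) * (x * x ^ suc d)) (homogenize-shift d p x))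
  (solve 4 (λ x h p y → (x :+ con 1ℚ) :* (x :* h) :+ p :* (x :* y) := x :* ((x :+ con 1ℚ) :* h :+ p :* y)) refl
    x (homogenize d p x) (p (suc d)) (x ^ suc d))

-- For p of degree at most d, `homogenize d p x` is (x+1)^d p(x/(x+1)) wherever x + 1 ≠ 0. Since 1 -
-- x/(x+1) = 1/(x+1), multiplying p by 1 - x compensates for the raised degree. The correction is
-- the coefficient that `homogenize d` cuts off.
homogenize-∇ : ∀ d p x → homogenize (suc d) (∇ p) x ≡ homogenize d p x + p (suc d) * x ^ suc d
homogenize-∇ zero    p x =
  solve 3 (λ x p q → (x :+ con 1ℚ) :* p :+ (q :- p) :* (x :* con 1ℚ) := p :+ q :* (x :* con 1ℚ)) refl x (p 0) (p 1)
homogenize-∇ (suc d) p x =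
  trans (cong (λ z → (x + 1ℚ) * z + (p (suc (suc d)) - p (suc d)) * (x * x ^ suc d)) (homogenize-∇ d p x))
  (solve 5 (λ x h p q y → (x :+ con 1ℚ) :* (h :+ p :* y) :+ (q :- p) :* (x :* y) :=
      (x :+ con 1ℚ) :* h :+ p :* y :+ q :* (x :* y)) refl
    x (homogenize d p x) (p (suc d)) (p (suc (suc d))) (x ^ suc d))

iter-∇-one-degree : ∀ e {k} → e ℕ.< k → iter ∇ e one k ≡ 0ℚ
iter-∇-one-degree zero    (s≤s _)   = refl
iter-∇-one-degree (suc e) (s≤s e<k) =
  cong₂ _-_ (iter-∇-one-degree e (ℕ.m<n⇒m<1+n e<k)) (iter-∇-one-degree e e<k)

homogenize-1-x^ : ∀ e x → homogenize e (iter ∇ e one) x ≡ 1ℚ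
homogenize-1-x^ zero    x = refl
homogenize-1-x^ (suc e) x = begin
  homogenize (suc e) (∇ (iter ∇ e one)) x
    ≡⟨ homogenize-∇ e (iter ∇ e one) x ⟩
  homogenize e (iter ∇ e one) x + iter ∇ e one (suc e) * x ^ suc e
    ≡⟨ cong₂ (λ a b → a + b * x ^ suc e) (homogenize-1-x^ e x) (iter-∇-one-degree e ℕ.≤-refl) ⟩
  1ℚ + 0ℚ * x ^ suc e
    ≡⟨ solve 1 (λ y → con 1ℚ :+ con 0ℚ :* y := con 1ℚ) refl (x ^ suc e) ⟩
  1ℚ ∎
  where open ≡-Reasoning

homogenize-binomialPower : ∀ l e x → homogenize (l ℕ.+ e) (binomialPower l e) x ≡ x ^ l
homogenize-binomialPower zero    e x = homogenize-1-x^ e x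
homogenize-binomialPower (suc l) e x = trans (homogenize-shift (l ℕ.+ e) (binomialPower l e) x)
  (cong (x *_) (homogenize-binomialPower l e x))

∑-hSeq-basis : ∀ d f x → ∑ d (λ j → hSeq d f j * basis d d d j x) ≡ ∑ d (λ l → f l * x ^ l)
∑-hSeq-basis d f x = begin
  ∑ d (λ j → hSeq d f j * b j)
    ≡⟨ ∑-cong d (λ {j} _ → trans (*-comm (hSeq d f j) (b j)) (trans (sym (∑-* d (b j) (λ l → f l * c l j)))
         (∑-cong d λ {l} _ → solve 3 (λ a b c → a :* (b :* c) := b :* (c :* a)) refl (b j) (f l) (c l j)))) ⟩
  ∑ d (λ j → ∑ d (λ l → f l * (c l j * b j)))
    ≡⟨ ∑-swap d d (λ j l → f l * (c l j * b j)) ⟩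
  ∑ d (λ l → ∑ d (λ j → f l * (c l j * b j)))
    ≡⟨ ∑-cong d (λ {l} l≤d → trans (∑-* d (f l) (λ j → c l j * b j)) (cong (f l *_) (begin
         ∑ d (λ j → c l j * b j)               ≡⟨ ∑-basis d (c l) x ⟩
         homogenize d (c l) x                  ≡⟨ cong (λ n → homogenize n (c l) x) (ℕ.m+[n∸m]≡n l≤d) ⟨
         homogenize (l ℕ.+ (d ∸ l)) (c l) x    ≡⟨ homogenize-binomialPower l (d ∸ l) x ⟩
         x ^ l                                 ∎))) ⟩
  ∑ d (λ l → f l * x ^ l) ∎
  where
  open ≡-Reasoning
  b : ℕ → ℚ
  b j = basis d d d j x
  c : ℕ → Seq
  c l = binomialPower l (d ∸ l)

-- From multichain counts to h-vectors.

binomials : ℕ → Seq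
binomials l m = fromℕ (m C l)

∇-binomials : ∀ l → ∇ (binomials (suc l)) ≗ shift (binomials l)
∇-binomials l zero    = refl
∇-binomials l (suc m) = trans
  (cong (_- fromℕ (m C suc l)) (trans (cong fromℕ (sym (nCk+nC[k+1]≡[n+1]C[k+1] m l))) (fromℕ-+ (m C l) (m C suc l))))
  (solve 2 (λ a b → (a :+ b) :- b := a) refl (fromℕ (m C l)) (fromℕ (m C suc l)))

∇-binomials-zero : ∇ (binomials 0) ≗ one
∇-binomials-zero zero    = refl
∇-binomials-zero (suc m) = refl

-- The generating function Σ_m C(m,l) x^m = x^l/(1-x)^(l+1), with Pascal's rule clearing one factor
-- of the denominator at a time.
iter-∇-binomials : ∀ l → iter ∇ (suc l) (binomials l) ≗ iter shift l one
iter-∇-binomials zero    k = ∇-binomials-zero k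
iter-∇-binomials (suc l) k = begin
  iter ∇ (suc (suc l)) (binomials (suc l)) k     ≡⟨ commute-iter {∇} ∇-linear (λ _ _ → refl) (suc l) (binomials (suc l)) k ⟩
  iter ∇ (suc l) (∇ (binomials (suc l))) k       ≡⟨ iter-linear ∇-linear (suc l) .cong-≗ (∇-binomials l) k ⟩
  iter ∇ (suc l) (shift (binomials l)) k         ≡⟨ iter-commute ∇-linear ∇-shift (suc l) (binomials l) k ⟩
  shift (iter ∇ (suc l) (binomials l)) k         ≡⟨ shift-linear .cong-≗ (iter-∇-binomials l) k ⟩
  iter shift (suc l) one k                       ∎
  where open ≡-Reasoning

iter-+ : ∀ T m n f → iter T (m ℕ.+ n) f ≡ iter T m (iter T n f)
iter-+ T zero    n f = refl
iter-+ T (suc m) n f = cong T (iter-+ T m n f)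

iter-∇-binomials-binomialPower : ∀ {d l} → l ℕ.≤ d → iter ∇ (suc d) (binomials l) ≗ binomialPower l (d ∸ l)
iter-∇-binomials-binomialPower {d} {l} l≤d k = begin
  iter ∇ (suc d) (binomials l) k
    ≡⟨ cong (λ n → iter ∇ n (binomials l) k) (trans (ℕ.+-suc (d ∸ l) l) (cong suc (ℕ.m∸n+n≡m l≤d))) ⟨
  iter ∇ ((d ∸ l) ℕ.+ suc l) (binomials l) k
    ≡⟨ cong (λ f → f k) (iter-+ ∇ (d ∸ l) (suc l) (binomials l)) ⟩
  iter ∇ (d ∸ l) (iter ∇ (suc l) (binomials l)) k
    ≡⟨ iter-linear ∇-linear (d ∸ l) .cong-≗ (iter-∇-binomials l) k ⟩
  iter ∇ (d ∸ l) (iter shift l one) k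
    ≡⟨ commute-iter shift-linear (iter-commute ∇-linear ∇-shift (d ∸ l)) l one k ⟩
  binomialPower l (d ∸ l) k ∎
  where open ≡-Reasoning

-- Division by 1 + x.

alternate : Seq → Seq
alternate f zero    = f zero
alternate f (suc k) = f (suc k) - alternate f k

pairSum-alternate : ∀ f → pairSum (alternate f) ≗ f
pairSum-alternate f zero    = refl
pairSum-alternate f (suc k) = solve 2 (λ a b → (a :- b) :+ b := a) refl (f (suc k)) (alternate f k)

-- The two hypotheses say that M is E₂ of F/(1+x), in a form without subtraction that counts of
-- chains can supply. Then (1-x)^(d+1) E₂[F/(1+x)] = E₂[(1+x)^d (1-x)^(d+1) F], and F is expanded in
-- the basis r^j (r+1)^(d-j) with coefficients `hSeq d f j`.
hSeq-transform : ∀ d (f f′ : ℕ → ℚ) →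
  let F = λ r → ∑ d (λ l → f l * fromℕ r ^ l)
      M = λ m → ∑ d (λ l → f′ l * binomials l m) in
  M 0 ≡ F 0 → (∀ m → M (suc m) + F (suc (double m)) ≡ M m + F (double (suc m))) →
  ∀ k → hSeq d f′ k ≡ ∑ d (λ j → hSeq d f j * intervalColumn d j k)
hSeq-transform d f f′ M₀≡ M-step k = begin
  hSeq d f′ k
    ≡⟨ ∑-cong d (λ {l} l≤d → cong (f′ l *_) (iter-∇-binomials-binomialPower l≤d k)) ⟨
  ∑ d (λ l → f′ l * iter ∇ (suc d) (binomials l) k)
    ≡⟨ linear-∑ (iter-linear ∇-linear (suc d)) d f′ binomials k ⟨
  iter ∇ (suc d) M k
    ≡⟨ iter-linear ∇-linear (suc d) .cong-≗ M≗ k ⟩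
  iter ∇ (suc d) (even (alternate F)) k
    ≡⟨ iter-∇-even (suc d) (alternate F) k ⟩
  even (iter pairSum (suc d) (iter ∇ (suc d) (alternate F))) k
    ≡⟨ commute-iter {pairSum} pairSum-linear (λ _ _ → refl) d (iter ∇ (suc d) (alternate F)) (double k) ⟩
  even (iter pairSum d (pairSum (iter ∇ (suc d) (alternate F)))) k
    ≡⟨ iter-linear pairSum-linear d .cong-≗ (λ k → sym (iter-commute ∇-linear ∇-pairSum (suc d) (alternate F) k)) (double k) ⟩
  even (iter pairSum d (iter ∇ (suc d) (pairSum (alternate F)))) k
    ≡⟨ Ψ-linear .cong-≗ (pairSum-alternate F) k ⟩
  Ψ F k
    ≡⟨ Ψ-linear .cong-≗ (λ r → sym (∑-hSeq-basis d f (fromℕ r))) k ⟩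
  Ψ (λ r → ∑ d (λ j → hSeq d f j * basis d d d j (fromℕ r))) k
    ≡⟨ linear-∑ Ψ-linear d (hSeq d f) (λ j r → basis d d d j (fromℕ r)) k ⟩
  ∑ d (λ j → hSeq d f j * intervalColumn d j k) ∎
  where
  open ≡-Reasoning
  F M : Seq
  F r = ∑ d (λ l → f l * fromℕ r ^ l)
  M m = ∑ d (λ l → f′ l * binomials l m)

  Ψ : Seq → Seq
  Ψ g = even (iter pairSum d (iter ∇ (suc d) g))

  Ψ-linear : Linear Ψ
  Ψ-linear = ∘-linear even-linear (∘-linear (iter-linear pairSum-linear d) (iter-linear ∇-linear (suc d)))

  M≗ : M ≗ even (alternate F)
  M≗ zero    = M₀≡
  M≗ (suc m) = begin
    M (suc m)
      ≡⟨ solve 2 (λ a b → a := (a :+ b) :- b) refl (M (suc m)) (F (suc (double m))) ⟩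
    (M (suc m) + F (suc (double m))) - F (suc (double m))
      ≡⟨ cong (_- F (suc (double m))) (trans (M-step m) (cong (_+ F (double (suc m))) (M≗ m))) ⟩
    (alternate F (double m) + F (double (suc m))) - F (suc (double m))
      ≡⟨ solve 3 (λ g a b → (g :+ a) :- b := a :- (b :- g)) refl (alternate F (double m)) (F (double (suc m))) (F (suc (double m))) ⟩
    alternate F (double (suc m)) ∎

-- Sums over lists and over subsets.

when : Bool → ℕ → ℕ
when b n = if b then n else 0

module _ {A : Set} where

  Σˡ : List A → (A → ℕ) → ℕ
  Σˡ []       f = 0
  Σˡ (x ∷ xs) f = f x ℕ.+ Σˡ xs f

  Σˡ-cong : ∀ xs {f g : A → ℕ} → (∀ {x} → x ∈ˡ xs → f x ≡ g x) → Σˡ xs f ≡ Σˡ xs g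
  Σˡ-cong []       f≗g = refl
  Σˡ-cong (x ∷ xs) f≗g = cong₂ ℕ._+_ (f≗g (here refl)) (Σˡ-cong xs (f≗g ∘ there))

  Σˡ-+ : ∀ xs (f g : A → ℕ) → Σˡ xs (λ x → f x ℕ.+ g x) ≡ Σˡ xs f ℕ.+ Σˡ xs g
  Σˡ-+ []       f g = refl
  Σˡ-+ (x ∷ xs) f g = trans (cong (f x ℕ.+ g x ℕ.+_) (Σˡ-+ xs f g)) (interchange (f x) (g x) (Σˡ xs f) (Σˡ xs g))
    where
    interchange : ∀ a b c d → a ℕ.+ b ℕ.+ (c ℕ.+ d) ≡ a ℕ.+ c ℕ.+ (b ℕ.+ d)
    interchange = solve-∀

  Σˡ-zero : ∀ xs {f : A → ℕ} → (∀ {x} → x ∈ˡ xs → f x ≡ 0) → Σˡ xs f ≡ 0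
  Σˡ-zero []       f≡0 = refl
  Σˡ-zero (x ∷ xs) f≡0 = cong₂ ℕ._+_ (f≡0 (here refl)) (Σˡ-zero xs (f≡0 ∘ there))

  Σˡ-*ˡ : ∀ xs c (f : A → ℕ) → Σˡ xs (λ x → c ℕ.* f x) ≡ c ℕ.* Σˡ xs f
  Σˡ-*ˡ []       c f = sym (ℕ.*-zeroʳ c)
  Σˡ-*ˡ (x ∷ xs) c f = trans (cong (c ℕ.* f x ℕ.+_) (Σˡ-*ˡ xs c f)) (sym (ℕ.*-distribˡ-+ c (f x) (Σˡ xs f)))

  Σˡ-++ : ∀ xs ys (f : A → ℕ) → Σˡ (xs ++ ys) f ≡ Σˡ xs f ℕ.+ Σˡ ys f
  Σˡ-++ []       ys f = refl
  Σˡ-++ (x ∷ xs) ys f = trans (cong (f x ℕ.+_) (Σˡ-++ xs ys f)) (sym (ℕ.+-assoc (f x) (Σˡ xs f) (Σˡ ys f)))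

Σˡ-map : ∀ {A B : Set} (h : B → A) xs (f : A → ℕ) → Σˡ (List.map h xs) f ≡ Σˡ xs (f ∘ h)
Σˡ-map h []       f = refl
Σˡ-map h (x ∷ xs) f = cong (f (h x) ℕ.+_) (Σˡ-map h xs f)

Σˡ-swap : ∀ {A B : Set} (xs : List A) (ys : List B) (f : A → B → ℕ) →
  Σˡ xs (λ x → Σˡ ys (f x)) ≡ Σˡ ys (λ y → Σˡ xs (λ x → f x y))
Σˡ-swap []       ys f = sym (Σˡ-zero ys λ _ → refl)
Σˡ-swap (x ∷ xs) ys f = trans (cong (Σˡ ys (f x) ℕ.+_) (Σˡ-swap xs ys f))
  (sym (Σˡ-+ ys (f x) (λ y → Σˡ xs (λ x → f x y))))

Σˡ-cartesianProduct : ∀ {A B : Set} (xs : List A) (ys : List B) (f : A × B → ℕ) →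
  Σˡ (cartesianProduct xs ys) f ≡ Σˡ xs (λ x → Σˡ ys (λ y → f (x , y)))
Σˡ-cartesianProduct []       ys f = refl
Σˡ-cartesianProduct (x ∷ xs) ys f = trans (Σˡ-++ (List.map (x ,_) ys) (cartesianProduct xs ys) f)
  (cong₂ ℕ._+_ (Σˡ-map (x ,_) ys f) (Σˡ-cartesianProduct xs ys f))

does-true : ∀ {P : Set} (P? : Dec P) → does P? ≡ true → P
does-true (yes p) _ = p

does-unique : ∀ {P : Set} (P? : Dec P) {b} → (P → b ≡ true) → (b ≡ true → P) → does P? ≡ b
does-unique (yes p) to from = sym (to p)
does-unique (no ¬p) {false} to from = refl
does-unique (no ¬p) {true}  to from = ⊥-elim (¬p (from refl))

∧-true : ∀ {a b} → a ∧ b ≡ true → a ≡ true × b ≡ true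
∧-true {true} b≡true = refl , b≡true

Σˡ-subsets : ∀ n (f : Subset (suc n) → ℕ) →
  Σˡ (subsets (suc n)) f ≡ Σˡ (subsets n) (f ∘ (outside ∷_)) ℕ.+ Σˡ (subsets n) (f ∘ (inside ∷_))
Σˡ-subsets n f = trans (Σˡ-++ (List.map (outside ∷_) (subsets n)) (List.map (inside ∷_) (subsets n)) f)
  (cong₂ ℕ._+_ (Σˡ-map (outside ∷_) (subsets n) f) (Σˡ-map (inside ∷_) (subsets n) f))

-- Weighted counts of chains in a finite poset given as a list.

module Cliques {A : Set} (le : A → A → Bool)
  (le-refl : ∀ x → le x x ≡ true)
  (le-trans : ∀ {x y z} → le x y ≡ true → le y z ≡ true → le x z ≡ true)
  (le-antisym : ∀ {x y} → le x y ≡ true → le y x ≡ true → x ≡ y) where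

  comparable below : A → A → Bool
  comparable x y = le x y ∨ le y x
  below x y = le x y ∧ not (le y x)

  -- Σ φ(|S|) over the sublists S of pairwise comparable elements satisfying p.

  cliques : List A → (A → Bool) → (ℕ → ℕ) → ℕ
  cliques []       p φ = φ 0
  cliques (x ∷ xs) p φ = cliques xs p φ ℕ.+ when (p x) (cliques xs (λ y → p y ∧ comparable x y) (φ ∘ suc))

  cliques-cong : ∀ xs {p q φ ψ} → p ≗ q → φ ≗ ψ → cliques xs p φ ≡ cliques xs q ψ
  cliques-cong []       p≗q φ≗ψ = φ≗ψ 0
  cliques-cong (x ∷ xs) p≗q φ≗ψ = cong₂ ℕ._+_ (cliques-cong xs p≗q φ≗ψ)
    (cong₂ when (p≗q x) (cliques-cong xs (λ y → cong (_∧ comparable x y) (p≗q y)) (φ≗ψ ∘ suc)))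

  cliques-+ : ∀ xs p φ ψ → cliques xs p (λ s → φ s ℕ.+ ψ s) ≡ cliques xs p φ ℕ.+ cliques xs p ψ
  cliques-+ []       p φ ψ = refl
  cliques-+ (x ∷ xs) p φ ψ with p x
  ... | false = trans (ℕ.+-identityʳ (cliques xs p (λ s → φ s ℕ.+ ψ s))) (trans (cliques-+ xs p φ ψ)
                  (cong₂ ℕ._+_ (sym (ℕ.+-identityʳ (cliques xs p φ))) (sym (ℕ.+-identityʳ (cliques xs p ψ)))))
  ... | true  = trans (cong₂ ℕ._+_ (cliques-+ xs p φ ψ) (cliques-+ xs q (φ ∘ suc) (ψ ∘ suc)))
      (interchange (cliques xs p φ) (cliques xs p ψ) (cliques xs q (φ ∘ suc)) (cliques xs q (ψ ∘ suc)))
    where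
    q : A → Bool
    q y = p y ∧ comparable x y
    interchange : ∀ a b c d → a ℕ.+ b ℕ.+ (c ℕ.+ d) ≡ a ℕ.+ c ℕ.+ (b ℕ.+ d)
    interchange = solve-∀

  cliques-zero : ∀ xs p → cliques xs p (λ _ → 0) ≡ 0
  cliques-zero []       p = refl
  cliques-zero (x ∷ xs) p with p x
  ... | false = cong (ℕ._+ 0) (cliques-zero xs p)
  ... | true  = cong₂ ℕ._+_ (cliques-zero xs p) (cliques-zero xs (λ y → p y ∧ comparable x y))

  below-irrefl : ∀ x → below x x ≡ false
  below-irrefl x = Bool.∧-inverseʳ (le x x)

  below⇒le : ∀ {x y} → below x y ≡ true → le x y ≡ true
  below⇒le {x} {y} x<y with le x y
  ... | true = refl

  below⇒≱ : ∀ {x y} → below x y ≡ true → le y x ≡ false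
  below⇒≱ {x} {y} x<y with le x y | le y x
  ... | true | false = refl

  le∧≱⇒below : ∀ {x y} → le x y ≡ true → le y x ≡ false → below x y ≡ true
  le∧≱⇒below x≤y y≰x = cong₂ (λ a b → a ∧ not b) x≤y y≰x

  below-trans : ∀ {x y z} → below x y ≡ true → below y z ≡ true → below x z ≡ true
  below-trans {x} {y} {z} x<y y<z = le∧≱⇒below (le-trans (below⇒le {x} {y} x<y) (below⇒le {y} {z} y<z)) (z≰x _ refl)
    where
    z≰x : ∀ b → le z x ≡ b → le z x ≡ false
    z≰x false eq = eq
    z≰x true  eq with trans (sym (below⇒≱ {y} {z} y<z)) (le-trans eq (below⇒le {x} {y} x<y))
    ... | ()

  below⇒comparable : ∀ {x y} → below x y ≡ true → comparable y x ≡ true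
  below⇒comparable {x} {y} x<y = trans (cong (le y x ∨_) (below⇒le {x} {y} x<y)) (Bool.∨-zeroʳ (le y x))

  -- Classify the nonempty cliques by their largest element. Induction on the list, splitting at its head z:
  -- a clique containing z has top z, or its top x is above z, or below z.

  cliques-top : ∀ {xs} → Unique xs → ∀ p φ → cliques xs p φ ≡
    φ 0 ℕ.+ Σˡ xs (λ x → when (p x) (cliques xs (λ y → p y ∧ below y x) (φ ∘ suc)))
  cliques-top {[]}     []          p φ = sym (ℕ.+-identityʳ (φ 0))
  cliques-top {z ∷ ws} (z∉ws ∷ ws!) p φ = begin
    cliques ws p φ ℕ.+ when (p z) (cliques ws (p ∧ᵖ comparable z) (φ ∘ suc))
      ≡⟨ cong₂ ℕ._+_ (cliques-top ws! p φ) (containing-z (p z)) ⟩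
    φ 0 ℕ.+ Σˡ ws rest ℕ.+ when (p z) (cliques ws (p ∧ᵖ (λ y → below y z)) (φ ∘ suc) ℕ.+ Σˡ ws above)
      ≡⟨ cong (φ 0 ℕ.+ Σˡ ws rest ℕ.+_) (when-+ (p z) (cliques ws (p ∧ᵖ (λ y → below y z)) (φ ∘ suc)) (Σˡ ws above)) ⟩
    φ 0 ℕ.+ Σˡ ws rest ℕ.+ (top-z ℕ.+ when (p z) (Σˡ ws above))
      ≡⟨ rearrange (φ 0) (Σˡ ws rest) top-z (when (p z) (Σˡ ws above)) ⟩
    φ 0 ℕ.+ (top-z ℕ.+ (Σˡ ws rest ℕ.+ when (p z) (Σˡ ws above)))
      ≡⟨ cong (λ n → φ 0 ℕ.+ (top-z ℕ.+ n)) (trans (cong (Σˡ ws rest ℕ.+_) (when-Σˡ (p z) ws above))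
           (sym (Σˡ-+ ws rest (λ x → when (p z) (above x))))) ⟩
    φ 0 ℕ.+ (top-z ℕ.+ Σˡ ws (λ x → rest x ℕ.+ when (p z) (above x)))
      ≡⟨ cong₂ (λ m n → φ 0 ℕ.+ (m ℕ.+ n)) head≡ (Σˡ-cong ws λ {x} _ → tail≡ x (p x) (p z)) ⟩
    φ 0 ℕ.+ (when (p z) (cliques (z ∷ ws) (p ∧ᵖ (λ y → below y z)) (φ ∘ suc)) ℕ.+
      Σˡ ws (λ x → when (p x) (cliques (z ∷ ws) (p ∧ᵖ (λ y → below y x)) (φ ∘ suc)))) ∎
    where
    open ≡-Reasoning
    infixr 6 _∧ᵖ_
    _∧ᵖ_ : (A → Bool) → (A → Bool) → A → Bool
    (q ∧ᵖ r) y = q y ∧ r y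

    rest above : A → ℕ
    rest x = when (p x) (cliques ws (p ∧ᵖ (λ y → below y x)) (φ ∘ suc))
    -- Cliques with largest element x that also contain z; both elements are split off, hence the
    -- shift of `φ` by two.
    above x = when (p x) (when (below z x) (cliques ws (λ y → (p y ∧ below y x) ∧ comparable z y) (λ s → φ (suc (suc s)))))

    top-z : ℕ
    top-z = when (p z) (cliques ws (p ∧ᵖ (λ y → below y z)) (φ ∘ suc))

    rearrange : ∀ a b c d → a ℕ.+ b ℕ.+ (c ℕ.+ d) ≡ a ℕ.+ (c ℕ.+ (b ℕ.+ d))
    rearrange = solve-∀

    when-+ : ∀ b m n → when b (m ℕ.+ n) ≡ when b m ℕ.+ when b n
    when-+ false m n = refl
    when-+ true  m n = refl

    when-Σˡ : ∀ b xs f → when b (Σˡ xs f) ≡ Σˡ xs (λ x → when b (f x))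
    when-Σˡ false xs f = sym (Σˡ-zero xs λ _ → refl)
    when-Σˡ true  xs f = refl

    head≡ : top-z ≡ when (p z) (cliques (z ∷ ws) (p ∧ᵖ (λ y → below y z)) (φ ∘ suc))
    head≡ = cong (when (p z)) (sym (trans
      (cong (λ b → cliques ws (p ∧ᵖ (λ y → below y z)) (φ ∘ suc) ℕ.+
        when b (cliques ws (λ y → (p y ∧ below y z) ∧ comparable z y) (λ s → φ (suc (suc s)))))
        (trans (cong (p z ∧_) (below-irrefl z)) (Bool.∧-zeroʳ (p z))))
      (ℕ.+-identityʳ _)))

    tail≡ : ∀ x b c →
      when b (cliques ws (p ∧ᵖ (λ y → below y x)) (φ ∘ suc)) ℕ.+
        when c (when b (when (below z x) (cliques ws (λ y → (p y ∧ below y x) ∧ comparable z y) (λ s → φ (suc (suc s)))))) ≡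
      when b (cliques ws (p ∧ᵖ (λ y → below y x)) (φ ∘ suc) ℕ.+
        when (c ∧ below z x) (cliques ws (λ y → (p y ∧ below y x) ∧ comparable z y) (λ s → φ (suc (suc s)))))
    tail≡ x false false = refl
    tail≡ x false true  = refl
    tail≡ x true  false = refl
    tail≡ x true  true  = refl

    -- The position of the top x relative to z decides: equality is excluded because z does not
    -- recur in `ws`, x above z gives `above x`, x below z leaves z on top, and an incomparable x
    -- contributes nothing.
    split : ∀ {x} → x ∈ˡ ws → ∀ b c d → p x ≡ b → le z x ≡ c → le x z ≡ d →
      when (p x ∧ comparable z x) (cliques ws (λ y → (p y ∧ comparable z y) ∧ below y x) (λ s → φ (suc (suc s)))) ≡
      when (p x ∧ below x z) (cliques ws (λ y → (p y ∧ below y z) ∧ below y x) (λ s → φ (suc (suc s)))) ℕ.+ above x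
    split x∈ws false c d px _ _ rewrite px = refl
    split {x} x∈ws true true true px z≤x x≤z = ⊥-elim (All.lookup z∉ws x∈ws (le-antisym z≤x x≤z))
    split {x} x∈ws true true false px z≤x x≰z rewrite px | z≤x | x≰z =
      cliques-cong ws (λ y → trans (Bool.∧-assoc (p y) (comparable z y) (below y x))
        (trans (cong (p y ∧_) (Bool.∧-comm (comparable z y) (below y x)))
          (sym (Bool.∧-assoc (p y) (below y x) (comparable z y))))) (λ _ → refl)
    split {x} x∈ws true false true px z≰x x≤z rewrite px | z≰x | x≤z =
      trans (cliques-cong ws (λ y → same y _ refl) (λ _ → refl)) (sym (ℕ.+-identityʳ _))
      where
      same : ∀ y b → below y x ≡ b → (p y ∧ comparable z y) ∧ below y x ≡ (p y ∧ below y z) ∧ below y x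
      same y false y≮x = trans (trans (cong (λ b → (p y ∧ comparable z y) ∧ b) y≮x) (Bool.∧-zeroʳ _))
        (sym (trans (cong (λ b → (p y ∧ below y z) ∧ b) y≮x) (Bool.∧-zeroʳ _)))
      same y true  y<x = cong (λ b → (p y ∧ b) ∧ below y x) (trans (below⇒comparable {y} {z} y<z) (sym y<z))
        where
        y<z : below y z ≡ true
        y<z = below-trans {y} {x} {z} y<x (le∧≱⇒below x≤z z≰x)
    split {x} x∈ws true false false px z≰x x≰z rewrite px | z≰x | x≰z = refl

    containing-z : ∀ b → when b (cliques ws (p ∧ᵖ comparable z) (φ ∘ suc)) ≡
      when b (cliques ws (p ∧ᵖ (λ y → below y z)) (φ ∘ suc) ℕ.+ Σˡ ws above)
    containing-z false = refl
    -- The induction hypothesis is used twice: cliques comparable with z are classified by their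
    -- largest element, then the empty clique and those with top below z are reassembled into the
    -- cliques below z.
    containing-z true  = begin
      cliques ws (p ∧ᵖ comparable z) (φ ∘ suc)
        ≡⟨ cliques-top ws! (p ∧ᵖ comparable z) (φ ∘ suc) ⟩
      φ 1 ℕ.+ Σˡ ws (λ x → when (p x ∧ comparable z x) (cliques ws (λ y → (p y ∧ comparable z y) ∧ below y x) (λ s → φ (suc (suc s)))))
        ≡⟨ cong (φ 1 ℕ.+_) (trans (Σˡ-cong ws λ {x} x∈ws → split x∈ws (p x) (le z x) (le x z) refl refl refl)
             (Σˡ-+ ws _ above)) ⟩
      φ 1 ℕ.+ (Σˡ ws (λ x → when (p x ∧ below x z) (cliques ws (λ y → (p y ∧ below y z) ∧ below y x) (λ s → φ (suc (suc s))))) ℕ.+ Σˡ ws above)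
        ≡⟨ ℕ.+-assoc (φ 1) _ (Σˡ ws above) ⟨
      φ 1 ℕ.+ Σˡ ws (λ x → when (p x ∧ below x z) (cliques ws (λ y → (p y ∧ below y z) ∧ below y x) (λ s → φ (suc (suc s))))) ℕ.+ Σˡ ws above
        ≡⟨ cong (ℕ._+ Σˡ ws above) (cliques-top ws! (p ∧ᵖ (λ y → below y z)) (φ ∘ suc)) ⟨
      cliques ws (p ∧ᵖ (λ y → below y z)) (φ ∘ suc) ℕ.+ Σˡ ws above ∎

  -- Pascal's rule splits the weight into C(m, s) and C(m, s - 1). The second part vanishes on the
  -- empty clique, and removing the largest element of any other clique turns it back into C(m, ·).
  cliques-C-suc : ∀ {xs} → Unique xs → ∀ p m → cliques xs p (suc m C_) ≡
    cliques xs p (m C_) ℕ.+ Σˡ xs (λ x → when (p x) (cliques xs (λ y → p y ∧ below y x) (m C_)))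
  cliques-C-suc {xs} xs! p m = trans (cliques-cong xs (λ _ → refl) pascal)
    (trans (cliques-+ xs p (m C_) shifted) (cong (cliques xs p (m C_) ℕ.+_) (cliques-top xs! p shifted)))
    where
    shifted : ℕ → ℕ
    shifted zero    = 0
    shifted (suc s) = m C s

    pascal : ∀ s → suc m C s ≡ m C s ℕ.+ shifted s
    pascal zero    = refl
    pascal (suc s) = trans (sym (nCk+nC[k+1]≡[n+1]C[k+1] m s)) (ℕ.+-comm (m C s) (m C suc s))

  cliques-C-zero : ∀ {xs} → Unique xs → ∀ p → cliques xs p (0 C_) ≡ 1
  cliques-C-zero {xs} xs! p = trans (cliques-top xs! p (0 C_))
    (cong suc (Σˡ-zero xs λ {x} _ → vanish (p x) (cliques-zero xs (λ y → p y ∧ below y x))))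
    where
    vanish : ∀ b {n} → n ≡ 0 → when b n ≡ 0
    vanish false _   = refl
    vanish true  n≡0 = n≡0

  -- The values of `ν` increase along a chain and stay below k, so a clique has at most k elements
  -- and `φ` matters only up to k. Removing the largest element lowers the bound by one.
  cliques-truncate : ∀ {xs} → Unique xs → (ν : A → ℕ) → (∀ {x y} → x ∈ˡ xs → y ∈ˡ xs → below x y ≡ true → ν x ℕ.< ν y) →
    ∀ k p {φ ψ} → (∀ {s} → s ℕ.≤ k → φ s ≡ ψ s) → (∀ {x} → x ∈ˡ xs → p x ≡ true → ν x ℕ.< k) →
    cliques xs p φ ≡ cliques xs p ψ
  cliques-truncate {xs} xs! ν ν-mono k p {φ} {ψ} φ≗ψ ν<k = trans (cliques-top xs! p φ)
    (trans (cong₂ ℕ._+_ (φ≗ψ z≤n) (Σˡ-cong xs λ {x} x∈xs → term k φ≗ψ ν<k x∈xs (p x) refl))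
      (sym (cliques-top xs! p ψ)))
    where
    term : ∀ k → (∀ {s} → s ℕ.≤ k → φ s ≡ ψ s) → (∀ {x} → x ∈ˡ xs → p x ≡ true → ν x ℕ.< k) →
      ∀ {x} → x ∈ˡ xs → ∀ b → p x ≡ b →
      when b (cliques xs (λ y → p y ∧ below y x) (φ ∘ suc)) ≡ when b (cliques xs (λ y → p y ∧ below y x) (ψ ∘ suc))
    term k       φ≗ψ ν<k x∈xs false px = refl
    term zero    φ≗ψ ν<k x∈xs true  px with ν<k x∈xs px
    ... | ()
    term (suc k) φ≗ψ ν<k {x} x∈xs true px = cliques-truncate xs! ν ν-mono k (λ y → p y ∧ below y x) (φ≗ψ ∘ s≤s)
      λ {y} y∈xs py → ℕ.<-≤-trans (ν-mono y∈xs x∈xs (proj₂ (∧-true {p y} py))) (ℕ.≤-pred (ν<k x∈xs px))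

  -- A test that copies the recursion of `cliques`, consuming one bit of the subset per list
  -- element. `IsClique` is its meaning, and it links the faces of an order complex with `cliques`.
  clique? : ∀ (xs : List A) → (A → Bool) → Subset (length xs) → Bool
  clique? []       p []            = true
  clique? (x ∷ xs) p (outside ∷ S) = clique? xs p S
  clique? (x ∷ xs) p (inside  ∷ S) = p x ∧ clique? xs (λ y → p y ∧ comparable x y) S

  Σˡ-cliques : ∀ xs p φ →
    Σˡ (subsets (length xs)) (λ S → when (clique? xs p S) (φ ∣ S ∣)) ≡ cliques xs p φ
  Σˡ-cliques []       p φ = ℕ.+-identityʳ (φ 0)
  Σˡ-cliques (x ∷ xs) p φ = trans (Σˡ-subsets (length xs) (λ S → when (clique? (x ∷ xs) p S) (φ ∣ S ∣)))
    (cong₂ ℕ._+_ (Σˡ-cliques xs p φ) (containing-x (p x)))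
    where
    containing-x : ∀ b → Σˡ (subsets (length xs)) (λ S →
      when (b ∧ clique? xs (λ y → p y ∧ comparable x y) S) (φ (suc ∣ S ∣))) ≡
      when b (cliques xs (λ y → p y ∧ comparable x y) (φ ∘ suc))
    containing-x false = Σˡ-zero (subsets (length xs)) λ _ → refl
    containing-x true  = Σˡ-cliques xs (λ y → p y ∧ comparable x y) (φ ∘ suc)

  IsClique : ∀ (xs : List A) → (A → Bool) → Subset (length xs) → Set
  IsClique xs p S = (∀ i j → i ∈ S → j ∈ S → comparable (lookup xs i) (lookup xs j) ≡ true) ×
                    (∀ i → i ∈ S → p (lookup xs i) ≡ true)

  clique?-sound : ∀ (xs : List A) p S → clique? xs p S ≡ true → IsClique xs p S
  clique?-sound [] p [] _ = (λ { () }) , λ { () }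
  clique?-sound (x ∷ xs) p (outside ∷ S) c =
    (λ { (suc i) (suc j) (there i∈S) (there j∈S) → proj₁ (clique?-sound xs p S c) i j i∈S j∈S }) ,
    λ { (suc i) (there i∈S) → proj₂ (clique?-sound xs p S c) i i∈S }
  clique?-sound (x ∷ xs) p (inside ∷ S) c = pairwise , satisfies
    where
    rest : IsClique xs (λ y → p y ∧ comparable x y) S
    rest = clique?-sound xs (λ y → p y ∧ comparable x y) S (proj₂ (∧-true {p x} c))

    x~ : ∀ i → i ∈ S → comparable x (lookup xs i) ≡ true
    x~ i i∈S = proj₂ (∧-true {p (lookup xs i)} (proj₂ rest i i∈S))

    pairwise : ∀ i j → i ∈ inside ∷ S → j ∈ inside ∷ S → comparable (lookup (x ∷ xs) i) (lookup (x ∷ xs) j) ≡ true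
    pairwise zero    zero    here        here        = cong (_∨ le x x) (le-refl x)
    pairwise zero    (suc j) here        (there j∈S) = x~ j j∈S
    pairwise (suc i) zero    (there i∈S) here        =
      trans (Bool.∨-comm (le (lookup xs i) x) (le x (lookup xs i))) (x~ i i∈S)
    pairwise (suc i) (suc j) (there i∈S) (there j∈S) = proj₁ rest i j i∈S j∈S

    satisfies : ∀ i → i ∈ inside ∷ S → p (lookup (x ∷ xs) i) ≡ true
    satisfies zero    here        = proj₁ (∧-true {p x} c)
    satisfies (suc i) (there i∈S) = proj₁ (∧-true {p (lookup xs i)} (proj₂ rest i i∈S))

  clique?-complete : ∀ (xs : List A) p S → IsClique xs p S → clique? xs p S ≡ true
  clique?-complete []       p []            _       = refl
  clique?-complete (x ∷ xs) p (outside ∷ S) (c , s) = clique?-complete xs p S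
    ((λ i j i∈S j∈S → c (suc i) (suc j) (there i∈S) (there j∈S)) , λ i i∈S → s (suc i) (there i∈S))
  clique?-complete (x ∷ xs) p (inside  ∷ S) (c , s) = cong₂ _∧_ (s zero here)
    (clique?-complete xs (λ y → p y ∧ comparable x y) S
      ((λ i j i∈S j∈S → c (suc i) (suc j) (there i∈S) (there j∈S)) ,
        λ i i∈S → cong₂ _∧_ (s (suc i) (there i∈S)) (c zero (suc i) here (there i∈S))))

-- Chains of sets between two given sets.

-- t^|B∖A| if A ⊆ B, and 0 otherwise.

gapPower : ∀ {n} → ℕ → Subset n → Subset n → ℕ
gapPower t []            []            = 1
gapPower t (outside ∷ A) (outside ∷ B) = gapPower t A B
gapPower t (outside ∷ A) (inside  ∷ B) = t ℕ.* gapPower t A B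
gapPower t (inside  ∷ A) (outside ∷ B) = 0
gapPower t (inside  ∷ A) (inside  ∷ B) = gapPower t A B

gapPower-⊆ : ∀ {n} {A B : Subset n} → A ⊆ B → gapPower 1 A B ≡ 1
gapPower-⊆ {A = []}          {[]}          A⊆B = refl
gapPower-⊆ {A = outside ∷ A} {outside ∷ B} A⊆B = gapPower-⊆ {A = A} (drop-∷-⊆ A⊆B)
gapPower-⊆ {A = outside ∷ A} {inside  ∷ B} A⊆B = trans (ℕ.*-identityˡ (gapPower 1 A B)) (gapPower-⊆ {A = A} (drop-∷-⊆ A⊆B))
gapPower-⊆ {A = inside  ∷ A} {outside ∷ B} A⊆B with A⊆B here
... | ()
gapPower-⊆ {A = inside  ∷ A} {inside  ∷ B} A⊆B = gapPower-⊆ {A = A} (drop-∷-⊆ A⊆B)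

gapPower-⊈ : ∀ {n} t {A B : Subset n} → ¬ A ⊆ B → gapPower t A B ≡ 0
gapPower-⊈ t {[]}          {[]}          A⊈B = ⊥-elim (A⊈B λ ())
gapPower-⊈ t {outside ∷ A} {outside ∷ B} A⊈B = gapPower-⊈ t {A} {B} λ A⊆B → A⊈B (out⊆ {p = A} A⊆B)
gapPower-⊈ t {outside ∷ A} {inside  ∷ B} A⊈B =
  trans (cong (t ℕ.*_) (gapPower-⊈ t {A} {B} λ A⊆B → A⊈B (out⊆ {p = A} A⊆B))) (ℕ.*-zeroʳ t)
gapPower-⊈ t {inside  ∷ A} {outside ∷ B} A⊈B = refl
gapPower-⊈ t {inside  ∷ A} {inside  ∷ B} A⊈B = gapPower-⊈ t {A} {B} λ A⊆B → A⊈B (s⊆s {p = A} A⊆B)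

gapPower-∅ : ∀ {n} t (B : Subset n) → gapPower t ∅ B ≡ t ℕ.^ ∣ B ∣
gapPower-∅ t []            = refl
gapPower-∅ t (outside ∷ B) = gapPower-∅ t B
gapPower-∅ t (inside  ∷ B) = cong (t ℕ.*_) (gapPower-∅ t B)

-- `gapPower t` is the t-th power of the zeta function of the Boolean lattice: it counts the chains
-- from A to B with t weak steps. Element by element, a member of B outside A either lies in E, in s
-- ways, or enters after E, in t ways.
gapPower-convolution : ∀ {n} s t (A B : Subset n) →
  Σˡ (subsets n) (λ E → gapPower s A E ℕ.* gapPower t E B) ≡ gapPower (s ℕ.+ t) A B
gapPower-convolution s t [] [] = refl
gapPower-convolution {suc n} s t (a ∷ A) (b ∷ B) =
  trans (Σˡ-subsets n (λ E → gapPower s (a ∷ A) E ℕ.* gapPower t E (b ∷ B))) (cases a b)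
  where
  S : (Subset n → ℕ) → ℕ
  S = Σˡ (subsets n)

  IH : S (λ E → gapPower s A E ℕ.* gapPower t E B) ≡ gapPower (s ℕ.+ t) A B
  IH = gapPower-convolution s t A B

  move : ∀ c x y → x ℕ.* (c ℕ.* y) ≡ c ℕ.* (x ℕ.* y)
  move = solve-∀

  cases : ∀ a b →
    S (λ E → gapPower s (a ∷ A) (outside ∷ E) ℕ.* gapPower t (outside ∷ E) (b ∷ B)) ℕ.+
    S (λ E → gapPower s (a ∷ A) (inside ∷ E) ℕ.* gapPower t (inside ∷ E) (b ∷ B)) ≡ gapPower (s ℕ.+ t) (a ∷ A) (b ∷ B)
  cases outside outside = trans (cong₂ ℕ._+_ IH (Σˡ-zero (subsets n) λ {E} _ → ℕ.*-zeroʳ (s ℕ.* gapPower s A E)))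
    (ℕ.+-identityʳ (gapPower (s ℕ.+ t) A B))
  cases outside inside  = trans (cong₂ ℕ._+_
      (trans (Σˡ-cong (subsets n) λ {E} _ → move t (gapPower s A E) (gapPower t E B)) (Σˡ-*ˡ (subsets n) t _))
      (trans (Σˡ-cong (subsets n) λ {E} _ → ℕ.*-assoc s (gapPower s A E) (gapPower t E B)) (Σˡ-*ˡ (subsets n) s _)))
    (trans (sym (ℕ.*-distribʳ-+ (S (λ E → gapPower s A E ℕ.* gapPower t E B)) t s))
      (cong₂ ℕ._*_ (ℕ.+-comm t s) IH))
  cases inside  outside = cong₂ ℕ._+_ (Σˡ-zero (subsets n) λ _ → refl)
    (Σˡ-zero (subsets n) λ {E} _ → ℕ.*-zeroʳ (gapPower s A E))
  cases inside  inside  = cong₂ ℕ._+_ (Σˡ-zero (subsets n) λ _ → refl) IH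

Σˡ-nonempty : ∀ n (f : Subset n → ℕ) →
  Σˡ (subsets n) (λ A → when (does (nonempty? A)) (f A)) ℕ.+ f ∅ ≡ Σˡ (subsets n) f
Σˡ-nonempty zero    f = trans (cong (λ b → when b (f []) ℕ.+ 0 ℕ.+ f []) (dec-false (nonempty? []) λ { (() , _) }))
  (sym (ℕ.+-identityʳ (f [])))
Σˡ-nonempty (suc n) f = begin
  Σˡ (subsets (suc n)) (λ A → when (does (nonempty? A)) (f A)) ℕ.+ f ∅
    ≡⟨ cong (ℕ._+ f ∅) (Σˡ-subsets n (λ A → when (does (nonempty? A)) (f A))) ⟩
  Σˡ (subsets n) (λ A → when (does (nonempty? (outside ∷ A))) (f (outside ∷ A))) ℕ.+
  Σˡ (subsets n) (λ A → when (does (nonempty? (inside ∷ A))) (f (inside ∷ A))) ℕ.+ f ∅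
    ≡⟨ cong (ℕ._+ f ∅) (cong₂ ℕ._+_
         (Σˡ-cong (subsets n) λ {A} _ → cong (λ b → when b (f (outside ∷ A))) (same A))
         (Σˡ-cong (subsets n) λ {A} _ → cong (λ b → when b (f (inside ∷ A))) (dec-true (nonempty? (inside ∷ A)) (zero , here)))) ⟩
  Σˡ (subsets n) (λ A → when (does (nonempty? A)) (f (outside ∷ A))) ℕ.+ Σˡ (subsets n) (λ A → f (inside ∷ A)) ℕ.+ f ∅
    ≡⟨ rearrange (Σˡ (subsets n) (λ A → when (does (nonempty? A)) (f (outside ∷ A)))) (Σˡ (subsets n) (λ A → f (inside ∷ A))) (f ∅) ⟩
  Σˡ (subsets n) (λ A → when (does (nonempty? A)) (f (outside ∷ A))) ℕ.+ f ∅ ℕ.+ Σˡ (subsets n) (λ A → f (inside ∷ A))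
    ≡⟨ cong (ℕ._+ Σˡ (subsets n) (λ A → f (inside ∷ A))) (Σˡ-nonempty n (f ∘ (outside ∷_))) ⟩
  Σˡ (subsets n) (λ A → f (outside ∷ A)) ℕ.+ Σˡ (subsets n) (λ A → f (inside ∷ A))
    ≡⟨ Σˡ-subsets n f ⟨
  Σˡ (subsets (suc n)) f ∎
  where
  open ≡-Reasoning
  rearrange : ∀ a b c → a ℕ.+ b ℕ.+ c ≡ a ℕ.+ c ℕ.+ b
  rearrange = solve-∀

  same : ∀ (A : Subset n) → does (nonempty? (outside ∷ A)) ≡ does (nonempty? A)
  same A = does-unique (nonempty? (outside ∷ A))
    (λ { (suc i , there i∈A) → dec-true (nonempty? A) (i , i∈A) })
    (λ eq → let i , i∈A = does-true (nonempty? A) eq in suc i , there i∈A)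

Σˡ-filter : ∀ {A : Set} {P : A → Set} (P? : ∀ x → Dec (P x)) xs f →
  Σˡ (filter P? xs) f ≡ Σˡ xs (λ x → when (does (P? x)) (f x))
Σˡ-filter P? []       f = refl
Σˡ-filter P? (x ∷ xs) f with does (P? x)
... | true  = cong (f x ℕ.+_) (Σˡ-filter P? xs f)
... | false = Σˡ-filter P? xs f

when-zero : ∀ b {n} → n ≡ 0 → when b n ≡ 0
when-zero false _   = refl
when-zero true  n≡0 = n≡0

subsets-unique : ∀ n → Unique (subsets n)
subsets-unique zero    = All.[] ∷ []
subsets-unique (suc n) = Unique.++⁺ (Unique.map⁺ ∷-injectiveʳ (subsets-unique n)) (Unique.map⁺ ∷-injectiveʳ (subsets-unique n))
  λ (σ∈out , σ∈in) → disjoint (∈ˡ.∈-map⁻ (outside ∷_) σ∈out) (∈ˡ.∈-map⁻ (inside ∷_) σ∈in)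
  where
  disjoint : ∀ {σ : Subset (suc n)} → (∃ λ τ → τ ∈ˡ subsets n × σ ≡ outside ∷ τ) →
    (∃ λ τ → τ ∈ˡ subsets n × σ ≡ inside ∷ τ) → ⊥
  disjoint (_ , _ , refl) (_ , _ , ())

-- The containment order on intervals.

-- Containment of intervals on the level of endpoints; it agrees with _≼_ on nonempty intervals
-- but, unlike _≼_, is antisymmetric on all pairs.

le : ∀ {n} → Subset n × Subset n → Subset n × Subset n → Bool
le (A , B) (A′ , B′) = does ((A′ ⊆? A) ×-dec (B ⊆? B′))

le-refl : ∀ {n} (I : Subset n × Subset n) → le I I ≡ true
le-refl (A , B) = dec-true ((A ⊆? A) ×-dec (B ⊆? B)) (⊆-refl {x = A} , ⊆-refl {x = B})

le⇒⊆ : ∀ {n} {A B A′ B′ : Subset n} → le (A , B) (A′ , B′) ≡ true → A′ ⊆ A × B ⊆ B′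
le⇒⊆ {A = A} {B} {A′} {B′} = does-true ((A′ ⊆? A) ×-dec (B ⊆? B′))

⊆⇒le : ∀ {n} {A B A′ B′ : Subset n} → A′ ⊆ A → B ⊆ B′ → le (A , B) (A′ , B′) ≡ true
⊆⇒le {A = A} {B} {A′} {B′} A′⊆A B⊆B′ = dec-true ((A′ ⊆? A) ×-dec (B ⊆? B′)) (A′⊆A , B⊆B′)

le-trans : ∀ {n} {I J K : Subset n × Subset n} → le I J ≡ true → le J K ≡ true → le I K ≡ true
le-trans {I = A , B} {A′ , B′} {A″ , B″} I≤J J≤K =
  let A′⊆A , B⊆B′ = le⇒⊆ {A = A} {B} {A′} {B′} I≤J
      A″⊆A′ , B′⊆B″ = le⇒⊆ {A = A′} {B′} {A″} {B″} J≤K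
  in ⊆⇒le {A = A} {B} {A″} {B″} (⊆-trans {i = A″} {A′} {A} A″⊆A′ A′⊆A) (⊆-trans {i = B} {B′} {B″} B⊆B′ B′⊆B″)

le-antisym : ∀ {n} {I J : Subset n × Subset n} → le I J ≡ true → le J I ≡ true → I ≡ J
le-antisym {I = A , B} {A′ , B′} I≤J J≤I =
  let A′⊆A , B⊆B′ = le⇒⊆ {A = A} {B} {A′} {B′} I≤J
      A⊆A′ , B′⊆B = le⇒⊆ {A = A′} {B′} {A} {B} J≤I
  in cong₂ _,_ (⊆-antisym A⊆A′ A′⊆A) (⊆-antisym B⊆B′ B′⊆B)

module _ {n : ℕ} where
  open Cliques (le {n}) le-refl (λ {I} {J} {K} → le-trans {n} {I} {J} {K}) le-antisym public

le⇒≼ : ∀ {n} {I J : Subset n × Subset n} → le I J ≡ true → I ≼ J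
le⇒≼ {I = A , B} {A′ , B′} I≤J C (A⊆C , C⊆B) =
  let A′⊆A , B⊆B′ = le⇒⊆ {A = A} {B} {A′} {B′} I≤J
  in ⊆-trans {i = A′} {A} {C} A′⊆A A⊆C , ⊆-trans {i = C} {B} {B′} C⊆B B⊆B′

≼⇒le : ∀ {n} {A B : Subset n} {J} → A ⊆ B → (A , B) ≼ J → le (A , B) J ≡ true
≼⇒le {A = A} {B} {A′ , B′} A⊆B I≼J = ⊆⇒le {A = A} {B} {A′} {B′}
  (proj₁ (I≼J A (⊆-refl {x = A} , A⊆B))) (proj₂ (I≼J B (A⊆B , ⊆-refl {x = B})))

size-< : ∀ {n} {p q : Subset n} → p ⊆ q → ¬ q ⊆ p → ∣ p ∣ ℕ.< ∣ q ∣
size-< {p = []}          {[]}          p⊆q q⊈p = ⊥-elim (q⊈p λ ())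
size-< {p = outside ∷ p} {outside ∷ q} p⊆q q⊈p = size-< {p = p} (drop-∷-⊆ p⊆q) λ q⊆p → q⊈p (s⊆s {p = q} q⊆p)
size-< {p = outside ∷ p} {inside  ∷ q} p⊆q q⊈p = s≤s (p⊆q⇒∣p∣≤∣q∣ {p = p} (drop-∷-⊆ p⊆q))
size-< {p = inside  ∷ p} {outside ∷ q} p⊆q q⊈p with p⊆q here
... | ()
size-< {p = inside  ∷ p} {inside  ∷ q} p⊆q q⊈p = s≤s (size-< {p = p} (drop-∷-⊆ p⊆q) λ q⊆p → q⊈p (s⊆s {p = q} q⊆p))

nonempty-size : ∀ {n} {p : Subset n} → Nonempty p → 0 ℕ.< ∣ p ∣
nonempty-size {p = inside  ∷ p} _                   = s≤s z≤n
nonempty-size {p = outside ∷ p} (suc i , there i∈p) = nonempty-size (i , i∈p)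

-- Face numbers as weighted counts of faces.

facesSum : ∀ {n} → SimplicialComplex n → (ℕ → ℕ) → ℕ
facesSum {n} Δ φ = Σˡ (subsets n) (λ σ → when (does (face? Δ σ)) (φ ∣ σ ∣))

truncate : ℕ → (ℕ → ℕ) → ℕ → ℕ
truncate d φ s = when (does (s ℕ.≤? d)) (φ s)

truncate-≤ : ∀ {d} φ {s} → s ℕ.≤ d → truncate d φ s ≡ φ s
truncate-≤ {d} φ {s} s≤d = cong (λ b → when b (φ s)) (dec-true (s ℕ.≤? d) s≤d)

-- The left side sees only face numbers up to index d. Truncating the weight makes the identity hold
-- without a rank hypothesis, so that it applies to the subdivision before its rank is bounded.
∑-faces : ∀ d {n} (Δ : SimplicialComplex n) φ →
  ∑ d (λ l → fromℕ (faces Δ l) * fromℕ (φ l)) ≡ fromℕ (facesSum Δ (truncate d φ))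
∑-faces d {n} Δ φ = go (subsets n)
  where
  open ≡-Reasoning
  count : List (Subset n) → ℕ → ℕ
  count L l = length (filter (λ σ → face? Δ σ ×-dec (∣ σ ∣ ℕ.≟ l)) L)

  length-filter-∷ : ∀ {A : Set} {P : A → Set} (P? : ∀ x → Dec (P x)) x xs →
    length (filter P? (x ∷ xs)) ≡ when (does (P? x)) 1 ℕ.+ length (filter P? xs)
  length-filter-∷ P? x xs with does (P? x)
  ... | true  = refl
  ... | false = refl

  single : ∀ b s → ∑ d (λ l → fromℕ (when (b ∧ does (s ℕ.≟ l)) 1) * fromℕ (φ l)) ≡ fromℕ (when b (truncate d φ s))
  single false s = ∑-zero d λ {l} _ → *-zeroˡ (fromℕ (φ l))
  single true  s with s ℕ.≤? d
  ... | yes s≤d = trans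
    (∑-single s≤d λ {l} _ l≢s → trans (cong (λ b → fromℕ (when b 1) * fromℕ (φ l)) (dec-false (s ℕ.≟ l) (l≢s ∘ sym)))
      (*-zeroˡ (fromℕ (φ l))))
    (trans (cong (λ b → fromℕ (when b 1) * fromℕ (φ s)) (dec-true (s ℕ.≟ s) refl))
      (trans (*-identityˡ (fromℕ (φ s))) (cong fromℕ (sym (truncate-≤ φ s≤d)))))
  ... | no  s≰d = trans
    (∑-zero d λ {l} l≤d → trans
      (cong (λ b → fromℕ (when b 1) * fromℕ (φ l)) (dec-false (s ℕ.≟ l) λ { refl → s≰d l≤d })) (*-zeroˡ (fromℕ (φ l))))
    (cong (λ b → fromℕ (when b (φ s))) (sym (dec-false (s ℕ.≤? d) s≰d)))

  go : ∀ L → ∑ d (λ l → fromℕ (count L l) * fromℕ (φ l)) ≡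
    fromℕ (Σˡ L (λ σ → when (does (face? Δ σ)) (truncate d φ ∣ σ ∣)))
  go []      = ∑-zero d λ {l} _ → *-zeroˡ (fromℕ (φ l))
  go (σ ∷ L) = begin
    ∑ d (λ l → fromℕ (count (σ ∷ L) l) * fromℕ (φ l))
      ≡⟨ ∑-cong d (λ {l} _ → trans
           (cong (_* fromℕ (φ l)) (trans
             (cong fromℕ (length-filter-∷ (λ σ → face? Δ σ ×-dec (∣ σ ∣ ℕ.≟ l)) σ L))
             (fromℕ-+ (indicator l) (count L l))))
           (*-distribʳ-+ (fromℕ (φ l)) (fromℕ (indicator l)) (fromℕ (count L l)))) ⟩
    ∑ d (λ l → fromℕ (indicator l) * fromℕ (φ l) + fromℕ (count L l) * fromℕ (φ l))
      ≡⟨ ∑-+ d (λ l → fromℕ (indicator l) * fromℕ (φ l)) (λ l → fromℕ (count L l) * fromℕ (φ l)) ⟩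
    ∑ d (λ l → fromℕ (indicator l) * fromℕ (φ l)) + ∑ d (λ l → fromℕ (count L l) * fromℕ (φ l))
      ≡⟨ cong₂ _+_ (single (does (face? Δ σ)) ∣ σ ∣) (go L) ⟩
    fromℕ (when (does (face? Δ σ)) (truncate d φ ∣ σ ∣)) + fromℕ (Σˡ L (λ σ → when (does (face? Δ σ)) (truncate d φ ∣ σ ∣)))
      ≡⟨ fromℕ-+ (when (does (face? Δ σ)) (truncate d φ ∣ σ ∣)) (Σˡ L (λ σ → when (does (face? Δ σ)) (truncate d φ ∣ σ ∣))) ⟨
    fromℕ (Σˡ (σ ∷ L) (λ σ → when (does (face? Δ σ)) (truncate d φ ∣ σ ∣))) ∎
    where
    indicator : ℕ → ℕ
    indicator l = when (does (face? Δ σ) ∧ does (∣ σ ∣ ℕ.≟ l)) 1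

-- Multichains of intervals and of faces.

module Intervals {n : ℕ} (Δ : SimplicialComplex n) where

  Q : List (Subset n × Subset n)
  Q = intervals Δ

  Q-unique : Unique Q
  Q-unique = Unique.filter⁺ (isInterval? Δ) (Unique.cartesianProduct⁺ (subsets-unique n) (subsets-unique n))

  ∈Q⇒IsInterval : ∀ {I} → I ∈ˡ Q → IsInterval Δ I
  ∈Q⇒IsInterval I∈Q = proj₂ (∈ˡ.∈-filter⁻ (isInterval? Δ) {xs = cartesianProduct (subsets n) (subsets n)} I∈Q)

  Σˡ-Q : ∀ f → Σˡ Q f ≡ Σˡ (subsets n) (λ A → Σˡ (subsets n) (λ B → when (does (isInterval? Δ (A , B))) (f (A , B))))
  Σˡ-Q f = trans (Σˡ-filter (isInterval? Δ) (cartesianProduct (subsets n) (subsets n)) f)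
    (Σˡ-cartesianProduct (subsets n) (subsets n) (λ I → when (does (isInterval? Δ I)) (f I)))

  gap : ℕ → Subset n × Subset n → ℕ
  gap t (A , B) = gapPower t A B

  -- A subinterval is a pair with A ⊆ A′ ⊆ B′ ⊆ B, so one zeta step is added at each end. Such a
  -- pair always occurs in `Q`: A′ contains the nonempty set A, and B′ is contained in the face B.
  subintervals-sum : ∀ t {A B} → IsInterval Δ (A , B) →
    Σˡ Q (λ I → when (le I (A , B)) (gap t I)) ≡ gapPower (suc (suc t)) A B
  subintervals-sum t {A} {B} ((fA , neA) , (fB , neB) , A⊆B) = begin
    Σˡ Q (λ I → when (le I (A , B)) (gap t I))
      ≡⟨ Σˡ-Q (λ I → when (le I (A , B)) (gap t I)) ⟩
    S (λ A′ → S (λ B′ → when (does (isInterval? Δ (A′ , B′))) (when (le (A′ , B′) (A , B)) (gapPower t A′ B′))))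
      ≡⟨ Σˡ-cong (subsets n) (λ {A′} _ → trans (Σˡ-cong (subsets n) λ {B′} _ → term A′ B′ (A ⊆? A′) (A′ ⊆? B′) (B′ ⊆? B))
           (Σˡ-*ˡ (subsets n) (gapPower 1 A A′) (λ B′ → gapPower t A′ B′ ℕ.* gapPower 1 B′ B))) ⟩
    S (λ A′ → gapPower 1 A A′ ℕ.* S (λ B′ → gapPower t A′ B′ ℕ.* gapPower 1 B′ B))
      ≡⟨ Σˡ-cong (subsets n) (λ {A′} _ → cong (gapPower 1 A A′ ℕ.*_) (gapPower-convolution t 1 A′ B)) ⟩
    S (λ A′ → gapPower 1 A A′ ℕ.* gapPower (t ℕ.+ 1) A′ B)
      ≡⟨ gapPower-convolution 1 (t ℕ.+ 1) A B ⟩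
    gapPower (suc (t ℕ.+ 1)) A B
      ≡⟨ cong (λ s → gapPower (suc s) A B) (ℕ.+-comm t 1) ⟩
    gapPower (suc (suc t)) A B ∎
    where
    open ≡-Reasoning
    S : (Subset n → ℕ) → ℕ
    S = Σˡ (subsets n)

    le-false : ∀ A′ B′ → ¬ (A ⊆ A′ × B′ ⊆ B) → le (A′ , B′) (A , B) ≡ false
    le-false A′ B′ = dec-false ((A ⊆? A′) ×-dec (B′ ⊆? B))

    term : ∀ A′ B′ → Dec (A ⊆ A′) → Dec (A′ ⊆ B′) → Dec (B′ ⊆ B) →
      when (does (isInterval? Δ (A′ , B′))) (when (le (A′ , B′) (A , B)) (gapPower t A′ B′)) ≡
      gapPower 1 A A′ ℕ.* (gapPower t A′ B′ ℕ.* gapPower 1 B′ B)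
    term A′ B′ (no A⊈A′) _ _ = trans
      (when-zero (does (isInterval? Δ (A′ , B′))) (cong (λ b → when b (gapPower t A′ B′)) (le-false A′ B′ (λ le → A⊈A′ (proj₁ le)))))
      (sym (cong (ℕ._* (gapPower t A′ B′ ℕ.* gapPower 1 B′ B)) (gapPower-⊈ 1 {A} {A′} A⊈A′)))
    term A′ B′ (yes _) (no A′⊈B′) _ = trans
      (when-zero (does (isInterval? Δ (A′ , B′))) (when-zero (le (A′ , B′) (A , B)) (gapPower-⊈ t {A′} {B′} A′⊈B′)))
      (sym (trans (cong (λ z → gapPower 1 A A′ ℕ.* (z ℕ.* gapPower 1 B′ B)) (gapPower-⊈ t {A′} {B′} A′⊈B′))
        (ℕ.*-zeroʳ (gapPower 1 A A′))))
    term A′ B′ (yes _) (yes _) (no B′⊈B) = trans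
      (when-zero (does (isInterval? Δ (A′ , B′))) (cong (λ b → when b (gapPower t A′ B′)) (le-false A′ B′ (λ le → B′⊈B (proj₂ le)))))
      (sym (trans (cong (λ z → gapPower 1 A A′ ℕ.* (gapPower t A′ B′ ℕ.* z)) (gapPower-⊈ 1 {B′} {B} B′⊈B))
        (trans (cong (gapPower 1 A A′ ℕ.*_) (ℕ.*-zeroʳ (gapPower t A′ B′))) (ℕ.*-zeroʳ (gapPower 1 A A′)))))
    term A′ B′ (yes A⊆A′) (yes A′⊆B′) (yes B′⊆B) = trans
      (cong₂ (λ b c → when b (when c (gapPower t A′ B′)))
        (dec-true (isInterval? Δ (A′ , B′))
          ((⊆-closed Δ (⊆-trans {i = A′} {B′} {B} A′⊆B′ B′⊆B) fB , nonempty-⊆ A⊆A′ neA) ,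
           (⊆-closed Δ B′⊆B fB , nonempty-⊆ (⊆-trans {i = A} {A′} {B′} A⊆A′ A′⊆B′) neA) , A′⊆B′))
        (⊆⇒le {A = A′} {B′} {A} {B} A⊆A′ B′⊆B))
      (sym (trans (cong₂ (λ y z → y ℕ.* (gapPower t A′ B′ ℕ.* z)) (gapPower-⊆ {A = A} {A′} A⊆A′) (gapPower-⊆ {A = B′} {B} B′⊆B))
        (trans (ℕ.*-identityˡ (gapPower t A′ B′ ℕ.* 1)) (ℕ.*-identityʳ (gapPower t A′ B′)))))
      where
      nonempty-⊆ : ∀ {p q : Subset n} → p ⊆ q → Nonempty p → Nonempty q
      nonempty-⊆ p⊆q (i , i∈p) = i , p⊆q i∈p

  Σˡ-le : ∀ {xs : List (Subset n × Subset n)} {I} → Unique xs → I ∈ˡ xs → ∀ (f : Subset n × Subset n → ℕ) →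
    Σˡ xs (λ J → when (le J I) (f J)) ≡ f I ℕ.+ Σˡ xs (λ J → when (below J I) (f J))
  Σˡ-le {xs} {I} xs! I∈xs f = begin
    Σˡ xs (λ J → when (le J I) (f J))
      ≡⟨ Σˡ-cong xs (λ {J} _ → split (le J I) (le I J) (f J)) ⟩
    Σˡ xs (λ J → when (le J I ∧ le I J) (f J) ℕ.+ when (below J I) (f J))
      ≡⟨ Σˡ-+ xs (λ J → when (le J I ∧ le I J) (f J)) (λ J → when (below J I) (f J)) ⟩
    Σˡ xs (λ J → when (le J I ∧ le I J) (f J)) ℕ.+ Σˡ xs (λ J → when (below J I) (f J))
      ≡⟨ cong (ℕ._+ Σˡ xs (λ J → when (below J I) (f J))) (single xs! I∈xs) ⟩
    f I ℕ.+ Σˡ xs (λ J → when (below J I) (f J)) ∎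
    where
    open ≡-Reasoning
    split : ∀ b c m → when b m ≡ when (b ∧ c) m ℕ.+ when (b ∧ not c) m
    split false c     m = refl
    split true  false m = refl
    split true  true  m = sym (ℕ.+-identityʳ m)

    other : ∀ {J} → J ≢ I → when (le J I ∧ le I J) (f J) ≡ 0
    other {J} J≢I = cong (λ b → when b (f J)) (ne (le J I ∧ le I J) refl)
      where
      ne : ∀ b → le J I ∧ le I J ≡ b → le J I ∧ le I J ≡ false
      ne false eq = eq
      ne true  eq = ⊥-elim (J≢I (le-antisym (proj₁ (∧-true {le J I} eq)) (proj₂ (∧-true {le J I} eq))))

    single : ∀ {xs} → Unique xs → I ∈ˡ xs → Σˡ xs (λ J → when (le J I ∧ le I J) (f J)) ≡ f I
    single {J ∷ xs} (J∉xs ∷ xs!) (here refl) = trans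
      (cong₂ ℕ._+_ (cong (λ b → when b (f I)) (cong₂ _∧_ (le-refl I) (le-refl I)))
        (Σˡ-zero xs λ K∈xs → other λ { refl → All.lookup J∉xs K∈xs refl }))
      (ℕ.+-identityʳ (f I))
    single {J ∷ xs} (J∉xs ∷ xs!) (there I∈xs) =
      cong₂ ℕ._+_ (other λ { refl → All.lookup J∉xs I∈xs refl }) (single xs! I∈xs)

  -- The weight C(m, ·) on chains strictly below I counts the multichains J_1 ≤ ⋯ ≤ J_m ≤ I, where I
  -- itself may be repeated. Their endpoints lead from A to B in 2m + 1 weak steps. In the
  -- induction, Pascal's first summand is the missing term J = I of the sum over all subintervals J.
  chains-below : ∀ m {I} → I ∈ˡ Q → cliques Q (λ J → below J I) (m C_) ≡ gap (suc (double m)) I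
  chains-below zero    {A , B} I∈Q = trans (cliques-C-zero Q-unique (λ J → below J (A , B)))
    (sym (gapPower-⊆ {A = A} {B} (proj₂ (proj₂ (∈Q⇒IsInterval I∈Q)))))
  chains-below (suc m) {I} I∈Q = begin
    cliques Q (λ J → below J I) (suc m C_)
      ≡⟨ cliques-C-suc Q-unique (λ J → below J I) m ⟩
    cliques Q (λ J → below J I) (m C_) ℕ.+
      Σˡ Q (λ J → when (below J I) (cliques Q (λ K → below K I ∧ below K J) (m C_)))
      ≡⟨ cong₂ ℕ._+_ (chains-below m I∈Q) (Σˡ-cong Q λ {J} J∈Q → lower J J∈Q (below J I) refl) ⟩
    gap (suc (double m)) I ℕ.+ Σˡ Q (λ J → when (below J I) (gap (suc (double m)) J))
      ≡⟨ Σˡ-le Q-unique I∈Q (gap (suc (double m))) ⟨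
    Σˡ Q (λ J → when (le J I) (gap (suc (double m)) J))
      ≡⟨ subintervals-sum (suc (double m)) (∈Q⇒IsInterval I∈Q) ⟩
    gap (suc (double (suc m))) I ∎
    where
    open ≡-Reasoning
    lower : ∀ J → J ∈ˡ Q → ∀ b → below J I ≡ b →
      when b (cliques Q (λ K → below K I ∧ below K J) (m C_)) ≡ when b (gap (suc (double m)) J)
    lower J J∈Q false _   = refl
    lower J J∈Q true  J<I = trans (cliques-cong Q (λ K → absorb K (below K J) refl) (λ _ → refl)) (chains-below m J∈Q)
      where
      absorb : ∀ K b → below K J ≡ b → below K I ∧ below K J ≡ below K J
      absorb K false K≮J = trans (cong (below K I ∧_) K≮J) (trans (Bool.∧-zeroʳ (below K I)) (sym K≮J))
      absorb K true  K<J = cong (_∧ below K J) (below-trans {x = K} {J} {I} K<J J<I)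

  -- Summing t^(|B| - |A|) over all A ⊆ B gives (t+1)^|B|. Intervals leave out only A = ∅, whose
  -- share t^|B| is the second summand on the left. For t = 2m + 1 the sum over `Q` is F(2m+2) -
  -- F(2m+1).
  intervals-sum : ∀ t → Σˡ Q (gap t) ℕ.+ facesSum Δ (t ℕ.^_) ≡ facesSum Δ (suc t ℕ.^_)
  intervals-sum t = begin
    Σˡ Q (gap t) ℕ.+ facesSum Δ (t ℕ.^_)
      ≡⟨ cong (ℕ._+ facesSum Δ (t ℕ.^_)) (trans (Σˡ-Q (gap t))
           (Σˡ-swap (subsets n) (subsets n) (λ A B → when (does (isInterval? Δ (A , B))) (gapPower t A B)))) ⟩
    S (λ B → S (λ A → when (does (isInterval? Δ (A , B))) (gapPower t A B))) ℕ.+ S (λ B → when (does (face? Δ B)) (t ℕ.^ ∣ B ∣))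
      ≡⟨ Σˡ-+ (subsets n) (λ B → S (λ A → when (does (isInterval? Δ (A , B))) (gapPower t A B)))
           (λ B → when (does (face? Δ B)) (t ℕ.^ ∣ B ∣)) ⟨
    S (λ B → S (λ A → when (does (isInterval? Δ (A , B))) (gapPower t A B)) ℕ.+ when (does (face? Δ B)) (t ℕ.^ ∣ B ∣))
      ≡⟨ Σˡ-cong (subsets n) (λ {B} _ → top B (face? Δ B)) ⟩
    facesSum Δ (suc t ℕ.^_) ∎
    where
    open ≡-Reasoning
    S : (Subset n → ℕ) → ℕ
    S = Σˡ (subsets n)

    top : ∀ B (B? : Dec (Face Δ B)) →
      S (λ A → when (does (isInterval? Δ (A , B))) (gapPower t A B)) ℕ.+ when (does B?) (t ℕ.^ ∣ B ∣) ≡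
      when (does B?) (suc t ℕ.^ ∣ B ∣)
    top B (no ¬fB) = trans (ℕ.+-identityʳ _) (Σˡ-zero (subsets n) λ {A} _ →
      cong (λ b → when b (gapPower t A B)) (dec-false (isInterval? Δ (A , B)) λ (_ , (fB , _) , _) → ¬fB fB))
    top B (yes fB) = begin
      S (λ A → when (does (isInterval? Δ (A , B))) (gapPower t A B)) ℕ.+ t ℕ.^ ∣ B ∣
        ≡⟨ cong₂ ℕ._+_ (Σˡ-cong (subsets n) (λ {A} _ → term A (A ⊆? B))) (sym (gapPower-∅ t B)) ⟩
      S (λ A → when (does (nonempty? A)) (gapPower t A B)) ℕ.+ gapPower t ∅ B
        ≡⟨ Σˡ-nonempty n (λ A → gapPower t A B) ⟩
      S (λ A → gapPower t A B)
        ≡⟨ Σˡ-cong (subsets n) (λ {A} _ → trans (cong (ℕ._* gapPower t A B) (gapPower-⊆ {A = ∅} {A} (⊥⊆ {p = A})))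
             (ℕ.*-identityˡ (gapPower t A B))) ⟨
      S (λ A → gapPower 1 ∅ A ℕ.* gapPower t A B)
        ≡⟨ gapPower-convolution 1 t ∅ B ⟩
      gapPower (suc t) ∅ B
        ≡⟨ gapPower-∅ (suc t) B ⟩
      suc t ℕ.^ ∣ B ∣ ∎
      where
      term : ∀ A → Dec (A ⊆ B) →
        when (does (isInterval? Δ (A , B))) (gapPower t A B) ≡ when (does (nonempty? A)) (gapPower t A B)
      term A (no A⊈B)  = trans (when-zero (does (isInterval? Δ (A , B))) (gapPower-⊈ t {A} {B} A⊈B))
        (sym (when-zero (does (nonempty? A)) (gapPower-⊈ t {A} {B} A⊈B)))
      term A (yes A⊆B) = cong (λ b → when b (gapPower t A B)) (does-unique (isInterval? Δ (A , B))
        (λ ((_ , neA) , _) → dec-true (nonempty? A) neA)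
        (λ eq → let i , i∈A = does-true (nonempty? A) eq in
          (⊆-closed Δ A⊆B fB , i , i∈A) , (fB , i , A⊆B i∈A) , A⊆B))

  everything : Subset n × Subset n → Bool
  everything _ = true

  facesSum-subdivision : ∀ φ → facesSum (intervalSubdivision Δ) φ ≡ cliques Q everything φ
  facesSum-subdivision φ = trans
    (Σˡ-cong (subsets (length Q)) λ {S} _ → cong (λ b → when b (φ ∣ S ∣))
      (does-unique (face? (intervalSubdivision Δ) S) (λ f → clique?-complete Q everything S (complete S f))
        (λ c → sound S (clique?-sound Q everything S c))))
    (Σˡ-cliques Q everything φ)
    where
    complete : ∀ S → Face (intervalSubdivision Δ) S → IsClique Q everything S
    complete S chain = pairwise , λ _ _ → refl
      where
      interval : ∀ i → proj₁ (lookup Q i) ⊆ proj₂ (lookup Q i)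
      interval i = proj₂ (proj₂ (∈Q⇒IsInterval (∈ˡ.∈-lookup {xs = Q} i)))

      pairwise : ∀ i j → i ∈ S → j ∈ S → comparable (lookup Q i) (lookup Q j) ≡ true
      pairwise i j i∈S j∈S with chain i j i∈S j∈S
      ... | inj₁ i≼j = cong (_∨ le (lookup Q j) (lookup Q i)) (≼⇒le {J = lookup Q j} (interval i) i≼j)
      ... | inj₂ j≼i = trans (cong (le (lookup Q i) (lookup Q j) ∨_) (≼⇒le {J = lookup Q i} (interval j) j≼i))
                         (Bool.∨-zeroʳ (le (lookup Q i) (lookup Q j)))

    ∨-true : ∀ {a b} → a ∨ b ≡ true → a ≡ true ⊎ b ≡ true
    ∨-true {true}  _  = inj₁ refl
    ∨-true {false} eq = inj₂ eq

    sound : ∀ S → IsClique Q everything S → Face (intervalSubdivision Δ) S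
    sound S (c , _) i j i∈S j∈S with ∨-true {le (lookup Q i) (lookup Q j)} (c i j i∈S j∈S)
    ... | inj₁ i≤j = inj₁ (le⇒≼ {I = lookup Q i} {lookup Q j} i≤j)
    ... | inj₂ j≤i = inj₂ (le⇒≼ {I = lookup Q j} {lookup Q i} j≤i)

  multichains-zero : cliques Q everything (0 C_) ≡ 1
  multichains-zero = cliques-C-zero Q-unique everything

  multichains-suc : ∀ m → cliques Q everything (suc m C_) ℕ.+ facesSum Δ (suc (double m) ℕ.^_) ≡
    cliques Q everything (m C_) ℕ.+ facesSum Δ (double (suc m) ℕ.^_)
  multichains-suc m = begin
    cliques Q everything (suc m C_) ℕ.+ facesSum Δ (suc (double m) ℕ.^_)
      ≡⟨ cong (ℕ._+ facesSum Δ (suc (double m) ℕ.^_)) (trans (cliques-C-suc Q-unique everything m)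
           (cong (cliques Q everything (m C_) ℕ.+_) (Σˡ-cong Q (chains-below m)))) ⟩
    cliques Q everything (m C_) ℕ.+ Σˡ Q (gap (suc (double m))) ℕ.+ facesSum Δ (suc (double m) ℕ.^_)
      ≡⟨ ℕ.+-assoc (cliques Q everything (m C_)) (Σˡ Q (gap (suc (double m)))) (facesSum Δ (suc (double m) ℕ.^_)) ⟩
    cliques Q everything (m C_) ℕ.+ (Σˡ Q (gap (suc (double m))) ℕ.+ facesSum Δ (suc (double m) ℕ.^_))
      ≡⟨ cong (cliques Q everything (m C_) ℕ.+_) (intervals-sum (suc (double m))) ⟩
    cliques Q everything (m C_) ℕ.+ facesSum Δ (double (suc m) ℕ.^_) ∎
    where open ≡-Reasoning

  -- The rank function is |B| - |A|. It increases strictly under proper containment and stays below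
  -- d because A is nonempty and |B| ≤ d; thus chains of intervals have at most d members.
  cliques-truncate-rank : ∀ {d} → HasRank Δ d → ∀ φ → cliques Q everything (truncate d φ) ≡ cliques Q everything φ
  cliques-truncate-rank {d} (_ , bound) φ = cliques-truncate Q-unique length′ length-mono d everything
    (truncate-≤ φ) (λ I∈Q _ → length-< (∈Q⇒IsInterval I∈Q))
    where
    length′ : Subset n × Subset n → ℕ
    length′ (A , B) = ∣ B ∣ ∸ ∣ A ∣

    length-< : ∀ {I} → IsInterval Δ I → length′ I ℕ.< d
    length-< {A , B} ((_ , neA) , (fB , _) , A⊆B) =
      ℕ.<-≤-trans (ℕ.∸-monoʳ-< {m = ∣ B ∣} {o = 0} (nonempty-size neA) (p⊆q⇒∣p∣≤∣q∣ {p = A} A⊆B)) (bound B fB)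

    length-mono : ∀ {I J} → I ∈ˡ Q → J ∈ˡ Q → below I J ≡ true → length′ I ℕ.< length′ J
    length-mono {A , B} {A′ , B′} I∈Q J∈Q I<J
      with le⇒⊆ {A = A} {B} {A′} {B′} (below⇒le {x = A , B} {A′ , B′} I<J) | A ⊆? A′
    ... | A′⊆A , B⊆B′ | no A⊈A′ = ℕ.≤-<-trans (ℕ.∸-monoˡ-≤ ∣ A ∣ (p⊆q⇒∣p∣≤∣q∣ {p = B} B⊆B′))
          (ℕ.∸-monoʳ-< {m = ∣ B′ ∣} (size-< {p = A′} A′⊆A A⊈A′)
            (p⊆q⇒∣p∣≤∣q∣ {p = A} (⊆-trans {i = A} {B} {B′} (proj₂ (proj₂ (∈Q⇒IsInterval I∈Q))) B⊆B′)))
    ... | A′⊆A , B⊆B′ | yes A⊆A′ = ℕ.<-≤-trans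
          (ℕ.∸-monoˡ-< {n = ∣ A ∣} (size-< {p = B} B⊆B′ B′⊈B) (p⊆q⇒∣p∣≤∣q∣ {p = A} (proj₂ (proj₂ (∈Q⇒IsInterval I∈Q)))))
          (ℕ.∸-monoʳ-≤ ∣ B′ ∣ (p⊆q⇒∣p∣≤∣q∣ {p = A′} A′⊆A))
      where
      B′⊈B : ¬ B′ ⊆ B
      B′⊈B B′⊆B with trans (sym (below⇒≱ {x = A , B} {A′ , B′} I<J)) (⊆⇒le {A = A′} {B′} {A} {B} A⊆A′ B′⊆B)
      ... | ()

-- The h-vector of the interval subdivision.

fromℕ-^ : ∀ r l → fromℕ (r ℕ.^ l) ≡ fromℕ r ^ l
fromℕ-^ r zero    = refl
fromℕ-^ r (suc l) = trans (fromℕ-* r (r ℕ.^ l)) (cong (fromℕ r *_) (fromℕ-^ r l))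

-- Because 0^0 = 1, only the empty face contributes. This is F(0), to be matched with the empty
-- chain counted by M(0).
facesSum-zero-power : ∀ {n} (Δ : SimplicialComplex n) → facesSum Δ (0 ℕ.^_) ≡ 1
facesSum-zero-power {n} Δ = trans (sym (Σˡ-nonempty n term))
  (cong₂ ℕ._+_ (Σˡ-zero (subsets n) λ {A} _ → nonempty≡0 A (nonempty? A))
    (cong₂ (λ b s → when b (0 ℕ.^ s)) (dec-true (face? Δ ∅) (∅-face Δ)) (∣⊥∣≡0 n)))
  where
  term : Subset n → ℕ
  term A = when (does (face? Δ A)) (0 ℕ.^ ∣ A ∣)

  0^>0 : ∀ {s} → 0 ℕ.< s → 0 ℕ.^ s ≡ 0
  0^>0 (s≤s _) = refl

  nonempty≡0 : ∀ A (A? : Dec (Nonempty A)) → when (does A?) (term A) ≡ 0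
  nonempty≡0 A (no _)   = refl
  nonempty≡0 A (yes ne) = when-zero (does (face? Δ A)) (0^>0 (nonempty-size ne))

hVector-subdivision : ∀ d {n} (Δ : SimplicialComplex n) → HasRank Δ d → ∀ i →
  fromℤ (hVector d (intervalSubdivision Δ) i) ≡
  ∑ d (λ j → hSeq d (λ l → fromℕ (faces Δ l)) j * intervalColumn d j (toℕ i))
hVector-subdivision d {n} Δ rank i = trans (hVector≡hSeq d (intervalSubdivision Δ) i)
  (hSeq-transform d f f′ (begin
      M 0                                           ≡⟨ M≡ 0 ⟩
      fromℕ (cliques Q everything (0 C_))           ≡⟨ cong fromℕ (trans multichains-zero (sym (facesSum-zero-power Δ))) ⟩
      fromℕ (facesSum Δ (0 ℕ.^_))                   ≡⟨ F≡ 0 ⟨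
      F 0                                           ∎)
    (λ m → begin
      M (suc m) + F (suc (double m))
        ≡⟨ cong₂ _+_ (M≡ (suc m)) (F≡ (suc (double m))) ⟩
      fromℕ (cliques Q everything (suc m C_)) + fromℕ (facesSum Δ (suc (double m) ℕ.^_))
        ≡⟨ fromℕ-+ (cliques Q everything (suc m C_)) (facesSum Δ (suc (double m) ℕ.^_)) ⟨
      fromℕ (cliques Q everything (suc m C_) ℕ.+ facesSum Δ (suc (double m) ℕ.^_))
        ≡⟨ cong fromℕ (multichains-suc m) ⟩
      fromℕ (cliques Q everything (m C_) ℕ.+ facesSum Δ (double (suc m) ℕ.^_))
        ≡⟨ fromℕ-+ (cliques Q everything (m C_)) (facesSum Δ (double (suc m) ℕ.^_)) ⟩
      fromℕ (cliques Q everything (m C_)) + fromℕ (facesSum Δ (double (suc m) ℕ.^_))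
        ≡⟨ cong₂ _+_ (M≡ m) (F≡ (double (suc m))) ⟨
      M m + F (double (suc m)) ∎) (toℕ i))
  where
  open ≡-Reasoning
  open Intervals Δ
  f f′ : ℕ → ℚ
  f l  = fromℕ (faces Δ l)
  f′ l = fromℕ (faces (intervalSubdivision Δ) l)

  F M : Seq
  F r = ∑ d (λ l → f l * fromℕ r ^ l)
  M m = ∑ d (λ l → f′ l * binomials l m)

  F≡ : ∀ r → F r ≡ fromℕ (facesSum Δ (r ℕ.^_))
  F≡ r = begin
    F r                                           ≡⟨ ∑-cong d (λ {l} _ → cong (f l *_) (fromℕ-^ r l)) ⟨
    ∑ d (λ l → f l * fromℕ (r ℕ.^ l))             ≡⟨ ∑-faces d Δ (r ℕ.^_) ⟩
    fromℕ (facesSum Δ (truncate d (r ℕ.^_)))      ≡⟨ cong fromℕ (Σˡ-cong (subsets n) λ {σ} _ → bounded σ (face? Δ σ)) ⟩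
    fromℕ (facesSum Δ (r ℕ.^_))                   ∎
    where
    bounded : ∀ σ (σ? : Dec (Face Δ σ)) → when (does σ?) (truncate d (r ℕ.^_) ∣ σ ∣) ≡ when (does σ?) (r ℕ.^ ∣ σ ∣)
    bounded σ (no _)   = refl
    bounded σ (yes fσ) = truncate-≤ (r ℕ.^_) (proj₂ rank σ fσ)

  M≡ : ∀ m → M m ≡ fromℕ (cliques Q everything (m C_))
  M≡ m = begin
    M m                                                               ≡⟨ ∑-faces d (intervalSubdivision Δ) (m C_) ⟩
    fromℕ (facesSum (intervalSubdivision Δ) (truncate d (m C_)))      ≡⟨ cong fromℕ (facesSum-subdivision (truncate d (m C_))) ⟩
    fromℕ (cliques Q everything (truncate d (m C_)))                  ≡⟨ cong fromℕ (cliques-truncate-rank rank (m C_)) ⟩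
    fromℕ (cliques Q everything (m C_))                               ∎

-- Uniqueness of the transformation matrix.

-- Forward differences in n shift the coefficients down by one, by Pascal's rule. The threshold N is
-- present because the test complexes, skeleta of simplices, have rank d only when there are at
-- least d vertices.
binomials-independent : ∀ d N (e : ℕ → ℚ) → (∀ n → N ℕ.≤ n → ∑ d (λ l → e l * binomials l n) ≡ 0ℚ) →
  ∀ {l} → l ℕ.≤ d → e l ≡ 0ℚ
binomials-independent zero    N e e≡0 z≤n = trans (sym (*-identityʳ (e 0))) (e≡0 N ℕ.≤-refl)
binomials-independent (suc d) N e e≡0 = all≡0
  where
  open ≡-Reasoning
  differences : ∀ n → N ℕ.≤ n → ∑ d (λ l → e (suc l) * binomials l n) ≡ 0ℚ
  differences n N≤n = begin
    T
      ≡⟨ solve 3 (λ t u v → t := (u :+ (t :+ v)) :- (u :+ v)) refl T (e 0 * 1ℚ) U ⟩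
    (e 0 * 1ℚ + (T + U)) - (e 0 * 1ℚ + U)
      ≡⟨ cong₂ (λ a b → (e 0 * 1ℚ + a) - b) (trans (sym (∑-+ d _ _)) (∑-cong d λ {l} _ → pascal l)) (sym (∑-first d (λ l → e l * binomials l n))) ⟩
    (e 0 * 1ℚ + ∑ d (λ l → e (suc l) * binomials (suc l) (suc n))) - ∑ (suc d) (λ l → e l * binomials l n)
      ≡⟨ cong₂ _-_ (trans (sym (∑-first d (λ l → e l * binomials l (suc n)))) (e≡0 (suc n) (ℕ.m≤n⇒m≤1+n N≤n))) (e≡0 n N≤n) ⟩
    0ℚ ∎
    where
    T U : ℚ
    T = ∑ d (λ l → e (suc l) * binomials l n)
    U = ∑ d (λ l → e (suc l) * binomials (suc l) n)

    pascal : ∀ l → e (suc l) * binomials l n + e (suc l) * binomials (suc l) n ≡ e (suc l) * binomials (suc l) (suc n)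
    pascal l = trans (sym (*-distribˡ-+ (e (suc l)) (binomials l n) (binomials (suc l) n)))
      (cong (e (suc l) *_) (trans (sym (fromℕ-+ (n C l) (n C suc l))) (cong fromℕ (nCk+nC[k+1]≡[n+1]C[k+1] n l))))

  tail≡0 : ∀ {l} → l ℕ.≤ d → e (suc l) ≡ 0ℚ
  tail≡0 = binomials-independent d N (e ∘ suc) differences

  all≡0 : ∀ {l} → l ℕ.≤ suc d → e l ≡ 0ℚ
  all≡0 {suc l} (s≤s l≤d) = tail≡0 l≤d
  all≡0 {zero}  _         = begin
    e 0
      ≡⟨ solve 1 (λ x → x := x :* con 1ℚ :+ con 0ℚ) refl (e 0) ⟩
    e 0 * 1ℚ + 0ℚ
      ≡⟨ cong (e 0 * 1ℚ +_) (∑-zero d λ {l} l≤d → trans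
           (cong (_* binomials (suc l) N) (tail≡0 l≤d)) (*-zeroˡ (binomials (suc l) N))) ⟨
    e 0 * 1ℚ + ∑ d (λ l → e (suc l) * binomials (suc l) N)
      ≡⟨ ∑-first d (λ l → e l * binomials l N) ⟨
    ∑ (suc d) (λ l → e l * binomials l N)
      ≡⟨ e≡0 N ℕ.≤-refl ⟩
    0ℚ ∎

binomialPower-below : ∀ l e {k} → k ℕ.< l → binomialPower l e k ≡ 0ℚ
binomialPower-below (suc l) e {zero}  _         = refl
binomialPower-below (suc l) e {suc k} (s≤s k<l) = binomialPower-below l e k<l

binomialPower-diagonal : ∀ l e → binomialPower l e l ≡ 1ℚ
binomialPower-diagonal zero    zero    = refl
binomialPower-diagonal zero    (suc e) = binomialPower-diagonal zero e
binomialPower-diagonal (suc l) e       = binomialPower-diagonal l e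

-- The system is unitriangular, since x^l (1-x)^(d-l) begins with x^l. It is solved by back
-- substitution from j = d downwards, with `k` in `go` bounding the distance to d.
binomialPowers-independent : ∀ d (c : ℕ → ℚ) →
  (∀ {l} → l ℕ.≤ d → ∑ d (λ j → c j * binomialPower l (d ∸ l) j) ≡ 0ℚ) → ∀ {j} → j ℕ.≤ d → c j ≡ 0ℚ
binomialPowers-independent d c c≡0 {j} j≤d = go (suc (d ∸ j)) j≤d ℕ.≤-refl
  where
  go : ∀ k {j} → j ℕ.≤ d → d ∸ j ℕ.< k → c j ≡ 0ℚ
  go (suc k) {j} j≤d (s≤s d∸j≤k) = trans (sym (*-identityʳ (c j)))
    (trans (cong (c j *_) (sym (binomialPower-diagonal j (d ∸ j))))
      (trans (sym (∑-single j≤d λ {i} i≤d i≢j → off-diagonal i≤d i≢j)) (c≡0 j≤d)))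
    where
    off-diagonal : ∀ {i} → i ℕ.≤ d → i ≢ j → c i * binomialPower j (d ∸ j) i ≡ 0ℚ
    off-diagonal {i} i≤d i≢j with i ℕ.<? j
    ... | yes i<j = trans (cong (c i *_) (binomialPower-below j (d ∸ j) i<j)) (*-zeroʳ (c i))
    ... | no  i≮j = trans (cong (_* binomialPower j (d ∸ j) i)
        (go k i≤d (ℕ.<-≤-trans (ℕ.∸-monoʳ-< (ℕ.≤∧≢⇒< (ℕ.≮⇒≥ i≮j) (i≢j ∘ sym)) i≤d) d∸j≤k)))
      (*-zeroˡ (binomialPower j (d ∸ j) i))

skeleton : ∀ n d → SimplicialComplex n
skeleton n d = record
  { Face     = λ σ → ∣ σ ∣ ℕ.≤ d
  ; face?    = λ σ → ∣ σ ∣ ℕ.≤? d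
  ; ∅-face   = subst (ℕ._≤ d) (sym (∣⊥∣≡0 n)) z≤n
  ; ⊆-closed = λ {σ} σ⊆τ → ℕ.≤-trans (p⊆q⇒∣p∣≤∣q∣ {p = σ} σ⊆τ)
  }

skeleton-rank : ∀ s d → HasRank (skeleton (s ℕ.+ d) d) d
skeleton-rank s d = (last s , ℕ.≤-reflexive (last-size s) , last-size s) , λ _ σ≤d → σ≤d
  where
  last : ∀ s → Subset (s ℕ.+ d)
  last zero    = full
  last (suc s) = outside ∷ last s

  last-size : ∀ s → ∣ last s ∣ ≡ d
  last-size zero    = ∣⊤∣≡n d
  last-size (suc s) = last-size s

subsets-of-size : ∀ n l → Σˡ (subsets n) (λ σ → when (does (∣ σ ∣ ℕ.≟ l)) 1) ≡ n C l
subsets-of-size zero    zero    = refl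
subsets-of-size zero    (suc l) = refl
subsets-of-size (suc n) zero    = trans (Σˡ-subsets n (λ σ → when (does (∣ σ ∣ ℕ.≟ 0)) 1))
  (cong₂ ℕ._+_ (subsets-of-size n 0) (Σˡ-zero (subsets n) λ _ → refl))
subsets-of-size (suc n) (suc l) = trans (Σˡ-subsets n (λ σ → when (does (∣ σ ∣ ℕ.≟ suc l)) 1))
  (trans (cong₂ ℕ._+_ (subsets-of-size n (suc l)) (subsets-of-size n l))
    (trans (ℕ.+-comm (n C suc l) (n C l)) (nCk+nC[k+1]≡[n+1]C[k+1] n l)))

length≡Σˡ : ∀ {A : Set} (xs : List A) → length xs ≡ Σˡ xs (λ _ → 1)
length≡Σˡ []       = refl
length≡Σˡ (x ∷ xs) = cong suc (length≡Σˡ xs)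

skeleton-faces : ∀ n {d l} → l ℕ.≤ d → faces (skeleton n d) l ≡ n C l
skeleton-faces n {d} {l} l≤d = begin
  faces (skeleton n d) l
    ≡⟨ length≡Σˡ (filter (λ σ → (∣ σ ∣ ℕ.≤? d) ×-dec (∣ σ ∣ ℕ.≟ l)) (subsets n)) ⟩
  Σˡ (filter (λ σ → (∣ σ ∣ ℕ.≤? d) ×-dec (∣ σ ∣ ℕ.≟ l)) (subsets n)) (λ _ → 1)
    ≡⟨ Σˡ-filter (λ σ → (∣ σ ∣ ℕ.≤? d) ×-dec (∣ σ ∣ ℕ.≟ l)) (subsets n) (λ _ → 1) ⟩
  Σˡ (subsets n) (λ σ → when (does ((∣ σ ∣ ℕ.≤? d) ×-dec (∣ σ ∣ ℕ.≟ l))) 1)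
    ≡⟨ Σˡ-cong (subsets n) (λ {σ} _ → cong (λ b → when b 1) (does-unique ((∣ σ ∣ ℕ.≤? d) ×-dec (∣ σ ∣ ℕ.≟ l))
         (λ (_ , σ≡l) → dec-true (∣ σ ∣ ℕ.≟ l) σ≡l)
         (λ eq → let σ≡l = does-true (∣ σ ∣ ℕ.≟ l) eq in subst (ℕ._≤ d) (sym σ≡l) l≤d , σ≡l))) ⟩
  Σˡ (subsets n) (λ σ → when (does (∣ σ ∣ ℕ.≟ l)) 1)
    ≡⟨ subsets-of-size n l ⟩
  n C l ∎
  where open ≡-Reasoning

-- A functional `c` on h-vectors becomes a functional `e` on f-vectors, and the f-vector of the
-- skeleton on n vertices is C(n, 0), ..., C(n, d). Independence of the binomials gives e = 0, then
-- independence of the polynomials x^l (1-x)^(d-l) gives c = 0.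
skeleta-span : ∀ d (c : ℕ → ℚ) →
  (∀ s → ∑ d (λ j → c j * hSeq d (λ l → fromℕ (faces (skeleton (s ℕ.+ d) d) l)) j) ≡ 0ℚ) →
  ∀ {j} → j ℕ.≤ d → c j ≡ 0ℚ
skeleta-span d c c≡0 = binomialPowers-independent d c (binomials-independent d d e λ n d≤n →
  subst (λ n → ∑ d (λ l → e l * binomials l n) ≡ 0ℚ) (ℕ.m∸n+n≡m d≤n) (vanish (n ∸ d)))
  where
  open ≡-Reasoning
  e : ℕ → ℚ
  e l = ∑ d (λ j → c j * binomialPower l (d ∸ l) j)

  vanish : ∀ s → ∑ d (λ l → e l * binomials l (s ℕ.+ d)) ≡ 0ℚ
  vanish s = begin
    ∑ d (λ l → e l * binomials l (s ℕ.+ d))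
      ≡⟨ ∑-cong d (λ {l} l≤d → trans (trans (*-comm (e l) (binomials l (s ℕ.+ d)))
           (cong (λ m → fromℕ m * e l) (sym (skeleton-faces (s ℕ.+ d) l≤d)))) (sym (∑-* d (f l) (λ j → c j * b l j)))) ⟩
    ∑ d (λ l → ∑ d (λ j → f l * (c j * b l j)))
      ≡⟨ ∑-swap d d (λ l j → f l * (c j * b l j)) ⟩
    ∑ d (λ j → ∑ d (λ l → f l * (c j * b l j)))
      ≡⟨ ∑-cong d (λ {j} _ → trans (∑-cong d λ {l} _ →
           solve 3 (λ f c b → f :* (c :* b) := c :* (f :* b)) refl (f l) (c j) (b l j))
           (∑-* d (c j) (λ l → f l * b l j))) ⟩
    ∑ d (λ j → c j * hSeq d f j)
      ≡⟨ c≡0 s ⟩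
    0ℚ ∎
    where
    f : ℕ → ℚ
    f l = fromℕ (faces (skeleton (s ℕ.+ d) d) l)
    b : ℕ → Seq
    b l = binomialPower l (d ∸ l)

extend : ∀ {n} → Vector ℚ n → ℕ → ℚ
extend {n} c k with k ℕ.<? n
... | yes k<n = c (Fin.fromℕ< k<n)
... | no  _   = 0ℚ

extend-toℕ : ∀ {n} (c : Vector ℚ n) j → extend c (toℕ j) ≡ c j
extend-toℕ {n} c j with toℕ j ℕ.<? n
... | yes j<n = cong c (Fin.fromℕ<-toℕ j j<n)
... | no  j≮n = ⊥-elim (j≮n (Fin.toℕ<n j))

-- Both rows i map the h-vector of each skeleton to the same entry of the h-vector of its
-- subdivision, so their difference annihilates vectors that span.
transformationMatrix-unique : ∀ d (H : Matrix (suc d) (suc d)) → IsTransformationMatrix d H →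
  ∀ i j → H i j ≡ intervalColumn d (toℕ j) (toℕ i)
transformationMatrix-unique d H H-transforms i j = begin
  H i j                    ≡⟨ solve 2 (λ h q → h := (h :- q) :+ q) refl (H i j) (q j) ⟩
  (H i j - q j) + q j      ≡⟨ cong (_+ q j) (trans (sym (extend-toℕ c j)) (skeleta-span d (extend c) detect (ℕ.≤-pred (Fin.toℕ<n j)))) ⟩
  0ℚ + q j                 ≡⟨ +-identityˡ (q j) ⟩
  q j                      ∎
  where
  open ≡-Reasoning
  q c : Vector ℚ (suc d)
  q j = intervalColumn d (toℕ j) (toℕ i)
  c j = H i j - q j

  detect : ∀ s → ∑ d (λ j → extend c j * hSeq d (λ l → fromℕ (faces (skeleton (s ℕ.+ d) d) l)) j) ≡ 0ℚ
  detect s = begin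
    ∑ d (λ j → extend c j * h j)
      ≡⟨ sumℚ≡∑ d (λ j → extend c j * h j) ⟨
    sumℚ {suc d} (λ j → extend c (toℕ j) * h (toℕ j))
      ≡⟨ Sum.sum-cong-≗ {suc d} (λ j → trans (cong (_* h (toℕ j)) (extend-toℕ c j))
           (solve 3 (λ a b x → (a :- b) :* x := con 1ℚ :* (a :* x) :+ con (- 1ℚ) :* (x :* b)) refl (H i j) (q j) (h (toℕ j)))) ⟩
    sumℚ {suc d} (λ j → 1ℚ * (H i j * h (toℕ j)) + - 1ℚ * (h (toℕ j) * q j))
      ≡⟨ sum-linear {suc d} 1ℚ (- 1ℚ) (λ j → H i j * h (toℕ j)) (λ j → h (toℕ j) * q j) ⟩
    1ℚ * sumℚ {suc d} (λ j → H i j * h (toℕ j)) + - 1ℚ * sumℚ {suc d} (λ j → h (toℕ j) * q j)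
      ≡⟨ cong₂ (λ x y → 1ℚ * x + - 1ℚ * y)
           (trans (Sum.sum-cong-≗ {suc d} λ j → cong (H i j *_) (sym (hVector≡hSeq d Δ j))) (sym (H-transforms Δ (skeleton-rank s d) i)))
           (trans (sumℚ≡∑ d (λ j → h j * intervalColumn d j (toℕ i))) (sym (hVector-subdivision d Δ (skeleton-rank s d) i))) ⟩
    1ℚ * h′ + - 1ℚ * h′
      ≡⟨ solve 1 (λ x → con 1ℚ :* x :+ con (- 1ℚ) :* x := con 0ℚ) refl h′ ⟩
    0ℚ ∎
    where
    Δ : SimplicialComplex (s ℕ.+ d)
    Δ = skeleton (s ℕ.+ d) d
    h : Seq
    h = hSeq d (λ l → fromℕ (faces Δ l))
    h′ : ℚ
    h′ = fromℤ (hVector d (intervalSubdivision Δ) i)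

theorem4p2 : ∀ (d : ℕ) → 1 ≤ d →
    (H : Matrix (suc d) (suc d)) → IsTransformationMatrix d H → TotallyPositive H
theorem4p2 d _ H H-transforms {k} r c r↑ c↑ = subst (0ℚ ℚ.≤_)
  (det-cong λ i j → sym (transformationMatrix-unique d H H-transforms (r i) (c j)))
  (interval-totallyPositive d (toℕ ∘ r) c r↑ c↑)
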